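{- Let $\Phi=(G,\varphi)$ be a finite complex unit gain graph of order $n$ (without loops and multiple edges). Then $r(\Phi)=r(G)-2\theta(G)$ if and only if all of the following hold: (1) the cycles (if any) of $G$ are pairwise vertex-disjoint; (2) each cycle $C_p^{\varphi}$ of $\Phi$ is of Type A and has order $p\equiv 2 \pmod 4$; (3) a series of $\delta$-transformations can transform $G$ into a crucial subgraph $G_0$ that is the disjoint union of $\theta(G)$ cycles together with some isolated vertices.
   Context: A complex unit gain graph $\Phi=(G,\varphi)$ consists of a finite simple graph $G$ (the underlying graph) with vertex set $\{v_1,\dots,v_n\}$ and a gain function $\varphi$ assigning to each oriented edge $e_{ij}$ (from $v_i$ to $v_j$, where $v_iv_j\in E(G)$) a complex number of modulus $1$, with $\varphi(e_{ji})=\overline{\varphi(e_{ij})}$. The adjacency matrix $A(\Phi)$ is the Hermitian matrix with $(i,j)$ entry $\varphi(e_{ij})$ if $v_iv_j\in E(G)$ and $0$ otherwise; $r(\Phi)$ is its rank, and $r(G)$ is the rank of the $0$-$1$ adjacency matrix of $G$. $\theta(G)=|E(G)|-|V(G)|+\omega(G)$, where $\omega(G)$ is the number of connected components. Subgraphs of $\Phi$ carry the gains of $\Phi$; a cycle $C_p^\varphi$ of $\Phi$ is a cycle of $G$ with its gains. For a gain cycle $C_p^{\varphi}$ with vertices $v_1,\dots,v_p$ in cyclic order, $\varphi(C_p)=\varphi(e_{12})\varphi(e_{23})\cdots\varphi(e_{p1})$; for $p$ even it is of Type A if $\varphi(C_p)=(-1)^{p/2}$. A $\delta$-transformation of a graph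 with a pendant vertex (vertex of degree $1$) deletes a pendant vertex together with its unique neighbour. A crucial subgraph of $G$ is a graph without pendant vertices obtained from $G$ by a series of $\delta$-transformations. -}

module Defs where

open import Algebra.Bundles using (CommutativeMonoid)
open import Algebra.Bundles.Raw using (RawRing)
import Algebra.Definitions.RawSemiring as RawSemiringDefs
import Algebra.Properties.CommutativeSemigroup as CommutativeSemigroupProperties
open import Data.Bool.Base using (Bool; false; T; if_then_else_)
open import Data.Bool.Properties using (T?)
open import Data.Fin.Base as Fin using (Fin; toℕ)
import Data.Fin.Properties as Fin
open import Data.Fin.Subset using (Subset; _∈_; _∩_; _-_; ∣_∣; ⊤)
open import Data.Integer.Base as ℤ using (ℤ; +_)
open import Data.List.Base using (List; []; _∷_; length; filter; allFin; cartesianProduct)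
open import Data.List.Membership.Propositional using () renaming (_∈_ to _∈ˡ_)
open import Data.List.Membership.Propositional.Properties using (∈-allFin)
open import Data.List.Relation.Unary.Any using (here; there)
open import Data.Nat.Base as ℕ using (ℕ; suc; _⊔_)
open import Data.Nat.Divisibility using (_∣_)
open import Data.Nat.DivMod using (_mod_)
import Data.Nat.Properties as ℕ
open import Data.Product using (Σ-syntax; ∃-syntax; _×_; _,_)
open import Data.Rational.Base as ℚ using (ℚ; 0ℚ; 1ℚ; ½)
import Data.Rational.Properties as ℚ
open import Data.Sum.Base using (_⊎_; inj₁; inj₂)
open import Data.Vec.Base using (tabulate)
open import Function.Bundles using (_⇔_)
open import Function.Definitions using (Injective)
open import Level using (0ℓ)
open import Relation.Binary.Construct.Closure.ReflexiveTransitive using (Star; _◅_; _◅◅_) renaming (ε to nil)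
open import Relation.Binary.Core using (Rel)
open import Relation.Binary.Definitions using (Decidable)
open import Relation.Binary.PropositionalEquality using (_≡_; _≢_; refl; sym; trans; cong; cong₂; subst)
open import Relation.Nullary using (¬_; yes; no)
open import Relation.Nullary.Decidable using (map′; ¬?; _×-dec_; _⊎-dec_)

-- ℝ is the setoid of Cauchy sequences of rationals.

Cauchy : (ℕ → ℚ) → Set
Cauchy x = ∀ ε → 0ℚ ℚ.< ε → ∃[ N ] ∀ m n → N ℕ.≤ m → N ℕ.≤ n → ℚ.∣ x m ℚ.- x n ∣ ℚ.< ε

record ℝ : Set where
  constructor mkℝ
  field
    seq    : ℕ → ℚ
    cauchy : Cauchy seq

open ℝ

infix 4 _≈ℝ_ _≤ℝ_

record _≈ℝ_ (x y : ℝ) : Set where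
  constructor mk≈ℝ
  field
    close : ∀ ε → 0ℚ ℚ.< ε → ∃[ N ] ∀ n → N ℕ.≤ n → ℚ.∣ seq x n ℚ.- seq y n ∣ ℚ.< ε

record _≤ℝ_ (x y : ℝ) : Set where
  constructor mk≤ℝ
  field
    below : ∀ ε → 0ℚ ℚ.< ε → ∃[ N ] ∀ n → N ℕ.≤ n → seq x n ℚ.< seq y n ℚ.+ ε

constℝ : ℚ → ℝ
constℝ q = mkℝ (λ _ → q) λ ε 0<ε →
  0 , λ _ _ _ _ → subst (λ r → ℚ.∣ r ∣ ℚ.< ε) (sym (ℚ.+-inverseʳ q)) 0<ε

private
  open CommutativeSemigroupProperties
    (CommutativeMonoid.commutativeSemigroup ℚ.+-0-commutativeMonoid) using (interchange)

  half-pos : ∀ {ε} → 0ℚ ℚ.< ε → 0ℚ ℚ.< ε ℚ.* ½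
  half-pos {ε} 0<ε = subst (ℚ._< ε ℚ.* ½) (ℚ.*-zeroˡ ½) (ℚ.*-monoˡ-<-pos ½ 0<ε)

  half+half : ∀ ε → ε ℚ.* ½ ℚ.+ ε ℚ.* ½ ≡ ε
  half+half ε = trans (sym (ℚ.*-distribˡ-+ ε ½ ½))
                      (trans (cong (ε ℚ.*_) ½+½≡1) (ℚ.*-identityʳ ε))
    where
    ½+½≡1 : ½ ℚ.+ ½ ≡ 1ℚ
    ½+½≡1 = refl

  diff-+ : ∀ a b c d → (a ℚ.+ b) ℚ.- (c ℚ.+ d) ≡ (a ℚ.- c) ℚ.+ (b ℚ.- d)
  diff-+ a b c d = trans (cong (a ℚ.+ b ℚ.+_) (ℚ.neg-distrib-+ c d))
                         (interchange a b (ℚ.- c) (ℚ.- d))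

  split : ∀ a b → a ≡ (a ℚ.- b) ℚ.+ b
  split a b = sym (trans (ℚ.+-assoc a (ℚ.- b) b)
                         (trans (cong (a ℚ.+_) (ℚ.+-inverseˡ b)) (ℚ.+-identityʳ a)))

  *-diff : ∀ a b c → a ℚ.* b ℚ.- a ℚ.* c ≡ a ℚ.* (b ℚ.- c)
  *-diff a b c = trans (cong (a ℚ.* b ℚ.+_) (ℚ.neg-distribʳ-* a c))
                       (sym (ℚ.*-distribˡ-+ a b (ℚ.- c)))

  diff-* : ∀ a b c d → (a ℚ.* b) ℚ.- (c ℚ.* d) ≡ a ℚ.* (b ℚ.- d) ℚ.+ d ℚ.* (a ℚ.- c)
  diff-* a b c d =
    trans (cong (ℚ._- c ℚ.* d) (split (a ℚ.* b) (a ℚ.* d)))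
    (trans (ℚ.+-assoc (a ℚ.* b ℚ.- a ℚ.* d) (a ℚ.* d) (ℚ.- (c ℚ.* d)))
    (cong₂ ℚ._+_ (*-diff a b d)
      (trans (cong₂ ℚ._-_ (ℚ.*-comm a d) (ℚ.*-comm c d)) (*-diff d a c))))

  eventuallyBounded : ∀ x → Cauchy x →
    ∃[ B ] ∃[ N ] (0ℚ ℚ.< B) × (∀ n → N ℕ.≤ n → ℚ.∣ x n ∣ ℚ.≤ B)
  eventuallyBounded x cx with cx 1ℚ (ℚ.positive⁻¹ 1ℚ)
  ... | N , close = 1ℚ ℚ.+ ℚ.∣ x N ∣ , N
    , ℚ.+-mono-<-≤ (ℚ.positive⁻¹ 1ℚ) (ℚ.0≤∣p∣ (x N))
    , λ n N≤n → ℚ.≤-trans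
        (subst (λ r → ℚ.∣ r ∣ ℚ.≤ ℚ.∣ x n ℚ.- x N ∣ ℚ.+ ℚ.∣ x N ∣) (sym (split (x n) (x N)))
               (ℚ.∣p+q∣≤∣p∣+∣q∣ (x n ℚ.- x N) (x N)))
        (ℚ.+-monoˡ-≤ ℚ.∣ x N ∣ (ℚ.<⇒≤ (close n N N≤n ℕ.≤-refl)))

  scale : ∀ B → 0ℚ ℚ.< B → ∀ {ε} → 0ℚ ℚ.< ε → ∃[ δ ] (0ℚ ℚ.< δ) × (B ℚ.* δ ≡ ε)
  scale B 0<B {ε} 0<ε = 1/B ℚ.* ε
    , ℚ.positive⁻¹ (1/B ℚ.* ε) {{ℚ.pos*pos⇒pos 1/B {{ℚ.1/pos⇒pos B}} ε}}
    , trans (sym (ℚ.*-assoc B 1/B ε)) (trans (cong (ℚ._* ε) (ℚ.*-inverseʳ B)) (ℚ.*-identityˡ ε))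
    where
    instance
      posB = ℚ.positive 0<B
      posε = ℚ.positive 0<ε
      nzB  = ℚ.pos⇒nonZero B
    1/B = ℚ.1/ B

  ∣*∣-bound : ∀ p q B δ → 0ℚ ℚ.< B → ℚ.∣ p ∣ ℚ.≤ B → ℚ.∣ q ∣ ℚ.< δ → ℚ.∣ p ℚ.* q ∣ ℚ.< B ℚ.* δ
  ∣*∣-bound p q B δ 0<B p≤B q<δ = subst (ℚ._< B ℚ.* δ) (sym (ℚ.∣p*q∣≡∣p∣*∣q∣ p q))
    (ℚ.≤-<-trans (ℚ.*-monoʳ-≤-nonNeg ℚ.∣ q ∣ {{ℚ.nonNegative (ℚ.0≤∣p∣ q)}} p≤B)
                 (ℚ.*-monoʳ-<-pos B {{ℚ.positive 0<B}} q<δ))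

  abstract
    +-cauchy : ∀ x y → Cauchy x → Cauchy y → Cauchy (λ n → x n ℚ.+ y n)
    +-cauchy x y cx cy ε 0<ε with cx (ε ℚ.* ½) (half-pos 0<ε) | cy (ε ℚ.* ½) (half-pos 0<ε)
    ... | M , p | N , q = M ⊔ N , λ m n m≥ n≥ →
      subst (ℚ.∣ (x m ℚ.+ y m) ℚ.- (x n ℚ.+ y n) ∣ ℚ.<_) (half+half ε)
        (ℚ.≤-<-trans
          (subst (λ r → ℚ.∣ r ∣ ℚ.≤ ℚ.∣ x m ℚ.- x n ∣ ℚ.+ ℚ.∣ y m ℚ.- y n ∣)
                 (sym (diff-+ (x m) (y m) (x n) (y n)))
                 (ℚ.∣p+q∣≤∣p∣+∣q∣ (x m ℚ.- x n) (y m ℚ.- y n)))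
          (ℚ.+-mono-< (p m n (ℕ.m⊔n≤o⇒m≤o M N m≥) (ℕ.m⊔n≤o⇒m≤o M N n≥))
                      (q m n (ℕ.m⊔n≤o⇒n≤o M N m≥) (ℕ.m⊔n≤o⇒n≤o M N n≥))))

    neg-cauchy : ∀ x → Cauchy x → Cauchy (λ n → ℚ.- x n)
    neg-cauchy x cx ε 0<ε with cx ε 0<ε
    ... | N , p = N , λ m n m≥ n≥ →
      subst (ℚ._< ε)
            (sym (trans (cong ℚ.∣_∣ (sym (ℚ.neg-distrib-+ (x m) (ℚ.- x n)))) (ℚ.∣-p∣≡∣p∣ (x m ℚ.- x n))))
            (p m n m≥ n≥)

    *-cauchy : ∀ x y → Cauchy x → Cauchy y → Cauchy (λ n → x n ℚ.* y n)
    *-cauchy x y cx cy ε 0<ε with eventuallyBounded x cx | eventuallyBounded y cy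
    ... | A , Nx , 0<A , x≤A | B , Ny , 0<B , y≤B
      with scale A 0<A (half-pos 0<ε) | scale B 0<B (half-pos 0<ε)
    ... | δ , 0<δ , Aδ | η , 0<η , Bη with cy δ 0<δ | cx η 0<η
    ... | M , p | N , q = (Nx ⊔ Ny) ⊔ (M ⊔ N) , λ m n m≥ n≥ →
      subst (ℚ.∣ x m ℚ.* y m ℚ.- x n ℚ.* y n ∣ ℚ.<_)
            (trans (cong₂ ℚ._+_ Aδ Bη) (half+half ε))
        (ℚ.≤-<-trans
          (subst (λ r → ℚ.∣ r ∣ ℚ.≤ ℚ.∣ x m ℚ.* (y m ℚ.- y n) ∣ ℚ.+ ℚ.∣ y n ℚ.* (x m ℚ.- x n) ∣)
                 (sym (diff-* (x m) (y m) (x n) (y n)))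
                 (ℚ.∣p+q∣≤∣p∣+∣q∣ (x m ℚ.* (y m ℚ.- y n)) (y n ℚ.* (x m ℚ.- x n))))
          (ℚ.+-mono-<
            (∣*∣-bound (x m) (y m ℚ.- y n) A δ 0<A (x≤A m (ℕ.m⊔n≤o⇒m≤o Nx Ny (lo m≥))) (p m n (ℕ.m⊔n≤o⇒m≤o M N (hi m≥)) (ℕ.m⊔n≤o⇒m≤o M N (hi n≥))))
            (∣*∣-bound (y n) (x m ℚ.- x n) B η 0<B (y≤B n (ℕ.m⊔n≤o⇒n≤o Nx Ny (lo n≥))) (q m n (ℕ.m⊔n≤o⇒n≤o M N (hi m≥)) (ℕ.m⊔n≤o⇒n≤o M N (hi n≥))))))
      where
      lo : ∀ {k} → (Nx ⊔ Ny) ⊔ (M ⊔ N) ℕ.≤ k → Nx ⊔ Ny ℕ.≤ k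
      lo = ℕ.m⊔n≤o⇒m≤o (Nx ⊔ Ny) (M ⊔ N)
      hi : ∀ {k} → (Nx ⊔ Ny) ⊔ (M ⊔ N) ℕ.≤ k → M ⊔ N ℕ.≤ k
      hi = ℕ.m⊔n≤o⇒n≤o (Nx ⊔ Ny) (M ⊔ N)

infixl 6 _+ℝ_
infixl 7 _*ℝ_
infix  8 -ℝ_

_+ℝ_ : ℝ → ℝ → ℝ
mkℝ x cx +ℝ mkℝ y cy = mkℝ (λ n → x n ℚ.+ y n) (+-cauchy x y cx cy)

_*ℝ_ : ℝ → ℝ → ℝ
mkℝ x cx *ℝ mkℝ y cy = mkℝ (λ n → x n ℚ.* y n) (*-cauchy x y cx cy)

-ℝ_ : ℝ → ℝ
-ℝ mkℝ x cx = mkℝ (λ n → ℚ.- x n) (neg-cauchy x cx)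

0ℝ 1ℝ : ℝ
0ℝ = constℝ 0ℚ
1ℝ = constℝ 1ℚ

record ℂ : Set where
  constructor _+i_
  field
    re im : ℝ

open ℂ

infix 4 _≈ℂ_

record _≈ℂ_ (z w : ℂ) : Set where
  constructor mk≈ℂ
  field
    re-≈ : re z ≈ℝ re w
    im-≈ : im z ≈ℝ im w

conj : ℂ → ℂ
conj (a +i b) = a +i (-ℝ b)

ℂ-rawRing : RawRing 0ℓ 0ℓ
ℂ-rawRing = record
  { Carrier = ℂ
  ; _≈_     = _≈ℂ_
  ; _+_     = λ z w → (re z +ℝ re w) +i (im z +ℝ im w)
  ; _*_     = λ z w → (re z *ℝ re w +ℝ (-ℝ (im z *ℝ im w))) +i (re z *ℝ im w +ℝ im z *ℝ re w)
  ; -_      = λ z → (-ℝ re z) +i (-ℝ im z)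
  ; 0#      = 0ℝ +i 0ℝ
  ; 1#      = 1ℝ +i 0ℝ
  }

open RawRing ℂ-rawRing using () renaming
  (_*_ to _*ℂ_; -_ to -ℂ_; 0# to 0ℂ; 1# to 1ℂ) public
open RawSemiringDefs (RawRing.rawSemiring ℂ-rawRing) using ()
  renaming (sum to sumℂ; product to productℂ; _^_ to _^ℂ_) public

-- r = |z|, i.e. r is the non-negative square root of (re z)² + (im z)².
HasModulus : ℂ → ℝ → Set
HasModulus z r = (0ℝ ≤ℝ r) × (r *ℝ r ≈ℝ re z *ℝ re z +ℝ im z *ℝ im z)

Matrix : ℕ → ℕ → Set
Matrix m n = Fin m → Fin n → ℂ

LinearlyIndependent : ∀ {m k} → (Fin k → (Fin m → ℂ)) → Set
LinearlyIndependent {m} {k} v = ∀ (c : Fin k → ℂ) →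
  (∀ i → sumℂ (λ j → c j *ℂ v j i) ≈ℂ 0ℂ) → ∀ j → c j ≈ℂ 0ℂ

-- The rank is the greatest size of a linearly independent family of columns.
-- It is a relation since equality of Cauchy reals is undecidable, so that no
-- function computing the rank of an arbitrary complex matrix can be defined.
HasRank : ∀ {m n} → Matrix m n → ℕ → Set
HasRank {m} {n} A r =
    (Σ[ f ∈ (Fin r → Fin n) ] LinearlyIndependent (λ j i → A i (f j)))
  × (∀ k (f : Fin k → Fin n) → LinearlyIndependent (λ j i → A i (f j)) → k ℕ.≤ r)

record Graph (n : ℕ) : Set where
  field
    adj        : Fin n → Fin n → Bool
    adj-sym    : ∀ u v → adj u v ≡ adj v u
    adj-irrefl : ∀ v → adj v v ≡ false

  Adj : Rel (Fin n) 0ℓ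
  Adj u v = T (adj u v)

  adj? : Decidable Adj
  adj? u v = T? (adj u v)

  Connected : Rel (Fin n) 0ℓ
  Connected = Star Adj

-- Warshall's algorithm: Via l u v holds when u and v are equal or joined by
-- a walk whose interior vertices belong to the list l.
module _ {n : ℕ} (G : Graph n) where
  open Graph G

  private
    Via : List (Fin n) → Rel (Fin n) 0ℓ
    Via []      u v = (u ≡ v) ⊎ Adj u v
    Via (w ∷ l) u v = Via l u v ⊎ (Via l u w × Via l w v)

    via? : ∀ l → Decidable (Via l)
    via? []      u v = (u Fin.≟ v) ⊎-dec adj? u v
    via? (w ∷ l) u v = via? l u v ⊎-dec (via? l u w ×-dec via? l w v)

    via⇒connected : ∀ l {u v} → Via l u v → Connected u v
    via⇒connected []      (inj₁ refl)    = nil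
    via⇒connected []      (inj₂ e)       = e ◅ nil
    via⇒connected (w ∷ l) (inj₁ p)       = via⇒connected l p
    via⇒connected (w ∷ l) (inj₂ (p , q)) = via⇒connected l p ◅◅ via⇒connected l q

    base⇒via : ∀ l {u v} → Via [] u v → Via l u v
    base⇒via []      p = p
    base⇒via (w ∷ l) p = inj₁ (base⇒via l p)

    via-into : ∀ l {u w} → Via (w ∷ l) u w → Via l u w
    via-into l (inj₁ p)       = p
    via-into l (inj₂ (p , _)) = p

    via-from : ∀ l {w v} → Via (w ∷ l) w v → Via l w v
    via-from l (inj₁ p)       = p
    via-from l (inj₂ (_ , p)) = p

    via-trans : ∀ l {u w v} → w ∈ˡ l → Via l u w → Via l w v → Via l u v
    via-trans (x ∷ l) (here refl) p q = inj₂ (via-into l p , via-from l q)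
    via-trans (x ∷ l) (there w∈l) (inj₁ p)       (inj₁ q)       = inj₁ (via-trans l w∈l p q)
    via-trans (x ∷ l) (there w∈l) (inj₁ p)       (inj₂ (q , r)) = inj₂ (via-trans l w∈l p q , r)
    via-trans (x ∷ l) (there w∈l) (inj₂ (o , p)) (inj₁ q)       = inj₂ (o , via-trans l w∈l p q)
    via-trans (x ∷ l) (there w∈l) (inj₂ (o , _)) (inj₂ (_ , r)) = inj₂ (o , r)

    connected⇒via : ∀ {u v} → Connected u v → Via (allFin n) u v
    connected⇒via nil      = base⇒via (allFin n) (inj₁ refl)
    connected⇒via (e ◅ es) =
      via-trans (allFin n) (∈-allFin _) (base⇒via (allFin n) (inj₂ e)) (connected⇒via es)

  connected? : Decidable Connected
  connected? u v = map′ (via⇒connected (allFin n)) connected⇒via (via? (allFin n) u v)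

  edgeCount : ℕ
  edgeCount = length (filter (λ (u , v) → (u Fin.<? v) ×-dec adj? u v)
                             (cartesianProduct (allFin n) (allFin n)))

  -- Each component is counted once, through its vertex of least index.
  componentCount : ℕ
  componentCount = length (filter (λ v → ¬? (Fin.any? λ u → (u Fin.<? v) ×-dec connected? u v))
                                  (allFin n))

  θ : ℤ
  θ = (+ edgeCount ℤ.- + n) ℤ.+ + componentCount

  adjacencyMatrix : Matrix n n
  adjacencyMatrix u v = if adj u v then 1ℂ else 0ℂ

next : ∀ {k} → Fin (suc k) → Fin (suc k)
next {k} i = suc (toℕ i) mod suc k

-- A cycle is given by its vertices listed in cyclic order; the starting point
-- and the direction are part of the data, see SameCycle below.
record Cycle {n : ℕ} (G : Graph n) : Set where
  open Graph G
  field
    order-3 : ℕ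

  order : ℕ
  order = 3 ℕ.+ order-3

  field
    vertex     : Fin order → Fin n
    vertex-inj : Injective _≡_ _≡_ vertex
    edge       : ∀ i → Adj (vertex i) (vertex (next i))

module _ {n : ℕ} {G : Graph n} where
  open Graph G
  open Cycle

  OnCycle : Cycle G → Fin n → Set
  OnCycle C v = ∃[ i ] vertex C i ≡ v

  EdgeOf : Cycle G → Rel (Fin n) 0ℓ
  EdgeOf C u v = ∃[ i ] ((vertex C i ≡ u × vertex C (next i) ≡ v)
                       ⊎ (vertex C i ≡ v × vertex C (next i) ≡ u))

  -- Equality of cycles as subgraphs of G.
  SameCycle : Rel (Cycle G) 0ℓ
  SameCycle C D = ∀ u v → EdgeOf C u v ⇔ EdgeOf D u v

  VertexDisjoint : Rel (Cycle G) 0ℓ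
  VertexDisjoint C D = ∀ v → ¬ (OnCycle C v × OnCycle D v)

CyclesPairwiseDisjoint : ∀ {n} → Graph n → Set
CyclesPairwiseDisjoint G = ∀ (C D : Cycle G) → ¬ SameCycle C D → VertexDisjoint C D

-- Since δ-transformations only delete vertices, every graph obtained
-- from G is the induced subgraph G[S] on a set S of vertices of G.

module _ {n : ℕ} (G : Graph n) where
  open Graph G

  degreeIn : Subset n → Fin n → ℕ
  degreeIn S v = ∣ S ∩ tabulate (adj v) ∣

  Pendant : Subset n → Fin n → Set
  Pendant S v = v ∈ S × degreeIn S v ≡ 1

  data δ-Step : Rel (Subset n) 0ℓ where
    delete : ∀ {S u v} → Pendant S u → v ∈ S → Adj u v → δ-Step S ((S - u) - v)

  -- G[S] is a crucial subgraph of G.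
  Crucial : Subset n → Set
  Crucial S = Star δ-Step ⊤ S × (∀ v → ¬ Pendant S v)

  -- G[S] is the disjoint union of k cycles and some isolated vertices: it has
  -- no edges other than those of k vertex-disjoint cycles.
  CyclesAndIsolatedVertices : Subset n → ℕ → Set
  CyclesAndIsolatedVertices S k = Σ[ C ∈ (Fin k → Cycle G) ]
      (∀ i v → OnCycle (C i) v → v ∈ S)
    × (∀ i j → i ≢ j → VertexDisjoint (C i) (C j))
    × (∀ u v → u ∈ S → v ∈ S → Adj u v → ∃[ i ] EdgeOf (C i) u v)

record GainGraph (n : ℕ) : Set where
  field
    graph : Graph n
  open Graph graph
  field
    gain      : ∀ u v → Adj u v → ℂ
    gain-unit : ∀ u v (e : Adj u v) → HasModulus (gain u v e) 1ℝ
    gain-conj : ∀ u v (e : Adj u v) (e′ : Adj v u) → gain v u e′ ≈ℂ conj (gain u v e)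

module _ {n : ℕ} (Φ : GainGraph n) where
  open GainGraph Φ
  open Graph graph
  open Cycle

  gainMatrix : Matrix n n
  gainMatrix u v with adj? u v
  ... | yes e = gain u v e
  ... | no  _ = 0ℂ

  cycleGain : Cycle graph → ℂ
  cycleGain C = productℂ (λ i → gain (vertex C i) (vertex C (next i)) (edge C i))

  TypeA : Cycle graph → Set
  TypeA C = (2 ∣ order C) × (cycleGain C ≈ℂ (-ℂ 1ℂ) ^ℂ (order C ℕ./ 2))

{-# OPTIONS --safe #-}
module Submission where

-- Write d(H) = r(Φ[H]) - r(H) + 2 θ(H) for an induced subgraph H.  Deleting a vertex
-- changes a rank by at most 2, deleting a vertex of a cycle lowers θ by at least 1, and
-- a δ-transformation lowers both ranks by 2 and preserves θ in a forest; hence d ≥ 0.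
-- If d(G) = 0, all these estimates are sharp at every cycle vertex x: θ drops by exactly
-- 1 (so the cycles are disjoint), r(Φ - x) = r(Φ) (so Φ has a kernel vector that does not
-- vanish at x) and r(G - x) = r(G) - 2 (so A(G) maps some vector vanishing at x to a
-- nonzero multiple of the unit vector at x).  Therefore δ-transformations never destroy a
-- cycle and preserve d = 0.  When no pendant vertex is left there is no bridge either:
-- otherwise some cycle would have a single outgoing edge yw, and deleting y, or a cycle
-- neighbour of y, and stripping the rest of the cycle would give two subgraphs with d = 0
-- differing only in the pendant vertex y, which is impossible.  On the remaining disjoint
-- cycles the two vectors above force type A and order 2 mod 4.  Conversely, a cycle of
-- order p ≡ 2 (mod 4) has rank p, and rank p - 2 if it carries a type A gain.
--
-- Equality of complex numbers is stable under double negation, as are statements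
-- about natural numbers; this is what makes the classical linear algebra available.

open import Defs
import Data.Fin.Properties as Fin
open import Data.Nat.Properties as ℕ using (≤-refl; ≤-trans; ≤-reflexive; ≤-antisym; ≤-pred; ≤-<-trans; m≤n⇒m≤1+n)
import Relation.Binary.Definitions as B
open import Data.Empty using (⊥; ⊥-elim)
open import Data.Fin.Base as Fin using (Fin; zero; suc; toℕ)
open import Data.Fin.Subset using (Subset; _∈_; _∉_; _⊆_; ∣_∣)
open import Data.Fin.Subset.Properties
open import Data.Nat.Base as ℕ using (ℕ; zero; suc; z≤n; s≤s; _<_; _≤_; _%_; _/_)
open import Data.Product using (Σ-syntax; ∃; ∃-syntax; _×_; _,_; proj₁; proj₂)
open import Data.Sum.Base using (_⊎_; inj₁; inj₂; [_,_]′)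
open import Function.Base using (_∘_; id; case_of_)
open import Function.Bundles using (_⇔_; mk⇔; Equivalence)
open import Level using (0ℓ)
open import Relation.Binary.Construct.Closure.ReflexiveTransitive as Star using (Star; _◅_; _◅◅_) renaming (ε to nil)
open import Relation.Binary.PropositionalEquality as ≡ using (_≡_; _≢_)
open import Relation.Nullary using (¬_; yes; no; Dec; does; contradiction)
open import Relation.Nullary.Decidable using (map′; ¬?; _×-dec_; _→-dec_; decidable-stable)
open import Relation.Unary using (Decidable)

-- The difficulty lies in the equality case in the presence of bridges. The two vectors at a cycle
-- vertex determine order and gain only for a cycle that is a component, so bridges must be excluded
-- first; yet stripping a leaf cycle needs its order to be even before that is known. A second leaf
-- cycle resolves this: it lies beyond the bridge of the first one, deleting one of its vertices
-- preserves both `d = 0` and the first cycle, and the induction hypothesis for the smaller graph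
-- gives the order. Every subgraph is a vertex set of one ambient graph whose deleted vertices
-- remain as isolated ones. Thus θ is edges plus components minus the constant `n`, and all
-- estimates are inequalities between natural numbers. Ranks exist only up to double negation, which
-- suffices because every conclusion drawn from them is decidable or stable.

-- The complex numbers over the Cauchy reals as a domain with stable equality

module ComplexNumbers where

  import Data.Rational.Properties as ℚ
  open import Algebra.Bundles using (CommutativeRing)
  open import Algebra.Bundles.Raw using (RawRing)
  open import Algebra.Structures using (IsCommutativeRing)
  open import Data.Nat.Base using (_⊔_)
  open import Data.Rational.Base as ℚ using (ℚ; 0ℚ; 1ℚ; ½)
  open import Data.Rational.Solver using (module +-*-Solver)
  open ≡ using (refl; sym; trans; cong; cong₂; subst; subst₂)

  open ℝ
  open ℂ
  open _≈ℝ_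
  open _≈ℂ_

  Null : (ℕ → ℚ) → Set
  Null s = ∀ ε → 0ℚ ℚ.< ε → ∃[ N ] ∀ n → N ≤ n → ℚ.∣ s n ∣ ℚ.< ε

  half-pos : ∀ {ε} → 0ℚ ℚ.< ε → 0ℚ ℚ.< ε ℚ.* ½
  half-pos {ε} 0<ε = subst (ℚ._< ε ℚ.* ½) (ℚ.*-zeroˡ ½) (ℚ.*-monoˡ-<-pos ½ 0<ε)

  half+half : ∀ ε → ε ℚ.* ½ ℚ.+ ε ℚ.* ½ ≡ ε
  half+half = +-*-Solver.solve 1 (λ e → e :* con ½ :+ e :* con ½ := e) refl
    where open +-*-Solver

  pos*pos : ∀ {p q} → 0ℚ ℚ.< p → 0ℚ ℚ.< q → 0ℚ ℚ.< p ℚ.* q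
  pos*pos {p} {q} 0<p 0<q =
    ℚ.positive⁻¹ (p ℚ.* q) {{ℚ.pos*pos⇒pos p {{ℚ.positive 0<p}} q {{ℚ.positive 0<q}}}}

  Null-cong : ∀ {s t} → (∀ n → s n ≡ t n) → Null s → Null t
  Null-cong s≡t s ε 0<ε with s ε 0<ε
  ... | N , p = N , λ n N≤n → subst (λ r → ℚ.∣ r ∣ ℚ.< ε) (s≡t n) (p n N≤n)

  Null-0 : Null (λ _ → 0ℚ)
  Null-0 ε 0<ε = 0 , λ _ _ → 0<ε

  Null-+ : ∀ {s t} → Null s → Null t → Null (λ n → s n ℚ.+ t n)
  Null-+ {s} {t} ns nt ε 0<ε with ns (ε ℚ.* ½) (half-pos 0<ε) | nt (ε ℚ.* ½) (half-pos 0<ε)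
  ... | M , p | N , q = M ⊔ N , λ n h → subst (ℚ.∣ s n ℚ.+ t n ∣ ℚ.<_) (half+half ε)
    (ℚ.≤-<-trans (ℚ.∣p+q∣≤∣p∣+∣q∣ (s n) (t n))
      (ℚ.+-mono-< (p n (ℕ.m⊔n≤o⇒m≤o M N h)) (q n (ℕ.m⊔n≤o⇒n≤o M N h))))

  Null-neg : ∀ {s} → Null s → Null (λ n → ℚ.- s n)
  Null-neg {s} ns ε 0<ε with ns ε 0<ε
  ... | N , p = N , λ n h → subst (ℚ._< ε) (sym (ℚ.∣-p∣≡∣p∣ (s n))) (p n h)

  EventuallyBounded : (ℕ → ℚ) → Set
  EventuallyBounded x = ∃[ B ] (0ℚ ℚ.< B) × ∃[ N ] (∀ n → N ≤ n → ℚ.∣ x n ∣ ℚ.≤ B)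

  cauchy⇒bounded : ∀ x → Cauchy x → EventuallyBounded x
  cauchy⇒bounded x cx with cx 1ℚ (ℚ.positive⁻¹ 1ℚ)
  ... | N , close = 1ℚ ℚ.+ ℚ.∣ x N ∣ , ℚ.+-mono-<-≤ (ℚ.positive⁻¹ 1ℚ) (ℚ.0≤∣p∣ (x N)) , N , λ n N≤n →
    ℚ.≤-trans
      (subst (λ r → ℚ.∣ r ∣ ℚ.≤ ℚ.∣ x n ℚ.- x N ∣ ℚ.+ ℚ.∣ x N ∣) (minus-plus (x n) (x N))
             (ℚ.∣p+q∣≤∣p∣+∣q∣ (x n ℚ.- x N) (x N)))
      (ℚ.+-monoˡ-≤ ℚ.∣ x N ∣ (ℚ.<⇒≤ (close n N N≤n ≤-refl)))
    where
    open +-*-Solver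
    minus-plus : ∀ a b → (a ℚ.- b) ℚ.+ b ≡ a
    minus-plus = solve 2 (λ a b → (a :- b) :+ b := a) refl

  Null-* : ∀ {s t} → Null s → EventuallyBounded t → Null (λ n → s n ℚ.* t n)
  Null-* {s} {t} ns (B , 0<B , N , t≤B) ε 0<ε
    with ns (ε ℚ.* 1/B) (pos*pos 0<ε (ℚ.positive⁻¹ 1/B {{ℚ.1/pos⇒pos B}}))
    where
    instance
      posB = ℚ.positive 0<B
      nzB  = ℚ.pos⇒nonZero B
    1/B = ℚ.1/ B
  ... | M , p = M ⊔ N , λ n h → subst₂ ℚ._<_ (sym (ℚ.∣p*q∣≡∣p∣*∣q∣ (s n) (t n))) ε/B*B
    (ℚ.≤-<-trans (ℚ.*-monoˡ-≤-nonNeg ℚ.∣ s n ∣ {{ℚ.nonNegative (ℚ.0≤∣p∣ (s n))}} (t≤B n (ℕ.m⊔n≤o⇒n≤o M N h)))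
                 (ℚ.*-monoˡ-<-pos B (p n (ℕ.m⊔n≤o⇒m≤o M N h))))
    where
    instance
      posB = ℚ.positive 0<B
      nzB  = ℚ.pos⇒nonZero B
    ε/B*B : ε ℚ.* ℚ.1/ B ℚ.* B ≡ ε
    ε/B*B = trans (ℚ.*-assoc ε (ℚ.1/ B) B) (trans (cong (ε ℚ.*_) (ℚ.*-inverseˡ B)) (ℚ.*-identityʳ ε))

  ≈ℝ-pointwise : ∀ {x y} → (∀ n → seq x n ≡ seq y n) → x ≈ℝ y
  ≈ℝ-pointwise {x} {y} eq .close = Null-cong (λ n → sym (trans (cong (ℚ._- seq y n) (eq n)) (ℚ.+-inverseʳ (seq y n)))) Null-0

  ≈ℝ-from : ∀ {x y s} → Null s → (∀ n → s n ≡ seq x n ℚ.- seq y n) → x ≈ℝ y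
  ≈ℝ-from ns eq .close = Null-cong eq ns

  module ℚ-Solver = +-*-Solver

  ≈ℝ-refl : ∀ {x} → x ≈ℝ x
  ≈ℝ-refl = ≈ℝ-pointwise λ _ → refl

  ≈ℝ-sym : ∀ {x y} → x ≈ℝ y → y ≈ℝ x
  ≈ℝ-sym {x} {y} p = ≈ℝ-from (Null-neg (close p)) λ n →
    solve 2 (λ a b → :- (a :- b) := b :- a) refl (seq x n) (seq y n)
    where open ℚ-Solver

  ≈ℝ-trans : ∀ {x y z} → x ≈ℝ y → y ≈ℝ z → x ≈ℝ z
  ≈ℝ-trans {x} {y} {z} p q = ≈ℝ-from (Null-+ (close p) (close q)) λ n →
    solve 3 (λ a b c → (a :- b) :+ (b :- c) := a :- c) refl (seq x n) (seq y n) (seq z n)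
    where open ℚ-Solver

  +ℝ-cong : ∀ {x x′ y y′} → x ≈ℝ x′ → y ≈ℝ y′ → x +ℝ y ≈ℝ x′ +ℝ y′
  +ℝ-cong {x} {x′} {y} {y′} p q = ≈ℝ-from (Null-+ (close p) (close q)) λ n →
    solve 4 (λ a b c d → (a :- b) :+ (c :- d) := (a :+ c) :- (b :+ d)) refl (seq x n) (seq x′ n) (seq y n) (seq y′ n)
    where open ℚ-Solver

  -ℝ-cong : ∀ {x y} → x ≈ℝ y → -ℝ x ≈ℝ -ℝ y
  -ℝ-cong {x} {y} p = ≈ℝ-from (Null-neg (close p)) λ n →
    solve 2 (λ a b → :- (a :- b) := (:- a) :- (:- b)) refl (seq x n) (seq y n)
    where open ℚ-Solver

  *ℝ-cong : ∀ {x x′ y y′} → x ≈ℝ x′ → y ≈ℝ y′ → x *ℝ y ≈ℝ x′ *ℝ y′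
  *ℝ-cong {x} {x′} {y} {y′} p q = ≈ℝ-from
    (Null-+ (Null-* (close p) (cauchy⇒bounded (seq y) (cauchy y)))
            (Null-* (close q) (cauchy⇒bounded (seq x′) (cauchy x′)))) λ n →
    solve 4 (λ a b c d → (a :- b) :* c :+ (c :- d) :* b := (a :* c) :- (b :* d)) refl (seq x n) (seq x′ n) (seq y n) (seq y′ n)
    where open ℚ-Solver

  -- ¬ (x # 0) → x ≈ 0 holds constructively for Cauchy sequences (no Markov
  -- principle), and it makes _≈ℝ_ stable under double negation.
  Apart : ℝ → Set
  Apart x = ∃[ δ ] (0ℚ ℚ.< δ) × ∃[ N ] (∀ n → N ≤ n → δ ℚ.≤ ℚ.∣ seq x n ∣)

  ¬apart⇒≈0 : ∀ x → ¬ Apart x → x ≈ℝ 0ℝ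
  ¬apart⇒≈0 x ¬a .close ε 0<ε with cauchy x (ε ℚ.* ½) (half-pos 0<ε) | cauchy x (ε ℚ.* ½ ℚ.* ½) (half-pos (half-pos 0<ε))
  -- One rational term decides: if it is below `ε / 2`, the tail stays below `ε`; otherwise the tail
  -- stays at least `ε / 4` away from 0, which is apartness.
  ... | N , c | M , d with ℚ.∣ seq x (N ⊔ M) ∣ ℚ.<? ε ℚ.* ½
  ...   | yes small = N ⊔ M , λ n h → subst₂ ℚ._<_ (cong ℚ.∣_∣ (rearrange (seq x n) (seq x (N ⊔ M)))) (half+half ε)
            (ℚ.≤-<-trans (ℚ.∣p+q∣≤∣p∣+∣q∣ (seq x n ℚ.- seq x (N ⊔ M)) (seq x (N ⊔ M)))
              (ℚ.+-mono-< (c n (N ⊔ M) (ℕ.m⊔n≤o⇒m≤o N M h) (ℕ.m≤m⊔n N M)) small))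
    where
    open ℚ-Solver
    rearrange : ∀ a b → (a ℚ.- b) ℚ.+ b ≡ a ℚ.- 0ℚ
    rearrange = solve 2 (λ a b → (a :- b) :+ b := a :- con 0ℚ) refl
  ...   | no big = ⊥-elim (¬a (ε ℚ.* ½ ℚ.* ½ , half-pos (half-pos 0<ε) , N ⊔ M , λ n h →
            ℚ.≮⇒≥ λ xn<ε/4 → big (subst₂ ℚ._<_ (cong ℚ.∣_∣ (rearrange (seq x (N ⊔ M)) (seq x n))) (half+half (ε ℚ.* ½))
              (ℚ.≤-<-trans (ℚ.∣p+q∣≤∣p∣+∣q∣ (seq x (N ⊔ M) ℚ.- seq x n) (seq x n))
                (ℚ.+-mono-< (d (N ⊔ M) n (ℕ.m≤n⊔m N M) (ℕ.m⊔n≤o⇒n≤o N M h)) xn<ε/4)))))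
    where
    open ℚ-Solver
    rearrange : ∀ a b → (a ℚ.- b) ℚ.+ b ≡ a
    rearrange = solve 2 (λ a b → (a :- b) :+ b := a) refl

  apart⇒≉0 : ∀ x → Apart x → ¬ x ≈ℝ 0ℝ
  apart⇒≉0 x (δ , 0<δ , N , p) x≈0 with close x≈0 δ 0<δ
  ... | M , q = ℚ.<-irrefl refl (ℚ.≤-<-trans (p (N ⊔ M) (ℕ.m≤m⊔n N M))
    (subst (λ r → ℚ.∣ r ∣ ℚ.< δ) (ℚ.+-identityʳ (seq x (N ⊔ M))) (q (N ⊔ M) (ℕ.m≤n⊔m N M))))

  ≈0-stable : ∀ x → ¬ ¬ x ≈ℝ 0ℝ → x ≈ℝ 0ℝ
  ≈0-stable x ¬¬x≈0 = ¬apart⇒≈0 x λ a → ¬¬x≈0 (apart⇒≉0 x a)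

  apart-* : ∀ x y → Apart x → Apart y → Apart (x *ℝ y)
  apart-* x y (δ , 0<δ , M , p) (η , 0<η , N , q) = δ ℚ.* η , pos*pos 0<δ 0<η , M ⊔ N , λ n h →
    subst (δ ℚ.* η ℚ.≤_) (sym (ℚ.∣p*q∣≡∣p∣*∣q∣ (seq x n) (seq y n)))
      (ℚ.≤-trans (ℚ.*-monoˡ-≤-nonNeg δ {{ℚ.nonNegative (ℚ.<⇒≤ 0<δ)}} (q n (ℕ.m⊔n≤o⇒n≤o M N h)))
                 (ℚ.*-monoʳ-≤-nonNeg ℚ.∣ seq y n ∣ {{ℚ.nonNegative (ℚ.0≤∣p∣ (seq y n))}} (p n (ℕ.m⊔n≤o⇒m≤o M N h))))

  -- A product of reals apart from 0 is apart from 0. Apartness of `x` cannot be extracted from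
  -- `¬ x ≈ℝ 0ℝ`, but refuting it already contradicts that hypothesis.
  *ℝ-cancel : ∀ x y → x *ℝ y ≈ℝ 0ℝ → ¬ x ≈ℝ 0ℝ → y ≈ℝ 0ℝ
  *ℝ-cancel x y xy≈0 x≉0 = ¬apart⇒≈0 y λ ay → x≉0 (¬apart⇒≈0 x λ ax → apart⇒≉0 (x *ℝ y) (apart-* x y ax ay) xy≈0)

  ∣x∣*∣x∣≤x²+y² : ∀ x y → ℚ.∣ x ∣ ℚ.* ℚ.∣ x ∣ ℚ.≤ x ℚ.* x ℚ.+ y ℚ.* y
  ∣x∣*∣x∣≤x²+y² x y = ℚ.≤-trans (ℚ.≤-reflexive (sq-abs x))
    (subst (ℚ._≤ x ℚ.* x ℚ.+ y ℚ.* y) (ℚ.+-identityʳ (x ℚ.* x)) (ℚ.+-monoʳ-≤ (x ℚ.* x) (0≤sq y)))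
    where
    0≤∣a∣*∣a∣ : ∀ a → 0ℚ ℚ.≤ ℚ.∣ a ∣ ℚ.* ℚ.∣ a ∣
    0≤∣a∣*∣a∣ a = subst (ℚ._≤ ℚ.∣ a ∣ ℚ.* ℚ.∣ a ∣) (ℚ.*-zeroˡ ℚ.∣ a ∣)
      (ℚ.*-monoʳ-≤-nonNeg ℚ.∣ a ∣ {{ℚ.nonNegative (ℚ.0≤∣p∣ a)}} (ℚ.0≤∣p∣ a))
    neg*neg : ∀ a → (ℚ.- a) ℚ.* (ℚ.- a) ≡ a ℚ.* a
    neg*neg = solve 1 (λ a → (:- a) :* (:- a) := a :* a) refl
      where open ℚ-Solver
    0≤sq : ∀ a → 0ℚ ℚ.≤ a ℚ.* a
    0≤sq a with ℚ.∣p∣≡p∨∣p∣≡-p a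
    ... | inj₁ eq = subst (0ℚ ℚ.≤_) (cong₂ ℚ._*_ eq eq) (0≤∣a∣*∣a∣ a)
    ... | inj₂ eq = subst (0ℚ ℚ.≤_) (trans (cong₂ ℚ._*_ eq eq) (neg*neg a)) (0≤∣a∣*∣a∣ a)
    sq-abs : ∀ a → ℚ.∣ a ∣ ℚ.* ℚ.∣ a ∣ ≡ a ℚ.* a
    sq-abs a = trans (sym (ℚ.∣p*q∣≡∣p∣*∣q∣ a a)) (ℚ.0≤p⇒∣p∣≡p (0≤sq a))

  sum-of-squares : ∀ x y → x *ℝ x +ℝ y *ℝ y ≈ℝ 0ℝ → x ≈ℝ 0ℝ
  sum-of-squares x y s≈0 = ¬apart⇒≈0 x λ (δ , 0<δ , N , p) →
    apart⇒≉0 (x *ℝ x +ℝ y *ℝ y)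
      (δ ℚ.* δ , pos*pos 0<δ 0<δ , N , λ n N≤n →
        ℚ.≤-trans (ℚ.≤-trans (ℚ.*-monoˡ-≤-nonNeg δ {{ℚ.nonNegative (ℚ.<⇒≤ 0<δ)}} (p n N≤n))
                   (ℚ.*-monoʳ-≤-nonNeg ℚ.∣ seq x n ∣ {{ℚ.nonNegative (ℚ.0≤∣p∣ (seq x n))}} (p n N≤n)))
         (ℚ.≤-trans (∣x∣*∣x∣≤x²+y² (seq x n) (seq y n)) (p≤∣p∣ _)))
      s≈0
    where
    p≤∣p∣ : ∀ p → p ℚ.≤ ℚ.∣ p ∣
    p≤∣p∣ p with ℚ.≤-total 0ℚ p
    ... | inj₁ 0≤p = ℚ.≤-reflexive (sym (ℚ.0≤p⇒∣p∣≡p 0≤p))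
    ... | inj₂ p≤0 = ℚ.≤-trans p≤0 (ℚ.0≤∣p∣ p)

  open RawRing ℂ-rawRing using () renaming (_+_ to _+ℂ_)

  Re Im : ℂ → ℕ → ℚ
  Re z = seq (re z)
  Im z = seq (im z)

  ≈ℂ-pointwise : ∀ {z w} → (∀ n → Re z n ≡ Re w n) → (∀ n → Im z n ≡ Im w n) → z ≈ℂ w
  ≈ℂ-pointwise p q = mk≈ℂ (≈ℝ-pointwise p) (≈ℝ-pointwise q)

  open ℚ-Solver using (solve; _:=_; _:+_; _:*_; :-_; _:-_; con)

  -- The laws are abstract so that normalising a term mentioning the ring ℂ does
  -- not unfold their proofs.
  abstract
    ℂ-isCommutativeRing : IsCommutativeRing _≈ℂ_ _+ℂ_ _*ℂ_ -ℂ_ 0ℂ 1ℂ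
    ℂ-isCommutativeRing = record
      { isRing = record
        { +-isAbelianGroup = record
          { isGroup = record
            { isMonoid = record
              { isSemigroup = record
                { isMagma = record
                  { isEquivalence = record
                    { refl = mk≈ℂ ≈ℝ-refl ≈ℝ-refl
                    ; sym = λ p → mk≈ℂ (≈ℝ-sym (re-≈ p)) (≈ℝ-sym (im-≈ p))
                    ; trans = λ p q → mk≈ℂ (≈ℝ-trans (re-≈ p) (re-≈ q)) (≈ℝ-trans (im-≈ p) (im-≈ q))
                    }
                  ; ∙-cong = λ p q → mk≈ℂ (+ℝ-cong (re-≈ p) (re-≈ q)) (+ℝ-cong (im-≈ p) (im-≈ q))
                  }
                ; assoc = λ x y z → ≈ℂ-pointwise
                    (λ n → ℚ.+-assoc (Re x n) (Re y n) (Re z n))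
                    (λ n → ℚ.+-assoc (Im x n) (Im y n) (Im z n))
                }
              ; identity = (λ x → ≈ℂ-pointwise (λ n → ℚ.+-identityˡ _) (λ n → ℚ.+-identityˡ _))
                         , (λ x → ≈ℂ-pointwise (λ n → ℚ.+-identityʳ _) (λ n → ℚ.+-identityʳ _))
              }
            ; inverse = (λ x → ≈ℂ-pointwise (λ n → ℚ.+-inverseˡ (Re x n)) (λ n → ℚ.+-inverseˡ (Im x n)))
                      , (λ x → ≈ℂ-pointwise (λ n → ℚ.+-inverseʳ (Re x n)) (λ n → ℚ.+-inverseʳ (Im x n)))
            ; ⁻¹-cong = λ p → mk≈ℂ (-ℝ-cong (re-≈ p)) (-ℝ-cong (im-≈ p))
            }
          ; comm = λ x y → ≈ℂ-pointwise (λ n → ℚ.+-comm (Re x n) (Re y n))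
                                        (λ n → ℚ.+-comm (Im x n) (Im y n))
          }
        ; *-cong = λ p q → mk≈ℂ
            (+ℝ-cong (*ℝ-cong (re-≈ p) (re-≈ q)) (-ℝ-cong (*ℝ-cong (im-≈ p) (im-≈ q))))
            (+ℝ-cong (*ℝ-cong (re-≈ p) (im-≈ q)) (*ℝ-cong (im-≈ p) (re-≈ q)))
        ; *-assoc = λ x y z → ≈ℂ-pointwise
            (λ n → solve 6 (λ a b c d e f → (a :* c :+ (:- (b :* d))) :* e :+ (:- ((a :* d :+ b :* c) :* f))
                             := a :* (c :* e :+ (:- (d :* f))) :+ (:- (b :* (c :* f :+ d :* e)))) refl
                     (Re x n) (Im x n) (Re y n) (Im y n) (Re z n) (Im z n))
            (λ n → solve 6 (λ a b c d e f → (a :* c :+ (:- (b :* d))) :* f :+ (a :* d :+ b :* c) :* e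
                             := a :* (c :* f :+ d :* e) :+ b :* (c :* e :+ (:- (d :* f)))) refl
                     (Re x n) (Im x n) (Re y n) (Im y n) (Re z n) (Im z n))
        ; *-identity =
            (λ x → ≈ℂ-pointwise
              (λ n → solve 2 (λ a b → con 1ℚ :* a :+ (:- (con 0ℚ :* b)) := a) refl (Re x n) (Im x n))
              (λ n → solve 2 (λ a b → con 1ℚ :* b :+ con 0ℚ :* a := b) refl (Re x n) (Im x n)))
          , (λ x → ≈ℂ-pointwise
              (λ n → solve 2 (λ a b → a :* con 1ℚ :+ (:- (b :* con 0ℚ)) := a) refl (Re x n) (Im x n))
              (λ n → solve 2 (λ a b → a :* con 0ℚ :+ b :* con 1ℚ := b) refl (Re x n) (Im x n)))
        ; distrib =
            (λ x y z → ≈ℂ-pointwise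
              (λ n → solve 6 (λ a b c d e f → a :* (c :+ e) :+ (:- (b :* (d :+ f)))
                               := (a :* c :+ (:- (b :* d))) :+ (a :* e :+ (:- (b :* f)))) refl
                     (Re x n) (Im x n) (Re y n) (Im y n) (Re z n) (Im z n))
              (λ n → solve 6 (λ a b c d e f → a :* (d :+ f) :+ b :* (c :+ e)
                               := (a :* d :+ b :* c) :+ (a :* f :+ b :* e)) refl
                     (Re x n) (Im x n) (Re y n) (Im y n) (Re z n) (Im z n)))
          , (λ x y z → ≈ℂ-pointwise
              (λ n → solve 6 (λ a b c d e f → (c :+ e) :* a :+ (:- ((d :+ f) :* b))
                               := (c :* a :+ (:- (d :* b))) :+ (e :* a :+ (:- (f :* b)))) refl
                     (Re x n) (Im x n) (Re y n) (Im y n) (Re z n) (Im z n))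
              (λ n → solve 6 (λ a b c d e f → (c :+ e) :* b :+ (d :+ f) :* a
                               := (c :* b :+ d :* a) :+ (e :* b :+ f :* a)) refl
                     (Re x n) (Im x n) (Re y n) (Im y n) (Re z n) (Im z n)))
        }
      ; *-comm = λ x y → ≈ℂ-pointwise
          (λ n → solve 4 (λ a b c d → a :* c :+ (:- (b :* d)) := c :* a :+ (:- (d :* b))) refl
                   (Re x n) (Im x n) (Re y n) (Im y n))
          (λ n → solve 4 (λ a b c d → a :* d :+ b :* c := c :* b :+ d :* a) refl
                   (Re x n) (Im x n) (Re y n) (Im y n))
      }

  ℂ-commutativeRing : CommutativeRing 0ℓ 0ℓ
  ℂ-commutativeRing = record { isCommutativeRing = ℂ-isCommutativeRing }

  abstract
    ℂ-≈0-stable : ∀ z → ¬ ¬ z ≈ℂ 0ℂ → z ≈ℂ 0ℂ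
    ℂ-≈0-stable z ¬¬p = mk≈ℂ (≈0-stable (re z) λ ¬q → ¬¬p λ p → ¬q (re-≈ p))
                              (≈0-stable (im z) λ ¬q → ¬¬p λ p → ¬q (im-≈ p))

    normSq : ℂ → ℝ
    normSq z = re z *ℝ re z +ℝ im z *ℝ im z

    normSq≈0⇒≈0 : ∀ z → normSq z ≈ℝ 0ℝ → z ≈ℂ 0ℂ
    normSq≈0⇒≈0 z p = mk≈ℂ (sum-of-squares (re z) (im z) p)
      (sum-of-squares (im z) (re z) (≈ℝ-trans (≈ℝ-pointwise λ n → ℚ.+-comm (Im (z) n ℚ.* Im z n) (Re (z) n ℚ.* Re z n)) p))

    -- The squared modulus is multiplicative, which reduces cancellation to the reals.
    ℂ-cancel : ∀ z w → z *ℂ w ≈ℂ 0ℂ → ¬ z ≈ℂ 0ℂ → w ≈ℂ 0ℂ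
    ℂ-cancel z w zw≈0 z≉0 = normSq≈0⇒≈0 w (*ℝ-cancel (normSq z) (normSq w)
      (≈ℝ-trans (≈ℝ-pointwise λ n → solve 4 (λ a b c d → (a :* a :+ b :* b) :* (c :* c :+ d :* d)
           := (a :* c :+ (:- (b :* d))) :* (a :* c :+ (:- (b :* d))) :+ (a :* d :+ b :* c) :* (a :* d :+ b :* c)) refl
                     (Re z n) (Im z n) (Re w n) (Im w n))
        (≈ℝ-trans (+ℝ-cong (*ℝ-cong (re-≈ zw≈0) (re-≈ zw≈0)) (*ℝ-cong (im-≈ zw≈0) (im-≈ zw≈0)))
          (≈ℝ-pointwise λ _ → refl)))
      (z≉0 ∘ normSq≈0⇒≈0 z))

    1≉0 : ¬ 1ℂ ≈ℂ 0ℂ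
    1≉0 p = apart⇒≉0 1ℝ (1ℚ , ℚ.positive⁻¹ 1ℚ , 0 , λ _ _ → ℚ.≤-refl) (re-≈ p)

    1+1≉0 : ¬ 1ℂ +ℂ 1ℂ ≈ℂ 0ℂ
    1+1≉0 p = apart⇒≉0 (1ℝ +ℝ 1ℝ) (1ℚ ℚ.+ 1ℚ , ℚ.positive⁻¹ (1ℚ ℚ.+ 1ℚ) , 0 , λ _ _ → ℚ.≤-refl) (re-≈ p)

    unit*conj≈1 : ∀ z → HasModulus z 1ℝ → z *ℂ conj z ≈ℂ 1ℂ
    unit*conj≈1 z (_ , 1≈∣z∣²) = mk≈ℂ
      (≈ℝ-trans (≈ℝ-pointwise λ n → solve 2 (λ a b → a :* a :+ (:- (b :* (:- b))) := a :* a :+ b :* b) refl (Re z n) (Im z n))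
        (≈ℝ-trans (≈ℝ-sym 1≈∣z∣²) (≈ℝ-pointwise λ _ → refl)))
      (≈ℝ-pointwise λ n → solve 2 (λ a b → a :* (:- b) :+ b :* a := con 0ℚ) refl (Re z n) (Im z n))

-- Finite vertex sets, their enumerations and bounded maxima

module Subsets where

  open import Data.Fin.Subset using (_∪_; _-_; ⁅_⁆; inside; outside)
  open import Data.Vec.Base using (_∷_; tabulate; here; there)
  open import Data.Vec.Properties using (lookup∘tabulate; []=⇒lookup; lookup⇒[]=)
  open import Relation.Nullary.Decidable using (dec-true)
  open ≡ using (refl; sym; trans; cong)

  ∈-remove⁻ : ∀ {n} (S : Subset n) {x v} → v ∈ S - x → v ∈ S × v ≢ x
  ∈-remove⁻ S {x} v∈ = p─q⊆p S ⁅ x ⁆ v∈ , λ { refl → v∉ S v∈ }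
    where
    v∉ : ∀ {n} (S : Subset n) {v} → v ∉ S - v
    v∉ (s ∷ S) {zero}  ()
    v∉ (s ∷ S) {suc v} (there p) = v∉ S p

  ∈-remove⁺ : ∀ {n} {S : Subset n} {x v} → v ∈ S → v ≢ x → v ∈ S - x
  ∈-remove⁺ = x∈p∧x≢y⇒x∈p-y

  remove⊆ : ∀ {n} (S : Subset n) x → S - x ⊆ S
  remove⊆ S x = proj₁ ∘ ∈-remove⁻ S

  ∣∣-remove : ∀ {n} (S : Subset n) {x} → x ∈ S → ∣ S ∣ ≡ suc ∣ S - x ∣
  ∣∣-remove (s ∷ S) here = cong suc (cong ∣_∣ (sym (p─⊥≡p S)))
  ∣∣-remove (inside  ∷ S) (there p) = cong suc (∣∣-remove S p)
  ∣∣-remove (outside ∷ S) (there p) = ∣∣-remove S p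

  ∣∣≤1+∣remove∣ : ∀ {n} (S : Subset n) x → ∣ S ∣ ≤ suc ∣ S - x ∣
  ∣∣≤1+∣remove∣ S x with x ∈? S
  ... | yes x∈S = ≤-reflexive (∣∣-remove S x∈S)
  ... | no  x∉S = ℕ.m≤n⇒m≤1+n (p⊆q⇒∣p∣≤∣q∣ {p = S} {q = S - x} λ v∈ → ∈-remove⁺ v∈ λ { refl → x∉S v∈ })

  infixl 5 _▻_
  _▻_ : ∀ {n} → Subset n → Fin n → Subset n
  S ▻ x = S ∪ ⁅ x ⁆

  ∈-add⁻ : ∀ {n} (S : Subset n) {x v} → v ∈ S ▻ x → v ∈ S ⊎ v ≡ x
  ∈-add⁻ S {x} v∈ = [ inj₁ , inj₂ ∘ x∈⁅y⁆⇒x≡y x ]′ (x∈p∪q⁻ S ⁅ x ⁆ v∈)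

  ∈-add⁺ˡ : ∀ {n} {S : Subset n} {x v} → v ∈ S → v ∈ S ▻ x
  ∈-add⁺ˡ v∈ = x∈p∪q⁺ (inj₁ v∈)

  ∈-add⁺ʳ : ∀ {n} {S : Subset n} {x} → x ∈ S ▻ x
  ∈-add⁺ʳ {x = x} = x∈p∪q⁺ (inj₂ (x∈⁅x⁆ x))

  ∣∣-add : ∀ {n} (S : Subset n) {x} → x ∉ S → ∣ S ▻ x ∣ ≡ suc ∣ S ∣
  ∣∣-add S {x} x∉S = trans (∣∣-remove (S ▻ x) ∈-add⁺ʳ) (cong (suc ∘ ∣_∣) (⊆-antisym to from))
    where
    to : (S ▻ x) - x ⊆ S
    to v∈ with ∈-remove⁻ (S ▻ x) v∈
    ... | v∈▻ , v≢x = [ id , (λ eq → contradiction eq v≢x) ]′ (∈-add⁻ S v∈▻)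
    from : S ⊆ (S ▻ x) - x
    from v∈ = ∈-remove⁺ (∈-add⁺ˡ v∈) λ { refl → x∉S v∈ }

  ⟦_⟧ : ∀ {n} → {P : Fin n → Set} → Decidable P → Subset n
  ⟦ P? ⟧ = tabulate (does ∘ P?)

  ∈-⟦⟧⁺ : ∀ {n} {P : Fin n → Set} (P? : Decidable P) {v} → P v → v ∈ ⟦ P? ⟧
  ∈-⟦⟧⁺ P? {v} pv = lookup⇒[]= v _ (trans (lookup∘tabulate _ v) (dec-true (P? v) pv))

  ∈-⟦⟧⁻ : ∀ {n} {P : Fin n → Set} (P? : Decidable P) {v} → v ∈ ⟦ P? ⟧ → P v
  ∈-⟦⟧⁻ P? {v} v∈ with P? v | trans (sym (lookup∘tabulate (does ∘ P?) v)) ([]=⇒lookup v∈)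
  ... | yes pv | _  = pv
  ... | no  _  | ()

  enum : ∀ {n} → (S : Subset n) → Fin ∣ S ∣ → Fin n
  enum (inside  ∷ S) zero    = zero
  enum (inside  ∷ S) (suc i) = suc (enum S i)
  enum (outside ∷ S) i       = suc (enum S i)

  enum-injective : ∀ {n} (S : Subset n) {i j} → enum S i ≡ enum S j → i ≡ j
  enum-injective (inside  ∷ S) {zero}  {zero}  eq = refl
  enum-injective (inside  ∷ S) {suc i} {suc j} eq = cong suc (enum-injective S (Fin.suc-injective eq))
  enum-injective (outside ∷ S) eq = enum-injective S (Fin.suc-injective eq)

  enum-∈ : ∀ {n} (S : Subset n) i → enum S i ∈ S
  enum-∈ (inside  ∷ S) zero    = here
  enum-∈ (inside  ∷ S) (suc i) = there (enum-∈ S i)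
  enum-∈ (outside ∷ S) i       = there (enum-∈ S i)

  enum-surjective : ∀ {n} (S : Subset n) {v} → v ∈ S → ∃[ i ] enum S i ≡ v
  enum-surjective (inside  ∷ S) here      = zero , refl
  enum-surjective (inside  ∷ S) (there p) with enum-surjective S p
  ... | i , eq = suc i , cong suc eq
  enum-surjective (outside ∷ S) (there p) with enum-surjective S p
  ... | i , eq = i , cong suc eq

  image : ∀ {n} {k} → (Fin k → Fin n) → Subset n
  image f = ⟦ (λ v → Fin.any? λ j → f j Fin.≟ v) ⟧

  ∈-image⁺ : ∀ {n} {k} (f : Fin k → Fin n) a → f a ∈ image f
  ∈-image⁺ f a = ∈-⟦⟧⁺ (λ v → Fin.any? λ j → f j Fin.≟ v) (a , refl)

  ∈-image⁻ : ∀ {n} {k} (f : Fin k → Fin n) {v} → v ∈ image f → ∃[ a ] f a ≡ v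
  ∈-image⁻ f = ∈-⟦⟧⁻ (λ v → Fin.any? λ j → f j Fin.≟ v)

  image-size : ∀ {n} {k} (f : Fin k → Fin n) (S : Subset n) →
    (∀ {a b} → f a ≡ f b → a ≡ b) → (∀ a → f a ∈ S) → k ≤ ∣ S ∣
  image-size f S f-inj f∈ = Fin.injective⇒≤ {f = λ a → proj₁ (enum-surjective S (f∈ a))} λ {a} {b} eq →
    f-inj (trans (sym (proj₂ (enum-surjective S (f∈ a)))) (trans (cong (enum S) eq) (proj₂ (enum-surjective S (f∈ b)))))

  -- `P` will be an undecidable independence statement. Under the assumption that no maximum exists,
  -- every witness yields a larger one; `go` counts down the distance `d` to the bound.
  ¬¬-maximum : ∀ (P : ℕ → Set) b → P 0 → (∀ r → P r → r ≤ b) →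
    ¬ ¬ (∃[ r ] P r × (∀ s → P s → s ≤ r))
  ¬¬-maximum P b P0 bounded ¬max = go b 0 P0 (ℕ.m≤m+n b 0)
    where
    go : ∀ d r → P r → b ≤ d ℕ.+ r → ⊥
    go zero r Pr b≤r = ¬max (r , Pr , λ s Ps → ≤-trans (bounded s Ps) b≤r)
    go (suc d) r Pr b≤ = ¬max (r , Pr , λ s Ps → ℕ.≮⇒≥ λ r<s →
      go d s Ps (≤-trans b≤ (≤-trans (≤-reflexive (sym (ℕ.+-suc d r))) (ℕ.+-monoʳ-≤ d r<s))))

-- Linear algebra over a stable domain: ranks of principal submatrices under vertex deletion

module LinearAlgebra where

  import Algebra.Properties.Ring
  import Algebra.Properties.Semiring.Sum
  import Relation.Binary.Reasoning.Setoid
  open import Algebra.Bundles using (CommutativeRing)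
  open import Data.Bool.Base using (if_then_else_)
  open import Data.Fin.Subset using (_-_) renaming (⊤ to full; ⊥ to empty)
  open Subsets

  -- Cancellation takes the place of division: dependencies are combined by cross-multiplication,
  -- and coefficients are shown to vanish by refuting that they do not.
  record StableDomain : Set₁ where
    field
      commutativeRing : CommutativeRing 0ℓ 0ℓ

    open CommutativeRing commutativeRing hiding (_-_; zero) public

    field
      ≈0-stable : ∀ x → ¬ ¬ x ≈ 0# → x ≈ 0#
      cancel    : ∀ x y → x * y ≈ 0# → ¬ x ≈ 0# → y ≈ 0#
      1≉0       : ¬ 1# ≈ 0#

  module Domain (K : StableDomain) where
    open StableDomain K
    open Algebra.Properties.Ring ring
    open Algebra.Properties.Semiring.Sum semiring public
    open Relation.Binary.Reasoning.Setoid setoid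

    ≈-stable : ∀ x y → ¬ ¬ x ≈ y → x ≈ y
    ≈-stable x y ¬¬p = begin
      x             ≈⟨ sym (+-identityʳ x) ⟩
      x + 0#        ≈⟨ +-congˡ (sym (-‿inverseˡ y)) ⟩
      x + (- y + y) ≈⟨ sym (+-assoc x (- y) y) ⟩
      x + - y + y   ≈⟨ +-congʳ (≈0-stable (x + - y) λ ¬q → ¬¬p λ p → ¬q (trans (+-congʳ p) (-‿inverseʳ y))) ⟩
      0# + y        ≈⟨ +-identityˡ y ⟩
      y             ∎

    cancelʳ : ∀ x y → x * y ≈ 0# → ¬ y ≈ 0# → x ≈ 0#
    cancelʳ x y xy≈0 = cancel y x (trans (*-comm y x) xy≈0)

    0*≈0 : ∀ {x y} → x ≈ 0# → x * y ≈ 0#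
    0*≈0 p = trans (*-congʳ p) (zeroˡ _)

    *0≈0 : ∀ {x y} → y ≈ 0# → x * y ≈ 0#
    *0≈0 p = trans (*-congˡ p) (zeroʳ _)

    sum-zero : ∀ {n} {t : Fin n → Carrier} → (∀ j → t j ≈ 0#) → sum t ≈ 0#
    sum-zero {n} p = trans (sum-cong-≋ p) (sum-replicate-zero n)

    sum-single : ∀ {n} (t : Fin n → Carrier) a → (∀ j → j ≢ a → t j ≈ 0#) → sum t ≈ t a
    sum-single {suc n} t zero p =
      trans (+-congˡ (sum-zero {t = t ∘ suc} λ j → p (suc j) λ ())) (+-identityʳ _)
    sum-single {suc n} t (suc a) p =
      trans (+-cong (p zero λ ()) (sum-single (t ∘ suc) a λ j j≢a → p (suc j) (j≢a ∘ Fin.suc-injective))) (+-identityˡ _)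

    delta : ∀ {n} → Fin n → Carrier → Fin n → Carrier
    delta a x j = if does (j Fin.≟ a) then x else 0#

    delta-≢ : ∀ {n} {a j : Fin n} {x} → j ≢ a → delta a x j ≈ 0#
    delta-≢ {a = a} {j} j≢a with j Fin.≟ a
    ... | yes j≡a = contradiction j≡a j≢a
    ... | no  _   = refl

    delta-≡ : ∀ {n} (a : Fin n) {x} → delta a x a ≈ x
    delta-≡ a with a Fin.≟ a
    ... | yes _   = refl
    ... | no  a≢a = contradiction ≡.refl a≢a

    sum-two : ∀ {n} (t : Fin n → Carrier) {a b} → a ≢ b → (∀ j → j ≢ a → j ≢ b → t j ≈ 0#) → sum t ≈ t a + t b
    sum-two t {a} {b} a≢b p = begin
      sum t                                            ≈⟨ sum-cong-≋ split ⟩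
      sum (λ j → delta a (t a) j + delta b (t b) j)    ≈⟨ ∑-distrib-+ (delta a (t a)) (delta b (t b)) ⟩
      sum (delta a (t a)) + sum (delta b (t b))        ≈⟨ +-cong (trans (sum-single _ a λ _ → delta-≢) (delta-≡ a))
                                                                 (trans (sum-single _ b λ _ → delta-≢) (delta-≡ b)) ⟩
      t a + t b                                        ∎
      where
      split : ∀ j → t j ≈ delta a (t a) j + delta b (t b) j
      split j with j Fin.≟ a | j Fin.≟ b
      ... | yes ≡.refl | yes ≡.refl = contradiction ≡.refl a≢b
      ... | yes ≡.refl | no  _      = sym (+-identityʳ _)
      ... | no  _      | yes ≡.refl = sym (+-identityˡ _)
      ... | no  j≢a    | no  j≢b    = trans (p j j≢a j≢b) (sym (+-identityˡ _))

    Mat : ℕ → ℕ → Set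
    Mat m n = Fin m → Fin n → Carrier

    module Rank {n : ℕ} (M : Mat n n) where

      mv : (Fin n → Carrier) → Fin n → Carrier
      mv k i = sum (λ j → k j * M i j)

      mv-cong : ∀ {k l} → (∀ j → k j ≈ l j) → ∀ i → mv k i ≈ mv l i
      mv-cong p i = sum-cong-≋ λ j → *-congʳ (p j)

      mv-linear : ∀ α β k l i → mv (λ j → α * k j + β * l j) i ≈ α * mv k i + β * mv l i
      mv-linear α β k l i = begin
        sum (λ j → (α * k j + β * l j) * M i j)                          ≈⟨ sum-cong-≋ (λ j → distribʳ (M i j) (α * k j) (β * l j)) ⟩
        sum (λ j → α * k j * M i j + β * l j * M i j)                    ≈⟨ sum-cong-≋ (λ j → +-cong (*-assoc α (k j) (M i j)) (*-assoc β (l j) (M i j))) ⟩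
        sum (λ j → α * (k j * M i j) + β * (l j * M i j))                ≈⟨ ∑-distrib-+ (λ j → α * (k j * M i j)) (λ j → β * (l j * M i j)) ⟩
        sum (λ j → α * (k j * M i j)) + sum (λ j → β * (l j * M i j))    ≈⟨ sym (+-cong (*-distribˡ-sum α (λ j → k j * M i j)) (*-distribˡ-sum β (λ j → l j * M i j))) ⟩
        α * mv k i + β * mv l i                                          ∎

      Supp : (Fin n → Carrier) → Subset n → Set
      Supp k T = ∀ j → j ∉ T → k j ≈ 0#

      Ker : Subset n → (Fin n → Carrier) → Set
      Ker S k = ∀ i → i ∈ S → mv k i ≈ 0#

      -- Independence of the columns `T` of the submatrix with rows `S`. Vectors keep length `n` and
      -- are confined by their support, so passing to a subgraph requires no reindexing.
      Indep : Subset n → Subset n → Set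
      Indep S T = T ⊆ S × (∀ k → Supp k T → Ker S k → ∀ j → k j ≈ 0#)

      record HasRankOn (S : Subset n) (r : ℕ) : Set where
        constructor mkRank
        field
          basis   : ∃[ T ] Indep S T × ∣ T ∣ ≡ r
          maximal : ∀ T → Indep S T → ∣ T ∣ ≤ r

      open HasRankOn

      rank-unique : ∀ {S r s} → HasRankOn S r → HasRankOn S s → r ≡ s
      rank-unique (mkRank (T , ind , ≡.refl) max) (mkRank (T′ , ind′ , ≡.refl) max′) =
        ≤-antisym (max′ T ind) (max T′ ind′)

      indep-empty : ∀ S → Indep S empty
      indep-empty S = (λ v∈ → contradiction v∈ ∉⊥) , λ k supp _ j → supp j ∉⊥

      ¬¬-rank : ∀ S → ¬ ¬ (∃[ r ] HasRankOn S r)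
      ¬¬-rank S ¬rank = ¬¬-maximum (λ r → ∃[ T ] Indep S T × ∣ T ∣ ≡ r) n
        (empty , indep-empty S , ∣⊥∣≡0 n) (λ { _ (T , _ , ≡.refl) → ∣p∣≤n T })
        λ (r , Pr , max) → ¬rank (r , mkRank Pr λ T ind → max ∣ T ∣ (T , ind , ≡.refl))

      with-rank : ∀ {P : Set} S → Dec P → (∀ r → HasRankOn S r → P) → P
      with-rank S P? h = decidable-stable P? λ ¬P → ¬¬-rank S λ (r , rk) → ¬P (h r rk)

      dependency : ∀ {S T} → T ⊆ S → ¬ Indep S T →
        ¬ ¬ (∃[ k ] Supp k T × Ker S k × ∃[ j ] ¬ k j ≈ 0#)
      dependency T⊆S ¬ind ¬dep = ¬ind (T⊆S , λ k supp ker j →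
        ≈0-stable (k j) λ kj≉0 → ¬dep (k , supp , ker , j , kj≉0))

      indep-mono : ∀ {S x T} → Indep (S - x) T → Indep S T
      indep-mono {S} {x} (T⊆ , ind) = remove⊆ S x ∘ T⊆ , λ k supp ker → ind k supp λ i i∈ → ker i (remove⊆ S x i∈)

      ker-extend : ∀ {S x k} → Ker (S - x) k → mv k x ≈ 0# → Ker S k
      ker-extend {x = x} ker kx i i∈S with i Fin.≟ x
      ... | yes ≡.refl = kx
      ... | no  i≢x    = ker i (∈-remove⁺ i∈S i≢x)

      -- One element of `T` is lost with column `x`, and at most one more with row `x`, because a
      -- dependency that only row `x` rules out is unique up to scaling.
      indep-remove : ∀ {S T r} x → (∀ T′ → Indep (S - x) T′ → ∣ T′ ∣ ≤ r) → Indep S T → ∣ T ∣ ≤ 2 ℕ.+ r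
      indep-remove {S} {T} {r} x max (T⊆S , ind) = decidable-stable (_ ℕ.≤? _) λ |T|≰ →
        dependency T₁⊆ (λ ind₁ → |T|≰ (ℕ.m≤n⇒m≤1+n (≤-trans (∣∣≤1+∣remove∣ T x) (s≤s (max T₁ ind₁)))))
        λ (c , csupp , cker , j₀ , cj₀≉0) → |T|≰ (≤-trans (∣∣≤1+∣remove∣ T x)
          (s≤s (≤-trans (∣∣≤1+∣remove∣ T₁ j₀) (s≤s (max (T₁ - j₀) (drop c csupp cker j₀ cj₀≉0))))))
        where
        T₁ = T - x
        T₁⊆ : T₁ ⊆ S - x
        T₁⊆ v∈ = let v∈T , v≢x = ∈-remove⁻ T v∈ in ∈-remove⁺ (T⊆S v∈T) v≢x
        -- c is a dependency among the truncated columns; combining it with any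
        -- other dependency d so as to cancel row x shows that d vanishes on row x.
        drop : ∀ c → Supp c T₁ → Ker (S - x) c → ∀ j₀ → ¬ c j₀ ≈ 0# → Indep (S - x) (T₁ - j₀)
        drop c csupp cker j₀ cj₀≉0 = T₁⊆ ∘ remove⊆ T₁ j₀ , λ d dsupp dker →
          let
            α = mv d x
            β = mv c x
            e = λ j → β * d j + (- α) * c j
            dsupp₁ : Supp d T₁
            dsupp₁ = λ j j∉ → dsupp j (j∉ ∘ remove⊆ T₁ j₀)
            toT : ∀ {k} → Supp k T₁ → Supp k T
            toT = λ supp j j∉ → supp j (j∉ ∘ remove⊆ T x)
            esupp : Supp e T
            esupp = λ j j∉ → trans (+-cong (*0≈0 (toT dsupp₁ j j∉)) (*0≈0 (toT csupp j j∉))) (+-identityʳ 0#)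
            eker : Ker S e
            eker = ker-extend {k = e}
              (λ i i∈ → trans (mv-linear β (- α) d c i) (trans (+-cong (*0≈0 (dker i i∈)) (*0≈0 (cker i i∈))) (+-identityʳ 0#)))
              (trans (mv-linear β (- α) d c x) (trans (+-cong (*-comm β α) (sym (-‿distribˡ-* α β))) (-‿inverseʳ (α * β))))
            αc≈0 : (- α) * c j₀ ≈ 0#
            αc≈0 = trans (sym (trans (+-congʳ (*0≈0 (dsupp j₀ (λ j₀∈ → proj₂ (∈-remove⁻ T₁ j₀∈) ≡.refl)))) (+-identityˡ _)))
                         (ind e esupp eker j₀)
            α≈0 : α ≈ 0#
            α≈0 = trans (sym (-‿involutive α)) (trans (-‿cong (cancelʳ _ _ αc≈0 cj₀≉0)) -0#≈0#)
          in ind d (toT dsupp₁) (ker-extend dker α≈0)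

      rank-remove-≤ : ∀ {S x r s} → HasRankOn S r → HasRankOn (S - x) s → s ≤ r
      rank-remove-≤ rk (mkRank (T , ind , ≡.refl) _) = maximal rk T (indep-mono ind)

      rank-remove-≥ : ∀ {S x r s} → HasRankOn S r → HasRankOn (S - x) s → r ≤ 2 ℕ.+ s
      rank-remove-≥ {x = x} (mkRank (T , ind , ≡.refl) _) rk = indep-remove x (maximal rk) ind

      unit-ker : ∀ {S T u} → Indep S T → u ∈ T → (∀ i → i ∈ S → M i u ≈ 0#) → ⊥
      unit-ker {S} {T} {u} (_ , ind) u∈T col = 1≉0 (trans (sym (delta-≡ u))
        (ind (delta u 1#) (λ j j∉T → delta-≢ {a = u} {j} {1#} λ { ≡.refl → j∉T u∈T })
          (λ i i∈S → sum-zero λ j → case j Fin.≟ u of λ where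
              (yes ≡.refl) → *0≈0 (col i i∈S)
              (no j≢u) → 0*≈0 (delta-≢ {a = u} {j} {1#} j≢u)) u))

      record Isolated (S : Subset n) (u : Fin n) : Set where
        field
          row : ∀ j → j ∈ S → M u j ≈ 0#
          col : ∀ j → j ∈ S → M j u ≈ 0#

      indep-isolated : ∀ {S u T} → Isolated S u → Indep S T → Indep (S - u) T
      indep-isolated {S} {u} {T} iso ind@(T⊆S , ind′) =
        (λ v∈ → ∈-remove⁺ (T⊆S v∈) λ { ≡.refl → unit-ker ind v∈ (Isolated.col iso) }) ,
        λ k supp ker → ind′ k supp (ker-extend ker (sum-zero λ j → case j ∈? T of λ where
          (yes j∈T) → *0≈0 (Isolated.row iso j (T⊆S j∈T))
          (no j∉T) → 0*≈0 (supp j j∉T)))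

      rank-isolated : ∀ {S u r} → Isolated S u → HasRankOn (S - u) r → HasRankOn S r
      rank-isolated iso (mkRank (T , ind , eq) max) =
        mkRank (T , indep-mono ind , eq) λ T′ ind′ → max T′ (indep-isolated iso ind′)

      record IsPendant (S : Subset n) (u v : Fin n) : Set where
        field
          u∈S : u ∈ S
          v∈S : v ∈ S
          u≢v : u ≢ v
          uv  : ¬ M u v ≈ 0#
          vu  : ¬ M v u ≈ 0#
          row : ∀ j → j ∈ S → j ≢ v → M u j ≈ 0#
          col : ∀ j → j ∈ S → j ≢ v → M j u ≈ 0#

      module _ {S u v} (pend : IsPendant S u v) where
        open IsPendant pend

        pendant-isolated : Isolated (S - v) u
        pendant-isolated = record
          { row = λ j j∈ → let j∈S , j≢v = ∈-remove⁻ S j∈ in row j j∈S j≢v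
          ; col = λ j j∈ → let j∈S , j≢v = ∈-remove⁻ S j∈ in col j j∈S j≢v }

        -- Row `u` has its only entry at `v` and forces `k v` to vanish; column `u` is zero on the
        -- remaining rows, so the independence of `T` kills all coefficients but `k u`; row `v` then
        -- kills `k u`.
        indep-pendant : ∀ {T} → Indep (S - u - v) T → Indep S (T ▻ u ▻ v)
        indep-pendant {T} (T⊆ , ind) = ⊆S , vanish
          where
          T⊆S : T ⊆ S
          T⊆S = remove⊆ S u ∘ remove⊆ (S - u) v ∘ T⊆
          ⊆S : T ▻ u ▻ v ⊆ S
          ⊆S x∈ with ∈-add⁻ (T ▻ u) x∈
          ... | inj₂ ≡.refl = v∈S
          ... | inj₁ x∈′ with ∈-add⁻ T x∈′
          ...   | inj₂ ≡.refl = u∈S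
          ...   | inj₁ x∈T = T⊆S x∈T
          vanish : ∀ k → Supp k (T ▻ u ▻ v) → Ker S k → ∀ j → k j ≈ 0#
          vanish k supp ker = λ j → case j Fin.≟ u of λ where
              (yes ≡.refl) → ku≈0
              (no j≢u) → k≈0 j j≢u
            where
            kv≈0 : k v ≈ 0#
            kv≈0 = cancelʳ (k v) (M u v) (trans (sym (sum-single (λ j → k j * M u j) v λ j j≢v → case j ∈? S of λ where
                       (yes j∈S) → *0≈0 (row j j∈S j≢v)
                       (no  j∉S) → 0*≈0 (supp j (j∉S ∘ ⊆S)))) (ker u u∈S)) uv
            k′ : Fin n → Carrier
            k′ j = if does (j Fin.≟ u) then 0# else k j
            k′≈k : ∀ j → j ≢ u → k′ j ≈ k j
            k′≈k j j≢u with j Fin.≟ u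
            ... | yes j≡u = contradiction j≡u j≢u
            ... | no  _   = refl
            k′supp : Supp k′ T
            k′supp j j∉T with j Fin.≟ u | j Fin.≟ v
            ... | yes _  | _ = refl
            ... | no _   | yes ≡.refl = kv≈0
            ... | no j≢u | no j≢v = supp j λ j∈ → [ (λ j∈′ → [ j∉T , j≢u ]′ (∈-add⁻ T j∈′)) , j≢v ]′ (∈-add⁻ (T ▻ u) j∈)
            k′ker : Ker (S - u - v) k′
            k′ker i i∈ = trans (sum-cong-≋ same) (ker i i∈S)
              where
              i∈S = remove⊆ S u (remove⊆ (S - u) v i∈)
              same : ∀ j → k′ j * M i j ≈ k j * M i j
              same j with j Fin.≟ u
              ... | yes ≡.refl = trans (zeroˡ _) (sym (*0≈0 (col i i∈S (proj₂ (∈-remove⁻ (S - u) i∈)))))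
              ... | no  _ = refl
            k≈0 : ∀ j → j ≢ u → k j ≈ 0#
            k≈0 j j≢u = trans (sym (k′≈k j j≢u)) (ind k′ k′supp k′ker j)
            ku≈0 : k u ≈ 0#
            ku≈0 = cancelʳ (k u) (M v u) (trans (sym (sum-single (λ j → k j * M v j) u λ j j≢u → 0*≈0 (k≈0 j j≢u))) (ker v v∈S)) vu

        -- The upper bound passes through `S - v`: there `u` is isolated, so the rank is that of
        -- `S - u - v`, and restoring `v` adds at most 2.
        rank-pendant : ∀ {r} → HasRankOn (S - u - v) r → HasRankOn S (2 ℕ.+ r)
        rank-pendant rk@(mkRank (T , ind , ≡.refl) _) = mkRank
          (T ▻ u ▻ v , indep-pendant ind , size)
          λ T′ ind′ → indep-remove v (maximal (rank-isolated pendant-isolated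
                         (≡.subst (λ X → HasRankOn X _) (p─x─y≡p─y─x S u v) rk))) ind′
          where
          u∉T : u ∉ T
          u∉T u∈T = proj₂ (∈-remove⁻ S (remove⊆ (S - u) v (proj₁ ind u∈T))) ≡.refl
          v∉Tu : v ∉ T ▻ u
          v∉Tu v∈ = [ (λ v∈T → proj₂ (∈-remove⁻ (S - u) (proj₁ ind v∈T)) ≡.refl) , u≢v ∘ ≡.sym ]′ (∈-add⁻ T v∈)
          size : ∣ T ▻ u ▻ v ∣ ≡ 2 ℕ.+ ∣ T ∣
          size = ≡.trans (∣∣-add (T ▻ u) v∉Tu) (≡.cong suc (∣∣-add T u∉T))

      -- A basis `T` for `S - x` is still maximal in size for `S`, so adding column `x` creates a
      -- dependency; its coefficient at `x` cannot vanish, as `T` alone is independent.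
      kernel-at : ∀ {S x r} → x ∈ S → HasRankOn S r → HasRankOn (S - x) r →
        ¬ ¬ (∃[ z ] Supp z S × Ker S z × ¬ z x ≈ 0#)
      kernel-at {S} {x} x∈S rk (mkRank (T , ind , ≡.refl) _) ¬ker =
        dependency T▻x⊆ (λ ind′ → ℕ.1+n≰n (≤-trans (≤-reflexive (≡.sym (∣∣-add T x∉T))) (maximal rk (T ▻ x) ind′)))
        λ (z , supp , ker , j , zj≉0) → ¬ker (z , (λ i i∉S → supp i (i∉S ∘ T▻x⊆)) , ker , λ zx≈0 →
          zj≉0 (proj₂ (indep-mono ind) z (λ i i∉T → case i Fin.≟ x of λ where
            (yes ≡.refl) → zx≈0
            (no i≢x) → supp i λ i∈ → [ i∉T , i≢x ]′ (∈-add⁻ T i∈)) ker j))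
        where
        x∉T : x ∉ T
        x∉T x∈T = proj₂ (∈-remove⁻ S (proj₁ ind x∈T)) ≡.refl
        T▻x⊆ : T ▻ x ⊆ S
        T▻x⊆ v∈ with ∈-add⁻ T v∈
        ... | inj₁ v∈T = remove⊆ S x (proj₁ ind v∈T)
        ... | inj₂ ≡.refl = x∈S

      -- A basis of `S` without `x` is still too large to be independent on the rows `S - x`. The
      -- resulting dependency must be visible on row `x`, since it is none on all of `S`.
      coker-at : ∀ {S x r} → HasRankOn S (2 ℕ.+ r) → HasRankOn (S - x) r →
        ¬ ¬ (∃[ k ] Supp k (S - x) × Ker (S - x) k × ¬ mv k x ≈ 0#)
      coker-at {S} {x} (mkRank (T , (T⊆S , ind) , eq) _) rk ¬coker =
        dependency T-x⊆ (λ ind′ → ℕ.1+n≰n (≤-trans (ℕ.s≤s⁻¹ (≤-trans (≤-reflexive (≡.sym eq)) (∣∣≤1+∣remove∣ T x)))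
                                                     (maximal rk (T - x) ind′)))
        λ (k , supp , ker , j , kj≉0) → ¬coker (k , (λ i i∉ → supp i (i∉ ∘ T-x⊆)) , ker , λ kx≈0 →
          kj≉0 (ind k (λ i i∉T → supp i (i∉T ∘ remove⊆ T x)) (ker-extend ker kx≈0) j))
        where
        T-x⊆ : T - x ⊆ S - x
        T-x⊆ v∈ = let v∈T , v≢x = ∈-remove⁻ T v∈ in ∈-remove⁺ (T⊆S v∈T) v≢x

      IndepFamily : ∀ {k} → (Fin k → Fin n) → Set
      IndepFamily {k} f = ∀ (c : Fin k → Carrier) → (∀ i → sum (λ j → c j * M i (f j)) ≈ 0#) → ∀ j → c j ≈ 0#

      module _ {k} (f : Fin k → Fin n) where

        -- Coefficients add up over the fibres of `f`, so `mv-push` holds for every `f`, injective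
        -- or not.
        push : (Fin k → Carrier) → Fin n → Carrier
        push c v = sum (λ j → delta (f j) (c j) v)

        mv-push : ∀ c i → mv (push c) i ≈ sum (λ j → c j * M i (f j))
        mv-push c i = begin
          sum (λ v → push c v * M i v)                             ≈⟨ sum-cong-≋ (λ v → *-distribʳ-sum (M i v) (λ j → delta (f j) (c j) v)) ⟩
          sum (λ v → sum (λ j → delta (f j) (c j) v * M i v))      ≈⟨ ∑-comm (λ v j → delta (f j) (c j) v * M i v) ⟩
          sum (λ j → sum (λ v → delta (f j) (c j) v * M i v))      ≈⟨ sum-cong-≋ (λ j → sum-single (λ v → delta (f j) (c j) v * M i v) (f j) λ v v≢ → 0*≈0 (delta-≢ v≢)) ⟩
          sum (λ j → delta (f j) (c j) (f j) * M i (f j))          ≈⟨ sum-cong-≋ (λ j → *-congʳ (delta-≡ (f j))) ⟩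
          sum (λ j → c j * M i (f j))                              ∎

        push-∉ : ∀ c v → (∀ j → f j ≢ v) → push c v ≈ 0#
        push-∉ c v v∉ = sum-zero λ j → delta-≢ (v∉ j ∘ ≡.sym)

        push-∈ : (∀ {a b} → f a ≡ f b → a ≡ b) → ∀ c j → push c (f j) ≈ c j
        push-∈ f-inj c j = trans (sum-single (λ i → delta (f i) (c i) (f j)) j λ i i≢j → delta-≢ (i≢j ∘ ≡.sym ∘ f-inj)) (delta-≡ (f j))

        indep-family-injective : IndepFamily f → ∀ {a b} → f a ≡ f b → a ≡ b
        indep-family-injective ind {a} {b} fa≡fb with a Fin.≟ b
        ... | yes a≡b = a≡b
        ... | no  a≢b = ⊥-elim (1≉0 (trans (sym value) (ind c dep a)))
          where
          -- Coefficients 1 and -1 annihilate a column that occurs at both `a` and `b`.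
          c : Fin k → Carrier
          c j = delta a 1# j + delta b (- 1#) j
          value : c a ≈ 1#
          value = trans (+-cong (delta-≡ a) (delta-≢ a≢b)) (+-identityʳ 1#)
          dep : ∀ i → sum (λ j → c j * M i (f j)) ≈ 0#
          dep i = begin
            sum (λ j → c j * M i (f j))                ≈⟨ sum-two (λ j → c j * M i (f j)) a≢b (λ j j≢a j≢b → 0*≈0 (trans (+-cong (delta-≢ j≢a) (delta-≢ j≢b)) (+-identityʳ 0#))) ⟩
            c a * M i (f a) + c b * M i (f b)          ≈⟨ +-cong (*-congʳ value) (*-cong value′ (reflexive (≡.cong (M i) (≡.sym fa≡fb)))) ⟩
            1# * M i (f a) + (- 1#) * M i (f a)        ≈⟨ sym (distribʳ (M i (f a)) 1# (- 1#)) ⟩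
            (1# + - 1#) * M i (f a)                      ≈⟨ 0*≈0 (-‿inverseʳ 1#) ⟩
            0#                                         ∎
            where
            value′ : c b ≈ - 1#
            value′ = trans (+-cong (delta-≢ (a≢b ∘ ≡.sym)) (delta-≡ b)) (+-identityˡ (- 1#))

        indep-family⇒indep : IndepFamily f → Indep full (image f) × k ≤ ∣ image f ∣
        indep-family⇒indep ind = (⊆⊤ , vanish) , image-size f (image f) f-inj (∈-image⁺ f)
          where
          f-inj : ∀ {a b} → f a ≡ f b → a ≡ b
          f-inj = indep-family-injective ind
          vanish : ∀ κ → Supp κ (image f) → Ker full κ → ∀ j → κ j ≈ 0#
          vanish κ supp ker v with Fin.any? (λ j → f j Fin.≟ v)
          ... | no  v∉ = supp v λ v∈ → v∉ (∈-image⁻ f v∈)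
          ... | yes (j , ≡.refl) = ind (κ ∘ f) (λ i → trans (sym (mv-push (κ ∘ f) i)) (trans (mv-cong push≈κ i) (ker i ∈⊤))) j
            where
            push≈κ : ∀ w → push (κ ∘ f) w ≈ κ w
            push≈κ w with Fin.any? (λ j → f j Fin.≟ w)
            ... | yes (j , ≡.refl) = push-∈ f-inj (κ ∘ f) j
            ... | no  w∉ = trans (push-∉ (κ ∘ f) w λ j eq → w∉ (j , eq)) (sym (supp w λ w∈ → w∉ (∈-image⁻ f w∈)))

      indep⇒indep-family : ∀ T → Indep full T → IndepFamily (enum T)
      indep⇒indep-family T (_ , ind) c dep j = trans (sym (push-∈ (enum T) (enum-injective T) c j))
        (ind (push (enum T) c)
          (λ v v∉T → push-∉ (enum T) c v λ i eq → v∉T (≡.subst (_∈ T) eq (enum-∈ T i)))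
          (λ i _ → trans (mv-push (enum T) c i) (dep i)) (enum T j))

      HasFamilyRank : ℕ → Set
      HasFamilyRank r = (Σ[ f ∈ (Fin r → Fin n) ] IndepFamily f) × (∀ k (f : Fin k → Fin n) → IndepFamily f → k ≤ r)

      rank⇒familyRank : ∀ {r} → HasRankOn full r → HasFamilyRank r
      rank⇒familyRank (mkRank (T , ind , ≡.refl) max) = (enum T , indep⇒indep-family T ind) , λ k f indf →
        let ind′ , k≤ = indep-family⇒indep f indf in ≤-trans k≤ (max (image f) ind′)

      familyRank⇒rank : ∀ {r} → HasFamilyRank r → HasRankOn full r
      familyRank⇒rank ((f , indf) , max) =
        let ind , r≤ = indep-family⇒indep f indf
            max′ = λ T ind′ → max ∣ T ∣ (enum T) (indep⇒indep-family T ind′)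
        in mkRank (image f , ind , ≤-antisym (max′ (image f) ind) r≤) max′

-- Edges plus components under deletion of an edge

module EdgeDeletion where

  open import Data.Bool.Base using (T)
  open import Data.List.Base using (List; []; _∷_; length; filter; allFin; cartesianProduct)
  open import Data.List.Membership.Propositional using () renaming (_∈_ to _∈ˡ_)
  open import Data.List.Membership.Propositional.Properties using (∈-allFin; ∈-cartesianProduct⁺)
  open import Data.List.Properties using (filter-accept; filter-reject)
  open import Data.List.Relation.Unary.All as All using (All; []; _∷_)
  open import Data.List.Relation.Unary.AllPairs using ([]; _∷_)
  open import Data.List.Relation.Unary.Any using (here; there)
  open import Data.List.Relation.Unary.Unique.Propositional using (Unique)
  open import Data.List.Relation.Unary.Unique.Propositional.Properties using (allFin⁺; cartesianProduct⁺)
  open import Data.Nat.Base using (_+_)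
  open import Relation.Binary.Definitions using (tri<; tri≈; tri>)
  open import Relation.Nullary.Decidable using (dec-true; dec-false)
  open ≡ using (refl; sym; trans; cong; cong₂; subst)

  module _ {A : Set} {P Q : A → Set} (P? : Decidable P) (Q? : Decidable Q) where

    filter-length-cong : ∀ xs → (∀ x → x ∈ˡ xs → P x → Q x) → (∀ x → x ∈ˡ xs → Q x → P x) →
      length (filter P? xs) ≡ length (filter Q? xs)
    filter-length-cong [] _ _ = refl
    filter-length-cong (x ∷ xs) P⇒Q Q⇒P with ih ← filter-length-cong xs (λ y → P⇒Q y ∘ there) (λ y → Q⇒P y ∘ there) | P? x | Q? x
    ... | yes p | yes q = cong suc ih
    ... | yes p | no ¬q = contradiction (P⇒Q x (here refl) p) ¬q
    ... | no ¬p | yes q = contradiction (Q⇒P x (here refl) q) ¬p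
    ... | no ¬p | no ¬q = ih

    filter-length-suc : ∀ xs → Unique xs → ∀ x₀ → x₀ ∈ˡ xs → P x₀ → ¬ Q x₀ →
      (∀ x → x ≢ x₀ → P x → Q x) → (∀ x → x ≢ x₀ → Q x → P x) →
      length (filter P? xs) ≡ suc (length (filter Q? xs))
    filter-length-suc (x ∷ xs) (x∉xs ∷ _) .x (here refl) p ¬q P⇒Q Q⇒P
      rewrite filter-accept P? {xs = xs} p | filter-reject Q? {xs = xs} ¬q =
      cong suc (filter-length-cong xs
        (λ y y∈ → P⇒Q y λ { refl → All.lookup x∉xs y∈ refl })
        (λ y y∈ → Q⇒P y λ { refl → All.lookup x∉xs y∈ refl }))
    filter-length-suc (x ∷ xs) (x∉xs ∷ uniq) x₀ (there x₀∈) p ¬q P⇒Q Q⇒P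
      with ih ← filter-length-suc xs uniq x₀ x₀∈ p ¬q P⇒Q Q⇒P | P? x | Q? x
    ... | yes px | yes qx = cong suc ih
    ... | yes px | no ¬qx = contradiction (P⇒Q x (All.lookup x∉xs x₀∈) px) ¬qx
    ... | no ¬px | yes qx = contradiction (Q⇒P x (All.lookup x∉xs x₀∈) qx) ¬px
    ... | no ¬px | no ¬qx = ih

  least : ∀ {n} {P : Fin n → Set} → Decidable P → ∃ P → ∃[ v ] P v × (∀ u → P u → v Fin.≤ u)
  least {suc n} {P} P? (w , pw) with P? zero
  ... | yes p₀ = zero , p₀ , λ _ _ → z≤n
  ... | no ¬p₀ with least (P? ∘ suc) (shift w pw)
    where
    shift : ∀ w → P w → ∃ (P ∘ suc)
    shift zero    p = contradiction p ¬p₀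
    shift (suc w) p = w , p
  ... | v , pv , min = suc v , pv , λ where
    zero    p → contradiction p ¬p₀
    (suc u) p → s≤s (min u p)

  -- This is θ plus the order of the graph, and avoids integers. It drops by one when an edge on a
  -- cycle is deleted and is unchanged when a bridge is deleted.
  edges+components : ∀ {n} → Graph n → ℕ
  edges+components G = edgeCount G + componentCount G

  connected-sym : ∀ {n} (G : Graph n) {u v} → Graph.Connected G u v → Graph.Connected G v u
  connected-sym G = Star.reverse λ {u} {v} → subst T (Graph.adj-sym G u v)

  module _ {n} (G H : Graph n) where
    private
      module G = Graph G
      module H = Graph H

    SameAdj : Set
    SameAdj = (∀ {u v} → G.Adj u v → H.Adj u v) × (∀ {u v} → H.Adj u v → G.Adj u v)

    edges+components-cong : SameAdj → edges+components G ≡ edges+components H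
    edges+components-cong (to , from) = cong₂ _+_
      (filter-length-cong _ _ (cartesianProduct (allFin n) (allFin n))
        (λ _ _ (u<v , e) → u<v , to e) (λ _ _ (u<v , e) → u<v , from e))
      (filter-length-cong _ _ (allFin n)
        (λ _ _ rep (u , u<v , c) → rep (u , u<v , Star.map from c))
        (λ _ _ rep (u , u<v , c) → rep (u , u<v , Star.map to c)))

    record EdgeDeleted (a b : Fin n) : Set where
      field
        ab   : G.Adj a b
        ¬ab  : ¬ H.Adj a b
        sub  : ∀ {u v} → H.Adj u v → G.Adj u v
        rest : ∀ {u v} → G.Adj u v → H.Adj u v ⊎ (u ≡ a × v ≡ b) ⊎ (u ≡ b × v ≡ a)

    module _ {a b} (del : EdgeDeleted a b) where
      open EdgeDeleted del

      private
        a≢b : a ≢ b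
        a≢b refl = subst T (G.adj-irrefl a) ab

        ba : G.Adj b a
        ba = subst T (G.adj-sym a b) ab

        ¬ba : ¬ H.Adj b a
        ¬ba = ¬ab ∘ subst T (H.adj-sym b a)

        edges : List (Fin n × Fin n)
        edges = cartesianProduct (allFin n) (allFin n)

        unique-edges : Unique edges
        unique-edges = cartesianProduct⁺ (allFin⁺ n) (allFin⁺ n)

      edgeCount-delete : edgeCount G ≡ suc (edgeCount H)
      edgeCount-delete with Fin.<-cmp a b
      ... | tri≈ _ a≡b _ = contradiction a≡b a≢b
      ... | tri< a<b _ b≮a = filter-length-suc _ _ edges unique-edges (a , b)
        (∈-cartesianProduct⁺ (∈-allFin a) (∈-allFin b)) (a<b , ab) (λ (_ , e) → ¬ab e)
        (λ { (u , v) uv≢ (u<v , e) → u<v , (case rest e of λ where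
               (inj₁ e′) → e′
               (inj₂ (inj₁ (refl , refl))) → contradiction refl uv≢
               (inj₂ (inj₂ (refl , refl))) → contradiction u<v b≮a) })
        (λ _ _ (u<v , e) → u<v , sub e)
      ... | tri> a≮b _ b<a = filter-length-suc _ _ edges unique-edges (b , a)
        (∈-cartesianProduct⁺ (∈-allFin b) (∈-allFin a)) (b<a , ba) (λ (_ , e) → ¬ba e)
        (λ { (u , v) uv≢ (u<v , e) → u<v , (case rest e of λ where
               (inj₁ e′) → e′
               (inj₂ (inj₁ (refl , refl))) → contradiction u<v a≮b
               (inj₂ (inj₂ (refl , refl))) → contradiction refl uv≢) })
        (λ _ _ (u<v , e) → u<v , sub e)

      connected-delete : ∀ {u v} → G.Connected u v →
        H.Connected u v ⊎ (H.Connected u a × H.Connected b v) ⊎ (H.Connected u b × H.Connected a v)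
      connected-delete nil = inj₁ nil
      connected-delete (e ◅ p) with rest e | connected-delete p
      ... | inj₁ e′ | inj₁ q = inj₁ (e′ ◅ q)
      ... | inj₁ e′ | inj₂ (inj₁ (q , r)) = inj₂ (inj₁ (e′ ◅ q , r))
      ... | inj₁ e′ | inj₂ (inj₂ (q , r)) = inj₂ (inj₂ (e′ ◅ q , r))
      ... | inj₂ (inj₁ (refl , refl)) | inj₁ q = inj₂ (inj₁ (nil , q))
      ... | inj₂ (inj₁ (refl , refl)) | inj₂ (inj₁ (_ , r)) = inj₂ (inj₁ (nil , r))
      ... | inj₂ (inj₁ (refl , refl)) | inj₂ (inj₂ (_ , r)) = inj₁ r
      ... | inj₂ (inj₂ (refl , refl)) | inj₁ q = inj₂ (inj₂ (nil , q))
      ... | inj₂ (inj₂ (refl , refl)) | inj₂ (inj₁ (_ , r)) = inj₁ r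
      ... | inj₂ (inj₂ (refl , refl)) | inj₂ (inj₂ (_ , r)) = inj₂ (inj₂ (nil , r))

      edges+components-cyclic : H.Connected a b → edges+components G ≡ suc (edges+components H)
      edges+components-cyclic a~b = cong₂ _+_ edgeCount-delete
        (filter-length-cong _ _ (allFin n)
          (λ _ _ rep (u , u<v , c) → rep (u , u<v , Star.map sub c))
          (λ _ _ rep (u , u<v , c) → rep (u , u<v , shrink c)))
        where
        shrink : ∀ {u v} → G.Connected u v → H.Connected u v
        shrink c with connected-delete c
        ... | inj₁ p = p
        ... | inj₂ (inj₁ (p , q)) = p ◅◅ a~b ◅◅ q
        ... | inj₂ (inj₂ (p , q)) = p ◅◅ connected-sym H a~b ◅◅ q

      -- When the deleted edge joins the components of H with least vertices
      -- r < s, the only representative lost in G is s.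
      private
        componentCount-join : ∀ {a b} → (∀ {u v} → G.Connected u v →
            H.Connected u v ⊎ (H.Connected u a × H.Connected b v) ⊎ (H.Connected u b × H.Connected a v)) →
          G.Connected a b → ∀ {r s} →
          H.Connected a r → (∀ u → H.Connected a u → r Fin.≤ u) →
          H.Connected b s → (∀ u → H.Connected b u → s Fin.≤ u) →
          r Fin.< s → componentCount H ≡ suc (componentCount G)
        componentCount-join {a} {b} split Gab {r} {s} a~r r-min b~s s-min r<s =
          filter-length-suc _ _ (allFin n) (allFin⁺ n) s (∈-allFin s)
            (λ (u , u<s , c) → ℕ.<⇒≱ u<s (s-min u (b~s ◅◅ connected-sym H c)))
            (λ rep → rep (r , r<s , Star.map sub (connected-sym H a~r) ◅◅ Gab ◅◅ Star.map sub b~s))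
            (λ v v≢s rep (u , u<v , c) → case split c of λ where
              (inj₁ p) → rep (u , u<v , p)
              (inj₂ (inj₁ (_ , b~v))) → rep (s , Fin.≤∧≢⇒< (s-min v b~v) (v≢s ∘ sym) , connected-sym H b~s ◅◅ b~v)
              (inj₂ (inj₂ (u~b , a~v))) → case r Fin.≟ v of λ where
                (yes refl) → ℕ.<-asym r<s (≤-<-trans (s-min u (connected-sym H u~b)) u<v)
                (no r≢v) → rep (r , Fin.≤∧≢⇒< (r-min v a~v) r≢v , connected-sym H a~r ◅◅ a~v))
            (λ v _ rep (u , u<v , c) → rep (u , u<v , Star.map sub c))

      edges+components-bridge : ¬ H.Connected a b → edges+components G ≡ edges+components H
      edges+components-bridge a≁b
        with r , a~r , r-min ← least (connected? H a) (a , nil)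
           | s , b~s , s-min ← least (connected? H b) (b , nil)
        with Fin.<-cmp r s
      ... | tri< r<s _ _ = trans (cong₂ _+_ edgeCount-delete refl)
              (trans (sym (ℕ.+-suc _ _)) (cong (edgeCount H +_)
                (sym (componentCount-join connected-delete (ab ◅ nil) a~r r-min b~s s-min r<s))))
      ... | tri≈ _ refl _ = contradiction (a~r ◅◅ connected-sym H b~s) a≁b
      ... | tri> _ _ s<r = trans (cong₂ _+_ edgeCount-delete refl)
              (trans (sym (ℕ.+-suc _ _)) (cong (edgeCount H +_)
                (sym (componentCount-join ([ inj₁ , inj₂ ∘ [ inj₂ , inj₁ ]′ ]′ ∘ connected-delete) (ba ◅ nil) b~s s-min a~r r-min s<r))))

  module _ {n} (R : Fin n → Fin n → Set) (R? : B.Decidable R) (R-sym : ∀ {u v} → R u v → R v u) (R-irrefl : ∀ {v} → ¬ R v v) where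

    fromRelation : Graph n
    fromRelation = record
      { adj = λ u v → does (R? u v)
      ; adj-sym = λ u v → lem (R? u v) (R? v u)
      ; adj-irrefl = λ v → dec-false (R? v v) R-irrefl
      }
      where
      lem : ∀ {u v} (d : Dec (R u v)) (d′ : Dec (R v u)) → does d ≡ does d′
      lem (yes _) (yes _) = refl
      lem (no  _) (no  _) = refl
      lem (yes p) (no ¬q) = contradiction (R-sym p) ¬q
      lem (no ¬p) (yes q) = contradiction (R-sym q) ¬p

    fromRelation⁺ : ∀ {u v} → R u v → Graph.Adj fromRelation u v
    fromRelation⁺ {u} {v} p = subst T (sym (dec-true (R? u v) p)) _

    fromRelation⁻ : ∀ {u v} → Graph.Adj fromRelation u v → R u v
    fromRelation⁻ {u} {v} e with R? u v
    ... | yes p = p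

-- Induced subgraphs, cyclic edges and the effect of deleting a vertex

module InducedSubgraphs where

  open import Data.Bool.Base using (T)
  open import Data.Fin.Subset using (_-_)
  open import Data.List.Base using (List; []; _∷_; length; allFin; cartesianProduct; _++_)
  open import Data.List.Membership.Propositional using () renaming (_∈_ to _∈ˡ_; _∉_ to _∉ˡ_)
  open import Data.List.Membership.Propositional.Properties using (∈-allFin; ∈-++⁺ˡ)
  open import Data.List.Properties using (filter-all; filter-none; length-tabulate)
  open import Data.List.Relation.Unary.All as All using (All; []; _∷_)
  open import Data.List.Relation.Unary.Any using (here; there)
  open import Data.Nat.Base using (_+_)
  open ≡ using (refl; sym; trans; cong; cong₂; subst)
  open Subsets
  open EdgeDeletion

  module Induced {n : ℕ} (G : Graph n) where
    open import Data.List.Membership.DecPropositional (Fin._≟_ {n}) using () renaming (_∈?_ to _∈ˡ?_)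
    open Graph G

    E : Subset n → Fin n → Fin n → Set
    E S u v = u ∈ S × v ∈ S × Adj u v

    E? : ∀ S → B.Decidable (E S)
    E? S u v = (u ∈? S) ×-dec (v ∈? S) ×-dec adj? u v

    Adj-sym : ∀ {u v} → Adj u v → Adj v u
    Adj-sym {u} {v} = subst T (adj-sym u v)

    E-sym : ∀ {S u v} → E S u v → E S v u
    E-sym (u∈ , v∈ , e) = v∈ , u∈ , Adj-sym e

    Adj-≢ : ∀ {u v} → Adj u v → u ≢ v
    Adj-≢ {u} e refl = subst T (adj-irrefl u) e

    E-≢ : ∀ {S u v} → E S u v → u ≢ v
    E-≢ (_ , _ , e) = Adj-≢ e

    E-mono : ∀ {S S′ u v} → S ⊆ S′ → E S u v → E S′ u v
    E-mono S⊆ (u∈ , v∈ , e) = S⊆ u∈ , S⊆ v∈ , e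

    E-remove⁺ : ∀ {S x u v} → E S u v → u ≢ x → v ≢ x → E (S - x) u v
    E-remove⁺ (u∈ , v∈ , e) u≢x v≢x = ∈-remove⁺ u∈ u≢x , ∈-remove⁺ v∈ v≢x , e

    remove-mono : ∀ {S S′ : Subset n} {x} → S ⊆ S′ → S - x ⊆ S′ - x
    remove-mono {S} S⊆ v∈ = let v∈S , v≢x = ∈-remove⁻ S v∈ in ∈-remove⁺ (S⊆ v∈S) v≢x

    -- All `n` vertices are kept and those outside `S` become isolated. Each of them adds one vertex
    -- and one component, so θ of the subgraph on `S` is `ec S` minus the fixed `n`.
    induced : Subset n → Graph n
    induced S = fromRelation (E S) (E? S) E-sym (λ e → E-≢ e refl)

    induced⁺ : ∀ {S u v} → E S u v → Graph.Adj (induced S) u v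
    induced⁺ {S} = fromRelation⁺ _ (E? S) E-sym (λ e → E-≢ e refl)

    induced⁻ : ∀ {S u v} → Graph.Adj (induced S) u v → E S u v
    induced⁻ {S} = fromRelation⁻ _ (E? S) E-sym (λ e → E-≢ e refl)

    Con : Subset n → Fin n → Fin n → Set
    Con S = Star (E S)

    opaque
      con? : ∀ S → B.Decidable (Con S)
      con? S u v = map′ (Star.map (λ {u} {v} → induced⁻ {S} {u} {v})) (Star.map (λ {u} {v} → induced⁺ {S} {u} {v})) (connected? (induced S) u v)

    Con-sym : ∀ {S u v} → Con S u v → Con S v u
    Con-sym = Star.reverse E-sym

    Con-mono : ∀ {S S′ u v} → S ⊆ S′ → Con S u v → Con S′ u v
    Con-mono S⊆ = Star.map (E-mono S⊆)

    Con-∈ : ∀ {S u v} → Con S u v → v ∈ S → u ∈ S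
    Con-∈ nil v∈ = v∈
    Con-∈ ((u∈ , _) ◅ _) _ = u∈

    lastExit : ∀ S x {s t} → Con S s t → t ≢ x →
      (s ≢ x × Con (S - x) s t) ⊎ (∃[ v ] E S x v × Con (S - x) v t)
    lastExit S x nil t≢x = inj₁ (t≢x , nil)
    lastExit S x {s} (e ◅ p) t≢x with lastExit S x p t≢x
    ... | inj₂ r = inj₂ r
    ... | inj₁ (m≢x , q) with s Fin.≟ x
    ...   | yes refl = inj₂ (_ , e , q)
    ...   | no  s≢x  = inj₁ (s≢x , E-remove⁺ e s≢x m≢x ◅ q)

    -- A cycle through `x` along the edges `xa` and `xb`, recorded by reachability instead of a list
    -- of vertices. This makes lying on a cycle decidable and monotone in `S`.
    CycPair : Subset n → Fin n → Fin n → Fin n → Set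
    CycPair S x a b = a ≢ b × E S x a × E S x b × Con (S - x) a b

    CE : Subset n → Fin n → Fin n → Set
    CE S x w = ∃[ w′ ] CycPair S x w w′

    OnCyc : Subset n → Fin n → Set
    OnCyc S x = ∃[ w ] CE S x w

    opaque
      CE? : ∀ S → B.Decidable (CE S)
      CE? S x w = Fin.any? λ w′ → ¬? (w Fin.≟ w′) ×-dec E? S x w ×-dec E? S x w′ ×-dec con? (S - x) w w′

    opaque
      OnCyc? : ∀ S → Decidable (OnCyc S)
      OnCyc? S x = Fin.any? (CE? S x)

    CycPair-mono : ∀ {S S′ x a b} → S ⊆ S′ → CycPair S x a b → CycPair S′ x a b
    CycPair-mono S⊆ (a≢b , ea , eb , c) = a≢b , E-mono S⊆ ea , E-mono S⊆ eb , Con-mono (remove-mono S⊆) c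

    CE-mono : ∀ {S S′ x w} → S ⊆ S′ → CE S x w → CE S′ x w
    CE-mono S⊆ (w′ , p) = w′ , CycPair-mono S⊆ p

    -- The route from `w` to `w′` off `x` leaves `w` for the last time along some edge `wv`. The
    -- edge `xw′` and the reversed rest of the route then join `x` to `v` off `w`.
    CE-sym : ∀ {S x w} → CE S x w → CE S w x
    CE-sym {S} {x} {w} (w′ , w≢w′ , ew , ew′ , c) with lastExit (S - x) w c (w≢w′ ∘ sym)
    ... | inj₁ (w≢w , _) = contradiction refl w≢w
    ... | inj₂ (v , ewv , c′) = v
      , (λ { refl → proj₂ (∈-remove⁻ S (proj₁ (proj₂ ewv))) refl })
      , E-sym ew , E-mono (remove⊆ S x) ewv
      , E-remove⁺ ew′ (E-≢ ew) (w≢w′ ∘ sym) ◅ Con-sym (Con-mono (remove-mono (remove⊆ S x)) c′)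

    -- Every vertex lies on at most one cycle, as seen from its cyclic neighbours.
    Cactus : Subset n → Set
    Cactus S = ∀ {x a b c} → CycPair S x a b → CE S x c → c ≡ a ⊎ c ≡ b

    -- Opaque because with-abstraction would otherwise normalise the counts.
    opaque
      ec : Subset n → ℕ
      ec S = edges+components (induced S)

    -- S - x is reached from S by cutting the edges at x one at a time.
    module Cutting (S : Subset n) (x : Fin n) where

      Cut : List (Fin n) → Fin n → Fin n → Set
      Cut L u v = E S u v × ¬ (u ≡ x × v ∈ˡ L) × ¬ (v ≡ x × u ∈ˡ L)

      Cut? : ∀ L → B.Decidable (Cut L)
      Cut? L u v = E? S u v ×-dec ¬? ((u Fin.≟ x) ×-dec (v ∈ˡ? L)) ×-dec ¬? ((v Fin.≟ x) ×-dec (u ∈ˡ? L))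

      Cut-sym : ∀ {L u v} → Cut L u v → Cut L v u
      Cut-sym (e , p , q) = E-sym e , q , p

      Cut-irrefl : ∀ {L v} → ¬ Cut L v v
      Cut-irrefl (e , _) = E-≢ e refl

      cut : List (Fin n) → Graph n
      cut L = fromRelation (Cut L) (Cut? L) Cut-sym Cut-irrefl

      cut⁺ : ∀ {L u v} → Cut L u v → Graph.Adj (cut L) u v
      cut⁺ {L} = fromRelation⁺ _ (Cut? L) Cut-sym Cut-irrefl

      cut⁻ : ∀ {L u v} → Graph.Adj (cut L) u v → Cut L u v
      cut⁻ {L} = fromRelation⁻ _ (Cut? L) Cut-sym Cut-irrefl

      ecut : List (Fin n) → ℕ
      ecut L = edges+components (cut L)

      opaque
        unfolding ec

        ecut-[] : ecut [] ≡ ec S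
        ecut-[] = edges+components-cong (cut []) (induced S)
          ( (λ {u} {v} e → induced⁺ {S} {u} {v} (proj₁ (cut⁻ {[]} {u} {v} e)))
          , (λ {u} {v} e → cut⁺ {[]} {u} {v} (induced⁻ {S} {u} {v} e , (λ ()) , (λ ()))))

        ecut-all : ∀ {L} → (∀ w → w ∈ˡ L) → ecut L ≡ ec (S - x)
        ecut-all {L} all = edges+components-cong (cut L) (induced (S - x))
          ( (λ {u} {v} e → let (e′ , p , q) = cut⁻ {L} {u} {v} e in
              induced⁺ {S - x} {u} {v} (E-remove⁺ e′ (λ u≡x → p (u≡x , all v)) (λ v≡x → q (v≡x , all u))))
          , (λ {u} {v} e → let e′@(u∈ , v∈ , _) = induced⁻ {S - x} {u} {v} e in
              cut⁺ {L} {u} {v} (E-mono (remove⊆ S x) e′ , (λ (u≡x , _) → proj₂ (∈-remove⁻ S u∈) u≡x) , (λ (v≡x , _) → proj₂ (∈-remove⁻ S v∈) v≡x))))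

      Cut-weaken : ∀ {w L u v} → Cut (w ∷ L) u v → Cut L u v
      Cut-weaken (e , p , q) = e , (λ (u≡x , v∈) → p (u≡x , there v∈)) , (λ (v≡x , u∈) → q (v≡x , there u∈))

      Cut-rest : ∀ {w L u v} → Cut L u v → Cut (w ∷ L) u v ⊎ (u ≡ x × v ≡ w) ⊎ (u ≡ w × v ≡ x)
      Cut-rest {w} {L} {u} {v} (e , p , q) with u Fin.≟ x | v Fin.≟ w | v Fin.≟ x | u Fin.≟ w
      ... | yes u≡x | yes v≡w | _ | _ = inj₂ (inj₁ (u≡x , v≡w))
      ... | _ | _ | yes v≡x | yes u≡w = inj₂ (inj₂ (u≡w , v≡x))
      ... | no u≢x | _ | no v≢x | _ = inj₁ (e , (λ (u≡x , _) → u≢x u≡x) , (λ (v≡x , _) → v≢x v≡x))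
      ... | no u≢x | _ | yes v≡x | no u≢w =
        inj₁ (e , (λ (u≡x , _) → u≢x u≡x) , λ { (_ , here u≡w) → u≢w u≡w ; (_ , there u∈) → q (v≡x , u∈) })
      ... | yes u≡x | no v≢w | no v≢x | _ =
        inj₁ (e , (λ { (_ , here v≡w) → v≢w v≡w ; (_ , there v∈) → p (u≡x , v∈) }) , (λ (v≡x , _) → v≢x v≡x))
      ... | yes u≡x | no v≢w | yes v≡x | no u≢w = contradiction (trans u≡x (sym v≡x)) (E-≢ e)

      deletes : ∀ {w L} → E S x w → w ∉ˡ L → EdgeDeleted (cut L) (cut (w ∷ L)) x w
      deletes {w} {L} e w∉L = record
        { ab   = cut⁺ {L} (e , (λ (_ , w∈) → w∉L w∈) , (λ (w≡x , _) → E-≢ e (sym w≡x)))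
        ; ¬ab  = λ e′ → proj₁ (proj₂ (cut⁻ {w ∷ L} e′)) (refl , here refl)
        ; sub  = λ {u} {v} e′ → cut⁺ {L} {u} {v} (Cut-weaken {w} {L} (cut⁻ {w ∷ L} {u} {v} e′))
        ; rest = λ {u} {v} e′ → [ inj₁ ∘ cut⁺ {w ∷ L} {u} {v} , inj₂ ]′ (Cut-rest {w} {L} (cut⁻ {L} {u} {v} e′))
        }

      ecut-cyclic : ∀ {w L} → E S x w → w ∉ˡ L → Star (Cut (w ∷ L)) x w → ecut L ≡ suc (ecut (w ∷ L))
      ecut-cyclic {w} {L} e w∉L p = edges+components-cyclic (cut L) (cut (w ∷ L)) (deletes e w∉L) (Star.map (cut⁺ {w ∷ L}) p)

      ecut-bridge : ∀ {w L} → E S x w → w ∉ˡ L → ¬ Star (Cut (w ∷ L)) x w → ecut L ≡ ecut (w ∷ L)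
      ecut-bridge {w} {L} e w∉L ¬p = edges+components-bridge (cut L) (cut (w ∷ L)) (deletes e w∉L) (¬p ∘ Star.map (cut⁻ {w ∷ L}))

      ecut-nonedge : ∀ {w L} → ¬ (E S x w × w ∉ˡ L) → ecut L ≡ ecut (w ∷ L)
      ecut-nonedge {w} {L} ¬e = edges+components-cong (cut L) (cut (w ∷ L))
        ( (λ {u} {v} e → cut⁺ {w ∷ L} {u} {v} (stay (cut⁻ {L} {u} {v} e)))
        , (λ {u} {v} e → cut⁺ {L} {u} {v} (Cut-weaken {w} {L} (cut⁻ {w ∷ L} {u} {v} e))))
        where
        stay : ∀ {u v} → Cut L u v → Cut (w ∷ L) u v
        stay c@(e , p , q) with Cut-rest {w} {L} c
        ... | inj₁ c′ = c′
        ... | inj₂ (inj₁ (refl , refl)) = contradiction (e , λ w∈ → p (refl , w∈)) ¬e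
        ... | inj₂ (inj₂ (refl , refl)) = contradiction (E-sym e , λ w∈ → q (refl , w∈)) ¬e

      private
        cutCon? : ∀ L → B.Decidable (Star (Cut L))
        cutCon? L u v = map′ (Star.map (cut⁻ {L})) (Star.map (cut⁺ {L})) (connected? (cut L) u v)

      ecut-∷-≤ : ∀ w L → ecut (w ∷ L) ≤ ecut L
      ecut-∷-≤ w L with E? S x w ×-dec ¬? (w ∈ˡ? L) | cutCon? (w ∷ L) x w
      ... | no ¬e | _ = ≤-reflexive (sym (ecut-nonedge ¬e))
      ... | yes (e , w∉) | yes p = ≤-trans (ℕ.n≤1+n _) (≤-reflexive (sym (ecut-cyclic e w∉ p)))
      ... | yes (e , w∉) | no ¬p = ≤-reflexive (sym (ecut-bridge e w∉ ¬p))

      ecut-++-≤ : ∀ K L → ecut (K ++ L) ≤ ecut L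
      ecut-++-≤ []      L = ≤-refl
      ecut-++-≤ (w ∷ K) L = ≤-trans (ecut-∷-≤ w (K ++ L)) (ecut-++-≤ K L)

      ec-remove-≤-ecut : ∀ L → ec (S - x) ≤ ecut L
      ec-remove-≤-ecut L = ≤-trans (≤-reflexive (sym (ecut-all λ w → ∈-++⁺ˡ (∈-allFin w)))) (ecut-++-≤ (allFin n) L)

      Con⇒Cut : ∀ {L u v} → Con (S - x) u v → Star (Cut L) u v
      Con⇒Cut = Star.map λ e@(u∈ , v∈ , _) → E-mono (remove⊆ S x) e
        , (λ (u≡x , _) → proj₂ (∈-remove⁻ S u∈) u≡x) , (λ (v≡x , _) → proj₂ (∈-remove⁻ S v∈) v≡x)

      cut-detour : ∀ {L a b} → CycPair S x a b → b ∉ˡ L → Star (Cut L) x a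
      cut-detour (_ , ea , eb , c) b∉L =
        (eb , (λ (_ , b∈) → b∉L b∈) , (λ (b≡x , _) → E-≢ eb (sym b≡x))) ◅ Con⇒Cut (Con-sym c)

      ec-cyclic-≤ : ∀ {a b} → CycPair S x a b → suc (ec (S - x)) ≤ ec S
      ec-cyclic-≤ {a} {b} p@(a≢b , ea , _) = ≤-trans (s≤s (ec-remove-≤-ecut (a ∷ [])))
        (≤-reflexive (trans (sym (ecut-cyclic ea (λ ()) (cut-detour p λ { (here b≡a) → a≢b (sym b≡a) }))) ecut-[]))

      -- Two successive cuts hit non-bridges: `xc` has a detour through `d`, and afterwards `xa`
      -- still has its detour through `b`, which uses neither cut edge. Equality in the rank
      -- estimate allows a drop of only one, so this is what separates the cycles.
      ec-cyclic₂-≤ : ∀ {a b c} → CycPair S x a b → CE S x c → c ≢ a → c ≢ b → 2 + ec (S - x) ≤ ec S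
      ec-cyclic₂-≤ {a} {b} {c} p@(a≢b , ea , _) (d , q@(c≢d , ec , _)) c≢a c≢b =
        ≤-trans (s≤s (s≤s (ec-remove-≤-ecut (a ∷ c ∷ []))))
        (≤-reflexive (trans (cong suc (sym (ecut-cyclic ea (λ { (here a≡c) → c≢a (sym a≡c) })
              (cut-detour p λ { (here b≡a) → a≢b (sym b≡a) ; (there (here b≡c)) → c≢b (sym b≡c) }))))
          (trans (sym (ecut-cyclic ec (λ ()) (cut-detour q λ { (here d≡c) → c≢d (sym d≡c) }))) ecut-[])))

      -- Every edge at `x` is a bridge when its turn comes to be cut: a detour would come back to
      -- `x` along a different edge and so give a cycle through `x`.
      ec-acyclic : ¬ OnCyc S x → ec S ≡ ec (S - x)
      ec-acyclic ¬cyc = trans (sym ecut-[]) (trans (go (allFin n)) (ecut-all λ w → ∈-allFin w))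
        where
        arrive : ∀ {L u} → u ≢ x → Star (Cut L) u x → ∃[ w ] Con (S - x) u w × Cut L w x
        arrive u≢x nil = contradiction refl u≢x
        arrive {L} {u} u≢x (_◅_ {j = m} c p) with m Fin.≟ x
        ... | yes refl = u , nil , c
        ... | no m≢x with arrive m≢x p
        ...   | w , q , c′ = w , E-remove⁺ (proj₁ c) u≢x m≢x ◅ q , c′

        no-detour : ∀ {w L} → E S x w → ¬ Star (Cut (w ∷ L)) x w
        no-detour {w} {L} e p with arrive (E-≢ e ∘ sym) (Star.reverse Cut-sym p)
        ... | w′ , q , (e′ , _ , ok) = ¬cyc (w , w′ , (λ w≡w′ → ok (refl , here (sym w≡w′))) , e , E-sym e′ , q)

        go : ∀ L → ecut [] ≡ ecut L
        go [] = refl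
        go (w ∷ L) with E? S x w ×-dec ¬? (w ∈ˡ? L)
        ... | no ¬e = trans (go L) (ecut-nonedge ¬e)
        ... | yes (e , w∉) = trans (go L) (ecut-bridge e w∉ (no-detour e))

    open Cutting public using (ec-cyclic-≤; ec-cyclic₂-≤; ec-acyclic)

    opaque
      unfolding ec

      ec-empty : ∀ {S} → (∀ {u v} → ¬ E S u v) → ec S ≡ n
      ec-empty {S} ¬E = cong₂ _+_
        (cong length (filter-none _ {xs = cartesianProduct (allFin n) (allFin n)}
          (All.tabulate λ {(u , v)} _ (_ , e) → ¬E (induced⁻ {S} {u} {v} e))))
        (trans (cong length (filter-all _ {xs = allFin n} (All.tabulate λ where
            _ (_ , u<v , nil) → ℕ.<-irrefl refl u<v
            _ (u , _ , _◅_ {j = w} e _) → ¬E (induced⁻ {S} {u} {w} e))))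
          (length-tabulate {n = n} id))

    ec-forest : ∀ k S → ∣ S ∣ ≤ k → (∀ x → ¬ OnCyc S x) → ec S ≡ n
    ec-forest k S ∣S∣≤k ¬cyc with nonempty? S
    ... | no ¬ne = ec-empty λ (u∈ , _) → ¬ne (_ , u∈)
    ec-forest zero    S ∣S∣≤0 ¬cyc | yes (x , x∈) = contradiction (≤-trans (x∈p⇒∣p-x∣<∣p∣ x∈) ∣S∣≤0) λ ()
    ec-forest (suc k) S ∣S∣≤k ¬cyc | yes (x , x∈) = trans (ec-acyclic S x (¬cyc x))
      (ec-forest k (S - x) (≤-pred (≤-trans (x∈p⇒∣p-x∣<∣p∣ x∈) ∣S∣≤k)) λ y (w , c) → ¬cyc y (w , CE-mono (remove⊆ S x) c))

-- Cycles as periodic sequences, bridges and the search for a leaf cycle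

module CyclesAndBridges where

  import Data.Integer.Properties as ℤ
  open import Data.Bool.Properties using (T-≡)
  open import Data.Fin.Subset using (_∩_; _-_) renaming (⊤ to full)
  open import Data.Integer.Base as ℤ using (ℤ; +_)
  open import Data.Integer.Tactic.RingSolver using (solve-∀)
  open import Data.Nat.Base using (_+_; _*_; _∸_)
  open import Data.Nat.DivMod
  open import Data.Nat.Divisibility using (_∣_; divides; ∣m+n∣m⇒∣n; ∣⇒≤)
  open import Data.Nat.Induction using (<-wellFounded)
  open import Data.Nat.Tactic.RingSolver using () renaming (solve-∀ to ℕ-solve-∀)
  open import Data.Vec.Base using (tabulate)
  open import Data.Vec.Properties using (lookup∘tabulate; []=⇒lookup; lookup⇒[]=)
  open import Induction.WellFounded using (Acc; acc)
  open import Relation.Binary.PropositionalEquality using (module ≡-Reasoning)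
  open ≡ using (refl; sym; trans; cong; subst; subst₂)
  open Subsets
  open EdgeDeletion
  open InducedSubgraphs

  suc-%% : ∀ m p .{{_ : ℕ.NonZero p}} → suc (m % p) % p ≡ suc m % p
  suc-%% m p = trans (%-distribˡ-+ 1 (m % p) p)
    (trans (cong (λ r → (1 % p + r) % p) (m%n%n≡m%n m p)) (sym (%-distribˡ-+ 1 m p)))

  +-%-cancel : ∀ a m p .{{_ : ℕ.NonZero p}} → (a + m) % p ≡ m % p → p ∣ a
  +-%-cancel a m p eq = ∣m+n∣m⇒∣n {m = (m / p) * p} (divides ((a + m) / p) qp+a) (divides (m / p) refl)
    where
    open ℕ.≤-Reasoning
    r = m % p
    qp+a : (m / p) * p + a ≡ ((a + m) / p) * p
    qp+a = ℕ.+-cancelˡ-≡ r _ _ (begin-equality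
      r + ((m / p) * p + a)                    ≡⟨ ℕ.+-assoc r _ a ⟨
      r + (m / p) * p + a                      ≡⟨ cong (_+ a) (m≡m%n+[m/n]*n m p) ⟨
      m + a                                        ≡⟨ ℕ.+-comm m a ⟩
      a + m                                        ≡⟨ m≡m%n+[m/n]*n (a + m) p ⟩
      (a + m) % p + ((a + m) / p) * p        ≡⟨ cong (_+ ((a + m) / p) * p) eq ⟩
      r + ((a + m) / p) * p                    ∎)

  <⇒∤ : ∀ {a p} → 0 < a → a < p → ¬ p ∣ a
  <⇒∤ {suc a} _ a<p p∣a = ℕ.<⇒≱ a<p (∣⇒≤ p∣a)

  -- `j` is `m - i` modulo `p` written without subtraction, as `j + i` equals `i * p + m`.
  reach-index : ∀ i m p-1 → let j = i * p-1 + m in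
    (j / suc p-1) * suc p-1 + (j % suc p-1 + i) ≡ i * suc p-1 + m
  reach-index i m p-1 = begin-equality
    (j / p) * p + (j % p + i)    ≡⟨ ℕ.+-assoc ((j / p) * p) (j % p) i ⟨
    (j / p) * p + j % p + i      ≡⟨ cong (_+ i) (ℕ.+-comm ((j / p) * p) (j % p)) ⟩
    j % p + (j / p) * p + i      ≡⟨ cong (_+ i) (m≡m%n+[m/n]*n j p) ⟨
    j + i                            ≡⟨ regroup i m p-1 ⟩
    i * p + m                      ∎
    where
    open ℕ.≤-Reasoning
    p = suc p-1
    j = i * p-1 + m
    regroup : ∀ i m p-1 → i * p-1 + m + i ≡ i * suc p-1 + m
    regroup = ℕ-solve-∀

  module Cycles {n : ℕ} (G : Graph n) where
    open Graph G
    open Induced G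

    -- A cycle of G[S] unrolled to a periodic sequence of vertices.
    record PCycle (S : Subset n) : Set where
      field
        p-3      : ℕ
      p : ℕ
      p = 3 + p-3
      field
        f        : ℕ → Fin n
        periodic : ∀ m → f (p + m) ≡ f m
        edge     : ∀ m → E S (f m) (f (suc m))
        distinct : ∀ a m → 0 < a → a < p → f (a + m) ≢ f m

      -- The index is `p - 1 + m`, so the predecessor of position 0 needs no separate case.
      prev : ℕ → Fin n
      prev m = f (2 + p-3 + m)

      f∈S : ∀ m → f m ∈ S
      f∈S m = proj₁ (edge m)

      edge-prev : ∀ m → E S (f m) (prev m)
      edge-prev m = E-sym (subst (E S (prev m)) (periodic m) (edge (2 + p-3 + m)))

      periodic* : ∀ k m → f (k * p + m) ≡ f m
      periodic* zero    m = refl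
      periodic* (suc k) m = trans (cong f (ℕ.+-assoc p (k * p) m)) (trans (periodic (k * p + m)) (periodic* k m))

      f-% : ∀ m → f (m % p) ≡ f m
      f-% m = trans (sym (periodic* (m / p) (m % p)))
        (cong f (trans (ℕ.+-comm ((m / p) * p) (m % p)) (sym (m≡m%n+[m/n]*n m p))))

      prev-suc : ∀ m → prev (suc m) ≡ f m
      prev-suc m = trans (cong f (ℕ.+-suc (2 + p-3) m)) (periodic m)

      f-inj : ∀ i j → i < j → j < p → f i ≢ f j
      f-inj i j i<j j<p eq = distinct (j ∸ i) i (ℕ.m<n⇒0<n∸m i<j) (≤-<-trans (ℕ.m∸n≤m j i) j<p)
        (trans (cong f (ℕ.m∸n+n≡m (ℕ.<⇒≤ i<j))) (sym eq))

      f-inj-% : ∀ i j → f i ≡ f j → i % p ≡ j % p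
      f-inj-% i j eq with ℕ.<-cmp (i % p) (j % p) | trans (f-% i) (trans eq (sym (f-% j)))
      ... | B.tri< i<j _ _ | eq′ = contradiction eq′ (f-inj _ _ i<j (m%n<n j p))
      ... | B.tri≈ _ i≡j _ | _   = i≡j
      ... | B.tri> _ _ j<i | eq′ = contradiction (sym eq′) (f-inj _ _ j<i (m%n<n i p))

      f-step : ∀ i j → f i ≡ f j → f (suc i) ≡ f (suc j)
      f-step i j eq = trans (sym (f-% (suc i))) (trans (cong f (trans (sym (suc-%% i p))
        (trans (cong (λ r → suc r % p) (f-inj-% i j eq)) (suc-%% j p)))) (f-% (suc j)))

      f-steps : ∀ k i j → f i ≡ f j → f (k + i) ≡ f (k + j)
      f-steps zero    i j eq = eq
      f-steps (suc k) i j eq = f-step _ _ (f-steps k i j eq)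

      f-back : ∀ i j → f (suc i) ≡ f (suc j) → f i ≡ f j
      f-back i j eq = trans (sym (prev-suc i)) (trans (f-steps (2 + p-3) (suc i) (suc j) eq) (prev-suc j))

      opaque
        reach : ∀ i m → ∃[ j ] j < p × f (j + i) ≡ f m
        reach i m = j % p , m%n<n j p , trans (sym (periodic* (j / p) (j % p + i)))
          (trans (cong f (reach-index i m (2 + p-3))) (periodic* i m))
          where
          j : ℕ
          j = i * (2 + p-3) + m

      walk : ∀ x m j → (∀ i → i ≤ j → f (i + m) ≢ x) → Con (S - x) (f m) (f (j + m))
      walk x m zero    avoid = nil
      walk x m (suc j) avoid = walk x m j (λ i i≤j → avoid i (ℕ.m≤n⇒m≤1+n i≤j))
        ◅◅ (E-remove⁺ (edge (j + m)) (avoid j (ℕ.n≤1+n j)) (avoid (suc j) ≤-refl) ◅ nil)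

      around : ∀ m j → suc j < p → Con (S - f m) (f (suc m)) (f (suc j + m))
      around m j sj<p = subst (λ k → Con (S - f m) (f (suc m)) (f k)) (ℕ.+-suc j m)
        (walk (f m) (suc m) j λ i i≤j → subst (λ k → f k ≢ f m) (sym (ℕ.+-suc i m))
          (distinct (suc i) m (s≤s z≤n) (≤-<-trans (s≤s i≤j) sj<p)))

      cycPair : ∀ m → CycPair S (f m) (f (suc m)) (prev m)
      cycPair m = subst (λ k → f (suc m) ≢ f k) (ℕ.+-suc (suc p-3) m)
                    (distinct (suc p-3) (suc m) (s≤s z≤n) (s≤s (ℕ.m≤n⇒m≤1+n (≤-refl))) ∘ sym)
                , edge m , edge-prev m , around m (suc p-3) ≤-refl

      OnP : Fin n → Set
      OnP v = ∃[ m ] f m ≡ v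

      opaque
        OnP? : Decidable OnP
        OnP? v = map′ (λ (i , eq) → toℕ i , eq)
          (λ (m , eq) → Fin.fromℕ< (m%n<n m p) , trans (cong f (Fin.toℕ-fromℕ< (m%n<n m p))) (trans (f-% m) eq))
          (Fin.any? {n = p} λ i → f (toℕ i) Fin.≟ v)

      from-next : ∀ m {v} → OnP v → v ≢ f m → Con (S - f m) (f (suc m)) v
      from-next m (k , refl) v≢ with reach m k
      ... | zero  , _    , eq = contradiction (sym eq) v≢
      ... | suc j , sj<p , eq = subst (Con (S - f m) (f (suc m))) eq (around m j sj<p)

      chord : ∀ m {v} → OnP v → E S (f m) v → CE S (f m) v
      chord m {v} on e with v Fin.≟ f (suc m)
      ... | yes refl = _ , cycPair m
      ... | no  v≢   = f (suc m) , v≢ , e , edge m , Con-sym (from-next m on (E-≢ e ∘ sym))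

    open PCycle

    restrict : ∀ {S S′} (P : PCycle S) → (∀ m → f P m ∈ S′) → PCycle S′
    restrict P f∈ = record
      { p-3 = p-3 P ; f = f P ; periodic = periodic P ; distinct = distinct P
      ; edge = λ m → f∈ m , f∈ (suc m) , proj₂ (proj₂ (edge P m)) }

    shift : ∀ {S} → PCycle S → PCycle S
    shift P = record
      { p-3 = p-3 P ; f = f P ∘ suc
      ; periodic = λ m → trans (cong (f P) (sym (ℕ.+-suc (p P) m))) (periodic P (suc m))
      ; edge = edge P ∘ suc
      ; distinct = λ a m 0<a a<p → subst (λ i → f P i ≢ f P (suc m)) (ℕ.+-suc a m) (distinct P a (suc m) 0<a a<p) }

    module _ {S : Subset n} (C : Cycle G) where
      open Cycle C

      unroll : (∀ i → vertex i ∈ S) → PCycle S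
      unroll v∈ = record
        { p-3 = order-3
        ; f = λ m → vertex (m mod order)
        ; periodic = λ m → cong vertex (Fin.toℕ-injective (trans (toℕ-mod (order + m))
            (trans (trans (cong (_% order) (ℕ.+-comm order m)) ([m+n]%n≡m%n m order)) (sym (toℕ-mod m)))))
        ; edge = λ m → v∈ (m mod order) , v∈ (suc m mod order)
            , subst (λ j → Adj (vertex (m mod order)) (vertex j)) (next-mod m) (Cycle.edge C (m mod order))
        ; distinct = λ a m 0<a a<p eq → <⇒∤ 0<a a<p (+-%-cancel a m order
            (trans (sym (toℕ-mod (a + m))) (trans (cong toℕ (vertex-inj eq)) (toℕ-mod m))))
        }
        where
        toℕ-mod : ∀ m → toℕ (m mod order) ≡ m % order
        toℕ-mod m = Fin.toℕ-fromℕ< (m%n<n m order)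
        next-mod : ∀ m → next (m mod order) ≡ suc m mod order
        next-mod m = Fin.toℕ-injective (trans (toℕ-mod (suc (toℕ (m mod order))))
          (trans (cong (λ r → suc r % order) (toℕ-mod m)) (trans (suc-%% m order) (sym (toℕ-mod (suc m))))))

      unroll-vertex : (v∈ : ∀ i → vertex i ∈ S) → ∀ i → f (unroll v∈) (toℕ i) ≡ vertex i
      unroll-vertex v∈ i = cong vertex (Fin.toℕ-injective (trans (Fin.toℕ-fromℕ< (m%n<n (toℕ i) order)) (m<n⇒m%n≡m (Fin.toℕ<n i))))

    module _ {S : Subset n} (P : PCycle S) where

      f-next : ∀ (i : Fin (p P)) → f P (toℕ (next i)) ≡ f P (suc (toℕ i))
      f-next i = trans (cong (f P) (Fin.toℕ-fromℕ< (m%n<n (suc (toℕ i)) (p P)))) (f-% P (suc (toℕ i)))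

      roll : Cycle G
      roll = record
        { order-3 = p-3 P
        ; vertex = f P ∘ toℕ
        ; vertex-inj = λ {i} {j} eq → inj i j eq
        ; edge = λ i → subst (Adj (f P (toℕ i))) (sym (f-next i)) (proj₂ (proj₂ (edge P (toℕ i))))
        }
        where
        inj : ∀ (i j : Fin (p P)) → f P (toℕ i) ≡ f P (toℕ j) → i ≡ j
        inj i j eq with Fin.<-cmp i j
        ... | B.tri< i<j _ _ = contradiction eq (f-inj P _ _ i<j (Fin.toℕ<n j))
        ... | B.tri≈ _ i≡j _ = i≡j
        ... | B.tri> _ _ j<i = contradiction (sym eq) (f-inj P _ _ j<i (Fin.toℕ<n i))

      roll-edge : ∀ m → EdgeOf roll (f P m) (f P (suc m))
      roll-edge m = i , inj₁ (fi , trans (f-next i) (trans (cong (f P ∘ suc) (Fin.toℕ-fromℕ< (m%n<n m (p P))))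
          (trans (sym (f-% P (suc (m % p P)))) (trans (cong (f P) (suc-%% m (p P))) (f-% P (suc m))))))
        where
        i = Fin.fromℕ< (m%n<n m (p P))
        fi : f P (toℕ i) ≡ f P m
        fi = trans (cong (f P) (Fin.toℕ-fromℕ< (m%n<n m (p P)))) (f-% P m)

    EdgeOf-sym : ∀ {C : Cycle G} {u v} → EdgeOf C u v → EdgeOf C v u
    EdgeOf-sym (i , inj₁ p) = i , inj₂ p
    EdgeOf-sym (i , inj₂ p) = i , inj₁ p

    record Path (S : Subset n) (s t : Fin n) : Set where
      field
        len   : ℕ
        g     : ℕ → Fin n
        start : g 0 ≡ s
        end   : g len ≡ t
        step  : ∀ i → i < len → E S (g i) (g (suc i))
        inj   : ∀ i j → i < j → j ≤ len → g i ≢ g j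
        mem   : ∀ i → i ≤ len → g i ∈ S

    cons : Fin n → (ℕ → Fin n) → ℕ → Fin n
    cons x g zero    = x
    cons x g (suc i) = g i

    -- After the last departure from `s` the walk lives in `S - s`; this gives injectivity and makes
    -- the recursion on the size of the set terminate.
    simplePath : ∀ k S {s t} → ∣ S ∣ ≤ k → s ∈ S → Con S s t → Path S s t
    simplePath k S {s} {t} ∣S∣≤k s∈ c with s Fin.≟ t
    ... | yes refl = record { len = 0 ; g = λ _ → s ; start = refl ; end = refl ; step = λ _ ()
                            ; inj = λ { i (suc j) _ () } ; mem = λ _ _ → s∈ }
    simplePath zero S ∣S∣≤0 s∈ c | no s≢t = contradiction (≤-trans (x∈p⇒∣p-x∣<∣p∣ s∈) ∣S∣≤0) λ ()
    simplePath (suc k) S {s} {t} ∣S∣≤k s∈ c | no s≢t with lastExit S s c (s≢t ∘ sym)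
    ... | inj₁ (s≢s , _) = contradiction refl s≢s
    ... | inj₂ (v , e , c′) = record
      { len = suc len ; g = cons s g ; start = refl ; end = end
      ; step = λ { zero _ → subst (E S s) (sym start) e ; (suc i) (s≤s i<) → E-mono (remove⊆ S s) (step i i<) }
      ; inj = λ { zero (suc j) _ (s≤s j≤) eq → proj₂ (∈-remove⁻ S (mem j j≤)) (sym eq)
                ; (suc i) (suc j) (s≤s i<j) (s≤s j≤) → inj i j i<j j≤ }
      ; mem = λ { zero _ → s∈ ; (suc i) (s≤s i≤) → remove⊆ S s (mem i i≤) }
      }
      where
      open Path (simplePath k (S - s) (≤-pred (≤-trans (x∈p⇒∣p-x∣<∣p∣ s∈) ∣S∣≤k)) (∈-remove⁺ (proj₁ (proj₂ e)) (E-≢ e ∘ sym)) c′)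

    closePath : ∀ {S x a b} → CycPair S x a b → Path (S - x) a b → Σ[ P ∈ PCycle S ] f P 0 ≡ x × f P 1 ≡ a
    closePath (a≢b , _) record { len = zero ; start = refl ; end = end } = contradiction end a≢b
    closePath {S} {x} (_ , ea , eb , _) record { len = suc l ; g = g ; start = start ; end = end ; step = step ; inj = inj ; mem = mem } =
      -- A path with `suc l` steps has `2 + l` vertices; together with `x` the cycle has order
      -- `3 + l`.
      record { p-3 = l ; f = λ m → h (m % q)
             ; periodic = λ m → cong h (trans (cong (_% q) (ℕ.+-comm q m)) ([m+n]%n≡m%n m q))
             ; edge = λ m → edge′ m (ℕ.m≤n⇒m<n∨m≡n (m%n<n m q))
             ; distinct = λ a m 0<a a<q eq → <⇒∤ 0<a a<q (+-%-cancel a m q (h-inj _ _ (m%n<n (a + m) q) (m%n<n m q) eq)) }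
      , refl , trans (cong h (m<n⇒m%n≡m {n = q} {m = 1} (s≤s (s≤s z≤n)))) start
      where
      q = 3 + l
      h = cons x g
      h-edge : ∀ r → suc r < q → E S (h r) (h (suc r))
      h-edge zero    _ = subst (E S x) (sym start) ea
      h-edge (suc r) (s≤s (s≤s r<)) = E-mono (remove⊆ S x) (step r r<)
      h-apart : ∀ i j → i < j → j < q → h i ≢ h j
      h-apart zero    (suc j) _ (s≤s j<) eq = proj₂ (∈-remove⁻ S (mem j (≤-pred j<))) (sym eq)
      h-apart (suc i) (suc j) (s≤s i<j) (s≤s j<) = inj i j i<j (≤-pred j<)
      h-inj : ∀ i j → i < q → j < q → h i ≡ h j → i ≡ j
      h-inj i j i< j< eq with ℕ.<-cmp i j
      ... | B.tri< i<j _ _ = contradiction eq (h-apart i j i<j j<)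
      ... | B.tri≈ _ i≡j _ = i≡j
      ... | B.tri> _ _ j<i = contradiction (sym eq) (h-apart j i j<i i<)
      edge′ : ∀ m → suc (m % q) < q ⊎ suc (m % q) ≡ q → E S (h (m % q)) (h (suc m % q))
      edge′ m (inj₁ sr<q) = subst (E S (h (m % q))) (cong h (trans (sym (m<n⇒m%n≡m sr<q)) (suc-%% m q))) (h-edge (m % q) sr<q)
      edge′ m (inj₂ sr≡q) = subst₂ (E S) (trans (sym end) (cong h (sym (ℕ.suc-injective sr≡q))))
        (cong h (trans (sym (n%n≡0 q)) (trans (cong (_% q) (sym sr≡q)) (suc-%% m q)))) (E-sym eb)

    opaque
      cycleThrough : ∀ {S x a b} → CycPair S x a b → Σ[ P ∈ PCycle S ] f P 0 ≡ x × f P 1 ≡ a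
      cycleThrough {S} {x} pair@(_ , ea , _ , c) =
        closePath pair (simplePath _ (S - x) ≤-refl (∈-remove⁺ (proj₁ (proj₂ ea)) (E-≢ ea ∘ sym)) c)

    -- In a cactus, two cycles through a common vertex leave it along the same
    -- edges, so they have the same edges all the way round.
    module _ {S} (U : Cactus S) (P Q : PCycle S) where

      same-step : ∀ {i k} → f P i ≡ f Q k → f P (suc i) ≡ f Q (suc k) ⊎ f P (suc i) ≡ prev Q k
      same-step {i} {k} eq = U (subst (λ x → CycPair S x (f Q (suc k)) (prev Q k)) (sym eq) (cycPair Q k)) (_ , cycPair P i)

      same-vertices : ∀ {i k} → f P i ≡ f Q k → ∀ j → OnP Q (f P (j + i))
      same-vertices {k = k} eq zero = k , sym eq
      same-vertices {i} eq (suc j) with same-vertices {i} eq j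
      ... | k′ , eq′ = [ (λ e → _ , sym e) , (λ e → _ , sym e) ]′ (same-step {j + i} {k′} (sym eq′))

      same-OnP : ∀ {v} → OnP P v → OnP Q v → ∀ m → OnP Q (f P m)
      same-OnP (i , eq) (k , eq′) m with reach P i m
      ... | j , _ , eq″ = subst (OnP Q) eq″ (same-vertices {i} (trans eq (sym eq′)) j)

      same-edge : ∀ {v} → OnP P v → OnP Q v → ∀ m → EdgeOf (roll Q) (f P m) (f P (suc m))
      same-edge on on′ m with same-OnP on on′ m
      ... | k , eq = subst (λ x → EdgeOf (roll Q) x (f P (suc m))) eq (case same-step {m} {k} (sym eq) of λ where
          (inj₁ e) → subst (EdgeOf (roll Q) (f Q k)) (sym e) (roll-edge Q k)
          (inj₂ e) → subst (EdgeOf (roll Q) (f Q k)) (sym e) (EdgeOf-sym {roll Q}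
                       (subst (EdgeOf (roll Q) (prev Q k)) (periodic Q k) (roll-edge Q _))))

    Bridge : Subset n → Fin n → Fin n → Set
    Bridge S a b = E S a b × ¬ CE S a b

    Pend : Subset n → Fin n → Fin n → Set
    Pend S u v = E S u v × (∀ w → E S u w → w ≡ v)

    opaque
      Pend? : ∀ S → B.Decidable (Pend S)
      Pend? S u v = E? S u v ×-dec Fin.all? λ w → E? S u w →-dec (w Fin.≟ v)

    -- In a cactus the cyclic edges at a cycle vertex are the two edges of the cycle itself, so
    -- there `yw` is the only edge leaving the cycle and chords are excluded.
    record LeafCycle (S : Subset n) (y w : Fin n) : Set where
      field
        cycle  : PCycle S
        f0     : f cycle 0 ≡ y
        bridge : Bridge S y w
        only   : ∀ m d → E S (f cycle m) d → CE S (f cycle m) d ⊎ (f cycle m ≡ y × d ≡ w)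

    -- Following bridges away from a, the set of vertices beyond the bridge
    -- shrinks until a pendant vertex or a cycle with one outgoing edge is met.
    module Search {S : Subset n} (U : Cactus S) where

      far : Fin n → Fin n → Subset n
      far a b = ⟦ con? (S - a) b ⟧

      Found : Fin n → Fin n → Set
      Found a b = (∃[ u ] ∃[ v ] Pend S u v) ⊎ (∃[ y ] ∃[ w ] LeafCycle S y w × Con (S - a) b y)

      -- A walk from `d` off `c` cannot meet `a`, because `a` does not reach `d` off `c`. It can
      -- therefore be appended to the route from `b` through `c`.
      beyond : ∀ {a b c d} → Con (S - a) b c → c ≢ a → E S c d → ¬ Con (S - c) a d →
        ∀ {v} → Con (S - c) d v → Con (S - a) b v
      beyond {a} {b} {c} {d} b~c c≢a e a≁d {v} d~v = b~c ◅◅ (E-remove⁺ e c≢a (λ { refl → a≁d nil }) ◅ d~v′)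
        where
        v≢a : v ≢ a
        v≢a refl = a≁d (Con-sym d~v)
        d~v′ : Con (S - a) d v
        d~v′ with lastExit (S - c) a d~v v≢a
        ... | inj₁ (_ , p) = Con-mono (remove-mono (remove⊆ S c)) p
        ... | inj₂ (u , au , p) = contradiction (au ◅ Con-mono (remove⊆ (S - c) a) p ◅◅ Con-sym d~v) a≁d

      shrinks : ∀ {a b c d} → Con (S - a) b c → c ≢ a → E S c d → ¬ Con (S - c) a d →
        ∣ far c d ∣ < ∣ far a b ∣
      shrinks {a} {b} {c} {d} b~c c≢a e a≁d = p⊂q⇒∣p∣<∣q∣
        ( (λ v∈ → ∈-⟦⟧⁺ (con? (S - a) b) (beyond b~c c≢a e a≁d (∈-⟦⟧⁻ (con? (S - c) d) v∈)))
        , c , ∈-⟦⟧⁺ (con? (S - a) b) b~c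
        , λ c∈ → proj₂ (∈-remove⁻ S (Con-∈ (Con-sym (∈-⟦⟧⁻ (con? (S - c) d) c∈)) (∈-remove⁺ (proj₁ (proj₂ e)) (E-≢ e ∘ sym)))) refl)

      search : ∀ a b → Acc _<_ ∣ far a b ∣ → Bridge S a b → Found a b

      descend : ∀ {a b c d} → Acc _<_ ∣ far a b ∣ → Con (S - a) b c → c ≢ a → Bridge S c d → ¬ Con (S - c) a d → Found a b
      descend {a} {b} {c} {d} (acc rec) b~c c≢a br a≁d with search c d (rec (shrinks b~c c≢a (proj₁ br) a≁d)) br
      ... | inj₁ pend = inj₁ pend
      ... | inj₂ (y , w , leaf , d~y) = inj₂ (y , w , leaf , beyond b~c c≢a (proj₁ br) a≁d d~y)

      -- A route from `a` to `d` off `b` would close a cycle through the bridge `ab`.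
      stays : ∀ {a b d} → Bridge S a b → E S b d → d ≢ a → ¬ Con (S - b) a d
      stays (e , ¬ce) e′ d≢a c = ¬ce (CE-sym (_ , d≢a ∘ sym , E-sym e , e′ , c))

      search a b ac br@(e , ¬ce) with OnCyc? S b
      search a b ac br@(e , ¬ce) | no ¬cyc with Fin.any? (λ d → E? S b d ×-dec ¬? (d Fin.≟ a))
      ... | no none = inj₁ (b , a , E-sym e , λ w ew → case w Fin.≟ a of λ where
              (yes eq) → eq
              (no w≢a) → contradiction (w , ew , w≢a) none)
      ... | yes (d , ed , d≢a) = descend ac nil (E-≢ e ∘ sym) (ed , λ ce → ¬cyc (_ , ce)) (stays br ed d≢a)
      search a b ac br@(e , ¬ce) | yes (w₀ , b₀ , pair) with cycleThrough pair
      ... | P , f0 , _ with Fin.any? (λ c → Fin.any? λ d → OnP? P c ×-dec E? S c d ×-dec ¬? (CE? S c d) ×-dec ¬? ((c Fin.≟ b) ×-dec (d Fin.≟ a)))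
      ...   | no none = inj₂ (b , a , record { cycle = P ; f0 = f0 ; bridge = E-sym e , ¬ce ∘ CE-sym ; only = only } , nil)
        where
        only : ∀ m d → E S (f P m) d → CE S (f P m) d ⊎ (f P m ≡ b × d ≡ a)
        only m d ed with CE? S (f P m) d | (f P m Fin.≟ b) ×-dec (d Fin.≟ a)
        ... | yes ce | _ = inj₁ ce
        ... | no _ | yes eqs = inj₂ eqs
        ... | no ¬c | no ¬eqs = contradiction (f P m , d , (m , refl) , ed , ¬c , ¬eqs) none
      ...   | yes (c , d , (m , refl) , ed , ¬ced , ¬eqs) = descend ac b~c c≢a (ed , ¬ced) a≁d
        where
        -- If `a` lay on the cycle, the edge `ba` would join two of its vertices and be cyclic.
        off : ∀ k → f P k ≢ a
        off k refl = ¬ce (CE-sym (subst (λ x → CE S x (f P k)) f0 (chord P 0 (k , refl) (subst (λ x → E S x (f P k)) (sym f0) (E-sym e)))))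
        c≢a : f P m ≢ a
        c≢a = off m
        b~c : Con (S - a) b (f P m)
        b~c with reach P 0 m
        ... | j , _ , eq = subst₂ (Con (S - a)) f0 eq (walk P a 0 j λ i _ → off (i + 0))
        a≁d : ¬ Con (S - f P m) a d
        a≁d a~d with f P m Fin.≟ b
        ... | yes refl = stays br ed (λ d≡a → ¬eqs (refl , d≡a)) a~d
        -- The arc from the successor of `c` to `b`, the edge `ba` and the route from `a` to `d` all
        -- avoid `c`; together they would put `cd` on a cycle.
        ... | no c≢b = ¬ced (f P (suc m) , d≢next , ed , edge P m ,
                Con-sym (from-next P m (0 , f0) (c≢b ∘ sym) ◅◅ (E-remove⁺ (E-sym e) (c≢b ∘ sym) (c≢a ∘ sym) ◅ a~d)))
          where
          d≢next : d ≢ f P (suc m)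
          d≢next refl = ¬ced (_ , cycPair P m)

      opaque
        findLeaf : ∀ {a b} → Bridge S a b → Found a b
        findLeaf {a} {b} = search a b (<-wellFounded _)

  order-form : ∀ p → p % 4 ≡ 2 → p ≡ 2 + p / 4 * 4
  order-form p eq = trans (m≡m%n+[m/n]*n p 4) (cong (_+ p / 4 * 4) eq)

  θ-arithmetic : ∀ e n c k → e + c ≡ n + k → (+ e ℤ.- + n) ℤ.+ + c ≡ + k
  θ-arithmetic e n c k eq = trans (regroup (+ e) (+ n) (+ c)) (trans (cong (λ x → + x ℤ.- + n) eq) (collapse (+ n) (+ k)))
    where
    regroup : ∀ e n c → (e ℤ.- n) ℤ.+ c ≡ (e ℤ.+ c) ℤ.- n
    regroup = solve-∀
    collapse : ∀ n k → (n ℤ.+ k) ℤ.- n ≡ k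
    collapse = solve-∀

  rank-arithmetic : ∀ a b e n c → + a ≡ + b ℤ.- + 2 ℤ.* ((+ e ℤ.- + n) ℤ.+ + c) →
    a + 2 * (e + c) ≡ b + 2 * n
  rank-arithmetic a b e n c eq = ℤ.+-injective (begin
    + (a + 2 * (e + c))                                              ≡⟨ cong (λ x → + a ℤ.+ x) (ℤ.pos-* 2 (e + c)) ⟩
    + a ℤ.+ + 2 ℤ.* (+ e ℤ.+ + c)                                          ≡⟨ cong (λ x → x ℤ.+ + 2 ℤ.* (+ e ℤ.+ + c)) eq ⟩
    + b ℤ.- + 2 ℤ.* ((+ e ℤ.- + n) ℤ.+ + c) ℤ.+ + 2 ℤ.* (+ e ℤ.+ + c)      ≡⟨ shuffle (+ b) (+ e) (+ n) (+ c) ⟩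
    + b ℤ.+ + 2 ℤ.* + n                                                    ≡⟨ cong (λ x → + b ℤ.+ x) (ℤ.pos-* 2 n) ⟨
    + (b + 2 * n)                                                      ∎)
    where
    open ≡-Reasoning
    shuffle : ∀ b e n c → (b ℤ.- + 2 ℤ.* ((e ℤ.- n) ℤ.+ c)) ℤ.+ + 2 ℤ.* (e ℤ.+ c) ≡ b ℤ.+ + 2 ℤ.* n
    shuffle = solve-∀

  module GraphFacts {n : ℕ} (G : Graph n) where
    open Graph G
    open Induced G
    open Cycles G

    private
      neighbours : Subset n → Fin n → Subset n
      neighbours S u = S ∩ tabulate (adj u)

      ∈-neighbours⁺ : ∀ {S u w} → w ∈ S → Adj u w → w ∈ neighbours S u
      ∈-neighbours⁺ {S} {u} {w} w∈ e = x∈p∩q⁺ (w∈ , lookup⇒[]= w _ (trans (lookup∘tabulate (adj u) w) (Equivalence.to T-≡ e)))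

      ∈-neighbours⁻ : ∀ {S u w} → w ∈ neighbours S u → w ∈ S × Adj u w
      ∈-neighbours⁻ {S} {u} {w} w∈ = let w∈S , w∈N = x∈p∩q⁻ S _ w∈ in
        w∈S , Equivalence.from T-≡ (trans (sym (lookup∘tabulate (adj u) w)) ([]=⇒lookup w∈N))

    Pend⇒Pendant : ∀ {S u v} → Pend S u v → Pendant G S u
    Pend⇒Pendant {S} {u} {v} ((u∈ , v∈ , e) , only) = u∈ , trans (∣∣-remove N (∈-neighbours⁺ v∈ e))
      (cong suc (trans (cong ∣_∣ (Empty-unique {p = N - v} λ (w , w∈) →
        let w∈N , w≢v = ∈-remove⁻ N w∈ ; w∈S , e′ = ∈-neighbours⁻ w∈N in w≢v (only w (u∈ , w∈S , e′)))) (∣⊥∣≡0 n)))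
      where N = neighbours S u

    Pendant⇒Pend : ∀ {S u v} → Pendant G S u → v ∈ S → Adj u v → Pend S u v
    Pendant⇒Pend {S} {u} {v} (u∈ , deg≡1) v∈ e = (u∈ , v∈ , e) , λ w (_ , w∈ , e′) → decidable-stable (w Fin.≟ v) λ w≢v →
      contradiction (∣∣-remove (N - v) (∈-remove⁺ (∈-neighbours⁺ w∈ e′) w≢v))
        λ eq → case trans (sym deg≡1) (trans (∣∣-remove N (∈-neighbours⁺ v∈ e)) (cong suc eq)) of λ ()
      where N = neighbours S u

    Pendant⇒∃Pend : ∀ {S u} → Pendant G S u → ∃[ v ] Pend S u v
    Pendant⇒∃Pend {S} {u} pend@(u∈ , deg≡1) with nonempty? (neighbours S u)
    ... | yes (v , v∈) = let v∈S , e = ∈-neighbours⁻ v∈ in v , Pendant⇒Pend pend v∈S e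
    ... | no ¬ne = case trans (sym deg≡1) (trans (cong ∣_∣ (Empty-unique ¬ne)) (∣⊥∣≡0 n)) of λ ()

    opaque
      unfolding ec

      ec-full : ec full ≡ edgeCount G + componentCount G
      ec-full = edges+components-cong (induced full) G
        ((λ {u} {v} e → proj₂ (proj₂ (induced⁻ {full} {u} {v} e))) , λ {u} {v} e → induced⁺ {full} {u} {v} (∈⊤ , ∈⊤ , e))

    θ≡ : ∀ {k} → ec full ≡ n + k → θ G ≡ + k
    θ≡ {k} eq = θ-arithmetic (edgeCount G) n (componentCount G) k (trans (sym ec-full) eq)

    rank-equation : ∀ {a b} → + a ≡ + b ℤ.- + 2 ℤ.* θ G → a + 2 * ec full ≡ b + 2 * n
    rank-equation {a} {b} eq = trans (cong (λ x → a + 2 * x) ec-full)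
      (rank-arithmetic a b (edgeCount G) n (componentCount G) eq)

    module _ (C : Cycle G) where
      open Cycle C

      onFull : PCycle full
      onFull = unroll C (λ _ → ∈⊤)

      EdgeOf-unroll : ∀ {S} (v∈ : ∀ i → vertex i ∈ S) {u v} → EdgeOf (roll (unroll C v∈)) u v → EdgeOf C u v
      EdgeOf-unroll v∈ (i , eqs) = i , [ inj₁ ∘ conv , inj₂ ∘ conv ]′ eqs
        where
        conv : ∀ {u v} → (PCycle.f (unroll C v∈) (toℕ i) ≡ u × PCycle.f (unroll C v∈) (toℕ (next i)) ≡ v) → vertex i ≡ u × vertex (next i) ≡ v
        conv (p , q) = trans (sym (unroll-vertex C v∈ i)) p , trans (sym (unroll-vertex C v∈ (next i))) q

      OnCycle⇒OnP : ∀ {S} (v∈ : ∀ i → vertex i ∈ S) {v} → OnCycle C v → PCycle.OnP (unroll C v∈) v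
      OnCycle⇒OnP v∈ (i , eq) = toℕ i , trans (unroll-vertex C v∈ i) eq

    cactus⇒disjoint : Cactus full → CyclesPairwiseDisjoint G
    cactus⇒disjoint U C D ¬same v (onC , onD) = ¬same λ a b → mk⇔ (share C D onC onD) (share D C onD onC)
      where
      share : ∀ C D → OnCycle C v → OnCycle D v → ∀ {a b} → EdgeOf C a b → EdgeOf D a b
      share C D onC onD (i , eqs) = case eqs of λ where
          (inj₁ (refl , refl)) → edgeD
          (inj₂ (refl , refl)) → EdgeOf-sym {D} edgeD
        where
        edgeD : EdgeOf D (Cycle.vertex C i) (Cycle.vertex C (next i))
        edgeD = EdgeOf-unroll D (λ _ → ∈⊤) (subst (λ x → EdgeOf (roll (onFull D)) x (Cycle.vertex C (next i))) (unroll-vertex C (λ _ → ∈⊤) i)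
          (same-edge U (onFull C) (onFull D) (OnCycle⇒OnP C (λ _ → ∈⊤) onC) (OnCycle⇒OnP D (λ _ → ∈⊤) onD) (toℕ i)))

-- Kernels and ranks of weighted graphs with cycle components

module WeightedGraphs where

  import Algebra.Properties.Ring
  import Relation.Binary.Reasoning.Setoid
  open import Data.Bool.Base using (Bool; true; false; not)
  open import Data.Bool.Properties using (not-involutive; ¬-not) renaming (_≟_ to _≟ᵇ_)
  open import Data.Fin.Subset using (_-_) renaming (⊥ to empty)
  open import Data.Nat.DivMod
  open Subsets
  open LinearAlgebra
  open InducedSubgraphs
  open CyclesAndBridges

  addAll : ∀ {n} → Subset n → (ℕ → Fin n) → ℕ → Subset n
  addAll T g zero    = T
  addAll T g (suc k) = addAll T g k ▻ g k

  ∈-addAll⁻ : ∀ {n} (T : Subset n) g k {v} → v ∈ addAll T g k → v ∈ T ⊎ (∃[ i ] i < k × v ≡ g i)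
  ∈-addAll⁻ T g zero    v∈ = inj₁ v∈
  ∈-addAll⁻ T g (suc k) v∈ with ∈-add⁻ (addAll T g k) v∈
  ... | inj₂ v≡ = inj₂ (k , ≤-refl , v≡)
  ... | inj₁ v∈′ with ∈-addAll⁻ T g k v∈′
  ...   | inj₁ v∈T = inj₁ v∈T
  ...   | inj₂ (i , i<k , v≡) = inj₂ (i , ℕ.m≤n⇒m≤1+n i<k , v≡)

  ∈-addAll⁺ˡ : ∀ {n} {T : Subset n} g k {v} → v ∈ T → v ∈ addAll T g k
  ∈-addAll⁺ˡ g zero    v∈ = v∈
  ∈-addAll⁺ˡ g (suc k) v∈ = ∈-add⁺ˡ (∈-addAll⁺ˡ g k v∈)

  ∈-addAll⁺ʳ : ∀ {n} {T : Subset n} g {k i} → i < k → g i ∈ addAll T g k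
  ∈-addAll⁺ʳ {T = T} g {suc k} {i} i<sk with ℕ.m≤n⇒m<n∨m≡n (≤-pred i<sk)
  ... | inj₁ i<k    = ∈-add⁺ˡ (∈-addAll⁺ʳ {T = T} g i<k)
  ... | inj₂ ≡.refl = ∈-add⁺ʳ

  ∣addAll∣ : ∀ {n} (T : Subset n) g k → (∀ i → i < k → g i ∉ T) → (∀ i j → i < j → j < k → g i ≢ g j) →
    ∣ addAll T g k ∣ ≡ k ℕ.+ ∣ T ∣
  ∣addAll∣ T g zero    _ _ = ≡.refl
  ∣addAll∣ T g (suc k) g∉T g-inj = ≡.trans
    (∣∣-add (addAll T g k) λ gk∈ → case ∈-addAll⁻ T g k gk∈ of λ where
      (inj₁ gk∈T) → g∉T k ≤-refl gk∈T
      (inj₂ (i , i<k , eq)) → g-inj i k i<k ≤-refl (≡.sym eq))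
    (≡.cong suc (∣addAll∣ T g k (λ i i<k → g∉T i (ℕ.m≤n⇒m≤1+n i<k)) (λ i j i<j j<k → g-inj i j i<j (ℕ.m≤n⇒m≤1+n j<k))))

  even : ℕ → Bool
  even zero    = true
  even (suc m) = not (even m)

  even-4* : ∀ q → even (q ℕ.* 4) ≡ true
  even-4* zero    = ≡.refl
  even-4* (suc q) rewrite even-4* q = ≡.refl

  module WeightedGraph (K : StableDomain) where
    open StableDomain K
    open Algebra.Properties.Ring ring
    open Domain K
    open Relation.Binary.Reasoning.Setoid setoid

    prodN : (ℕ → Carrier) → ℕ → Carrier
    prodN w zero    = 1#
    prodN w (suc k) = w 0 * prodN (w ∘ suc) k

    prodN-snoc : ∀ w k → prodN w (suc k) ≈ prodN w k * w k
    prodN-snoc w zero    = *-comm (w 0) 1#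
    prodN-snoc w (suc k) = trans (*-congˡ (prodN-snoc (w ∘ suc) k)) (sym (*-assoc (w 0) (prodN (w ∘ suc) k) (w (suc k))))

    prodN-shift : ∀ w k → w k ≈ w 0 → prodN (w ∘ suc) k ≈ prodN w k
    prodN-shift w zero    _ = refl
    prodN-shift w (suc k) wk≈w0 = begin
      prodN (w ∘ suc) (suc k)           ≈⟨ prodN-snoc (w ∘ suc) k ⟩
      prodN (w ∘ suc) k * w (suc k)     ≈⟨ *-comm _ _ ⟩
      w (suc k) * prodN (w ∘ suc) k     ≈⟨ *-congʳ wk≈w0 ⟩
      prodN w (suc k)                   ∎

    prodN-1 : ∀ w k → (∀ m → w m ≈ 1#) → prodN w k ≈ 1#
    prodN-1 w zero    p = refl
    prodN-1 w (suc k) p = trans (*-cong (p 0) (prodN-1 (w ∘ suc) k (p ∘ suc))) (*-identityˡ 1#)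

    -*-≈ : ∀ x y → x * (- y) ≈ - (x * y)
    -*-≈ x y = sym (-‿distribʳ-* x y)

    -- Each use of the recurrence advances two positions and contributes one sign; over four
    -- positions the signs cancel.
    transport₄ : ∀ q (w ζ : ℕ → Carrier) → (∀ m → ζ m ≈ - (w m * (w (suc m) * ζ (2 ℕ.+ m)))) →
      ζ 0 ≈ prodN w (q ℕ.* 4) * ζ (q ℕ.* 4)
    transport₄ zero    w ζ rec = sym (*-identityˡ (ζ 0))
    transport₄ (suc q) w ζ rec = begin
      ζ 0                                                         ≈⟨ rec 0 ⟩
      - (w 0 * (w 1 * ζ 2))                                       ≈⟨ -‿cong (*-congˡ (*-congˡ (rec 2))) ⟩
      - (w 0 * (w 1 * (- (w 2 * (w 3 * ζ 4)))))                   ≈⟨ -‿cong (*-congˡ (-*-≈ _ _)) ⟩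
      - (w 0 * (- (w 1 * (w 2 * (w 3 * ζ 4)))))                   ≈⟨ -‿cong (-*-≈ _ _) ⟩
      - (- (w 0 * (w 1 * (w 2 * (w 3 * ζ 4)))))                   ≈⟨ -‿involutive _ ⟩
      w 0 * (w 1 * (w 2 * (w 3 * ζ 4)))                           ≈⟨ *-congˡ (*-congˡ (*-congˡ (*-congˡ (transport₄ q (w ∘ (4 ℕ.+_)) (ζ ∘ (4 ℕ.+_)) (rec ∘ (4 ℕ.+_)))))) ⟩
      w 0 * (w 1 * (w 2 * (w 3 * (P * Z))))                       ≈⟨ *-congˡ (*-congˡ (*-congˡ (*-assoc (w 3) P Z))) ⟨
      w 0 * (w 1 * (w 2 * (w 3 * P * Z)))                         ≈⟨ *-congˡ (*-congˡ (*-assoc (w 2) (w 3 * P) Z)) ⟨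
      w 0 * (w 1 * (w 2 * (w 3 * P) * Z))                         ≈⟨ *-congˡ (*-assoc (w 1) (w 2 * (w 3 * P)) Z) ⟨
      w 0 * (w 1 * (w 2 * (w 3 * P)) * Z)                         ≈⟨ *-assoc (w 0) (w 1 * (w 2 * (w 3 * P))) Z ⟨
      w 0 * (w 1 * (w 2 * (w 3 * P))) * Z                         ∎
      where
      P = prodN (w ∘ (4 ℕ.+_)) (q ℕ.* 4)
      Z = ζ (suc q ℕ.* 4)

    -- The two positions beyond a multiple of four leave a single sign. This is where order 2 modulo
    -- 4 is tied to a cycle gain of -1.
    transport : ∀ q (w ζ : ℕ → Carrier) → (∀ m → ζ m ≈ - (w m * (w (suc m) * ζ (2 ℕ.+ m)))) →
      ζ 0 ≈ - (prodN w (2 ℕ.+ q ℕ.* 4) * ζ (2 ℕ.+ q ℕ.* 4))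
    transport q w ζ rec = trans (rec 0) (-‿cong (begin
      w 0 * (w 1 * ζ 2)        ≈⟨ *-congˡ (*-congˡ (transport₄ q (w ∘ (2 ℕ.+_)) (ζ ∘ (2 ℕ.+_)) (rec ∘ (2 ℕ.+_)))) ⟩
      w 0 * (w 1 * (P * Z))    ≈⟨ *-congˡ (*-assoc (w 1) P Z) ⟨
      w 0 * (w 1 * P * Z)      ≈⟨ *-assoc (w 0) (w 1 * P) Z ⟨
      w 0 * (w 1 * P) * Z      ∎))
      where
      P = prodN (w ∘ (2 ℕ.+_)) (q ℕ.* 4)
      Z = ζ (2 ℕ.+ q ℕ.* 4)

    mask : ∀ {A : Set} → Dec A → Carrier → Carrier
    mask (yes _) x = 0#
    mask (no  _) x = x

    mask-no : ∀ {A : Set} (d : Dec A) {x} → ¬ A → mask d x ≈ x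
    mask-no (yes a) ¬a = contradiction a ¬a
    mask-no (no  _) _  = refl

    mask-0 : ∀ {A : Set} (d : Dec A) {x} → (¬ A → x ≈ 0#) → mask d x ≈ 0#
    mask-0 (yes _)  _ = refl
    mask-0 (no  ¬a) h = h ¬a

    mask-* : ∀ {A : Set} (d : Dec A) {x y} → (A → y ≈ 0#) → mask d x * y ≈ x * y
    mask-* (yes a) h = trans (zeroˡ _) (sym (*0≈0 (h a)))
    mask-* (no  _) _ = refl

    x≈-y : ∀ {x y} → x + y ≈ 0# → x ≈ - y
    x≈-y {x} {y} p = begin
      x               ≈⟨ +-identityʳ x ⟨
      x + 0#          ≈⟨ +-congˡ (-‿inverseʳ y) ⟨
      x + (y + - y)   ≈⟨ +-assoc x y (- y) ⟨
      x + y + - y     ≈⟨ +-congʳ p ⟩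
      0# + - y        ≈⟨ +-identityˡ (- y) ⟩
      - y             ∎

    two-term : ∀ {x x₂ y ȳ y₁} → y * ȳ ≈ 1# → x * ȳ + x₂ * y₁ ≈ 0# → x ≈ - (y * (y₁ * x₂))
    two-term {x} {x₂} {y} {ȳ} {y₁} yȳ≈1 p = begin
      x                      ≈⟨ *-identityˡ _ ⟨
      1# * x                 ≈⟨ *-congʳ yȳ≈1 ⟨
      y * ȳ * x              ≈⟨ *-assoc _ _ _ ⟩
      y * (ȳ * x)            ≈⟨ *-congˡ (*-comm _ _) ⟩
      y * (x * ȳ)            ≈⟨ *-congˡ (x≈-y p) ⟩
      y * (- (x₂ * y₁))      ≈⟨ -*-≈ _ _ ⟩
      - (y * (x₂ * y₁))      ≈⟨ -‿cong (*-congˡ (*-comm _ _)) ⟩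
      - (y * (y₁ * x₂))      ∎

    -- The solution with Z 0 = 1, Z 1 = 0 of the kernel equations along a cycle
    -- with weights w and inverse weights w̄; it vanishes at odd positions.
    Z : (ℕ → Carrier) → ℕ → Carrier
    Z w̄ 0 = 1#
    Z w̄ 1 = 0#
    Z w̄ (suc (suc m)) = - (Z w̄ m * (w̄ m * w̄ (suc m)))

    Z-odd : ∀ w̄ m → even m ≡ false → Z w̄ m ≈ 0#
    Z-odd w̄ 1 _ = refl
    Z-odd w̄ (suc (suc m)) odd = trans (-‿cong (0*≈0 (Z-odd w̄ m (≡.trans (≡.sym (not-involutive (even m))) odd)))) -0#≈0#

    Z-kernel : ∀ (w w̄ : ℕ → Carrier) → (∀ m → w m * w̄ m ≈ 1#) → ∀ m →
      Z w̄ m * w̄ m + Z w̄ (2 ℕ.+ m) * w (suc m) ≈ 0#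
    Z-kernel w w̄ ww̄ m = begin
      x * u + (- (x * (u * u′))) * y′      ≈⟨ +-congˡ (sym (-‿distribˡ-* _ _)) ⟩
      x * u + - (x * (u * u′) * y′)        ≈⟨ +-congˡ (-‿cong (*-congʳ (*-assoc x u u′))) ⟨
      x * u + - (x * u * u′ * y′)          ≈⟨ +-congˡ (-‿cong (*-assoc (x * u) u′ y′)) ⟩
      x * u + - (x * u * (u′ * y′))        ≈⟨ +-congˡ (-‿cong (*-congˡ (trans (*-comm u′ y′) (ww̄ (suc m))))) ⟩
      x * u + - (x * u * 1#)               ≈⟨ +-congˡ (-‿cong (*-identityʳ _)) ⟩
      x * u + - (x * u)                    ≈⟨ -‿inverseʳ _ ⟩
      0#                                   ∎
      where
      x = Z w̄ m
      u = w̄ m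
      u′ = w̄ (suc m)
      y′ = w (suc m)

    module _ {n : ℕ} (G : Graph n) where
      open Graph G
      open Induced G
      open Cycles G
      open PCycle

      -- A common frame for both matrices: for the gain matrix `unit` expresses Hermitian symmetry
      -- together with modulus 1, and for the adjacency matrix it reads `1 * 1 ≈ 1`.
      record Weighted (M : Mat n n) : Set where
        field
          off  : ∀ {u v} → ¬ Adj u v → M u v ≈ 0#
          unit : ∀ {u v} → Adj u v → M u v * M v u ≈ 1#

        nonzero : ∀ {u v} → Adj u v → ¬ M u v ≈ 0#
        nonzero e p = 1≉0 (trans (sym (unit e)) (0*≈0 p))

      module OnGraph {M : Mat n n} (W : Weighted M) where
        open Weighted W
        open Rank M

        isPendant : ∀ {S u v} → Pend S u v → IsPendant S u v
        isPendant ((u∈ , v∈ , e) , only) = record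
          { u∈S = u∈ ; v∈S = v∈ ; u≢v = Adj-≢ e ; uv = nonzero e ; vu = nonzero (Adj-sym e)
          ; row = λ j j∈ j≢v → off λ e′ → j≢v (only j (u∈ , j∈ , e′))
          ; col = λ j j∈ j≢v → off λ e′ → j≢v (only j (u∈ , j∈ , Adj-sym e′)) }

        isIsolated : ∀ {S u} → u ∈ S → (∀ {w} → ¬ E S u w) → Isolated S u
        isIsolated u∈ ¬e = record
          { row = λ j j∈ → off λ e → ¬e (u∈ , j∈ , e)
          ; col = λ j j∈ → off λ e → ¬e (u∈ , j∈ , Adj-sym e) }

        rank-edgeless : ∀ {S} → (∀ {u v} → ¬ E S u v) → HasRankOn S 0
        rank-edgeless {S} ¬e = mkRank (empty , indep-empty S , ∣⊥∣≡0 n) λ T ind → ≤-reflexive (≡.trans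
          (≡.cong ∣_∣ (Empty-unique {p = T} λ (u , u∈) → unit-ker ind u∈ λ i i∈ → off λ e → ¬e (i∈ , proj₁ ind u∈ , e)))
          (∣⊥∣≡0 n))

        -- The cycle is chordless and forms a whole component of the subgraph on `S`.
        Closed : ∀ {S} → PCycle S → Set
        Closed {S} P = ∀ m d → E S (f P m) d → d ≡ f P (suc m) ⊎ d ≡ prev P m

        module Component {S} (P : PCycle S) (closed : Closed P) where

          w w̄ : ℕ → Carrier
          w m = M (f P m) (f P (suc m))
          w̄ m = M (f P (suc m)) (f P m)

          ww̄ : ∀ m → w m * w̄ m ≈ 1#
          ww̄ m = unit (proj₂ (proj₂ (edge P m)))

          f2≢f0 : ∀ m → f P m ≢ f P (2 ℕ.+ m)
          f2≢f0 m = distinct P 2 m (s≤s z≤n) (s≤s (s≤s (s≤s z≤n))) ∘ ≡.sym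

          row-sum : ∀ {k} → Supp k S → ∀ m → mv k (f P (suc m)) ≈ k (f P m) * w̄ m + k (f P (2 ℕ.+ m)) * w (suc m)
          row-sum {k} supp m = sum-two (λ j → k j * M (f P (suc m)) j) (f2≢f0 m) λ j j≢ j≢′ → case j ∈? S of λ where
            (no j∉S) → 0*≈0 (supp j j∉S)
            (yes j∈S) → *0≈0 (off λ e → [ j≢′ , (λ eq → j≢ (≡.trans eq (prev-suc P m))) ]′ (closed (suc m) j (f∈S P (suc m) , j∈S , e)))

          recurrence : ∀ {k} → Supp k S → ∀ m → mv k (f P (suc m)) ≈ 0# →
            k (f P m) ≈ - (w m * (w (suc m) * k (f P (2 ℕ.+ m))))
          recurrence {k} supp m row≈0 = two-term (ww̄ m) (trans (sym (row-sum supp m)) row≈0)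

          without : Subset n → Subset n
          without T = ⟦ (λ v → (v ∈? T) ×-dec ¬? (OnP? P v)) ⟧

          without⁻ : ∀ T {v} → v ∈ without T → v ∈ T × ¬ OnP P v
          without⁻ T = ∈-⟦⟧⁻ (λ v → (v ∈? T) ×-dec ¬? (OnP? P v))

          without⁺ : ∀ T {v} → v ∈ T → ¬ OnP P v → v ∈ without T
          without⁺ T v∈ v∉ = ∈-⟦⟧⁺ (λ v → (v ∈? T) ×-dec ¬? (OnP? P v)) (v∈ , v∉)

          block : ∀ {i j} → OnP P i → j ∈ S → ¬ OnP P j → ¬ Adj i j
          block (m , ≡.refl) j∈S j∉ e = j∉ ([ (λ eq → _ , ≡.sym eq) , (λ eq → _ , ≡.sym eq) ]′ (closed m _ (f∈S P m , j∈S , e)))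

          indep-without : ∀ {T} → Indep S T → Indep (without S) (without T)
          indep-without {T} (T⊆S , ind) =
            (λ v∈ → let v∈T , v∉ = without⁻ T v∈ in without⁺ S (T⊆S v∈T) v∉) ,
            λ k supp ker → ind k (λ j j∉T → supp j (j∉T ∘ proj₁ ∘ without⁻ T)) λ i i∈S → case OnP? P i of λ where
              (no i∉) → ker i (without⁺ S i∈S i∉)
              (yes i∈) → sum-zero λ j → case j ∈? without T of λ where
                (no j∉) → 0*≈0 (supp j j∉)
                (yes j∈) → let j∈T , j∉ = without⁻ T j∈ in *0≈0 (off (block i∈ (T⊆S j∈T) j∉))

          size-bound : ∀ T → T ⊆ addAll (without T) (f P) (p P)
          size-bound T {v} v∈ with OnP? P v
          ... | no v∉ = ∈-addAll⁺ˡ (f P) (p P) (without⁺ T v∈ v∉)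
          ... | yes (m , ≡.refl) = ≡.subst (_∈ addAll (without T) (f P) (p P)) (f-% P m)
                  (∈-addAll⁺ʳ {T = without T} (f P) (m%n<n m (p P)))

          size-all : ∀ T → ∣ addAll (without T) (f P) (p P) ∣ ≡ p P ℕ.+ ∣ without T ∣
          size-all T = ∣addAll∣ (without T) (f P) (p P) (λ i _ fi∈ → proj₂ (without⁻ T fi∈) (i , ≡.refl)) (f-inj P)

          on-all : ∀ T {i} → i < p P → f P i ∈ addAll (without T) (f P) (p P)
          on-all T i<p = ∈-addAll⁺ʳ {T = without T} (f P) i<p

          -- No edge joins the cycle to the rest of `S`, so the matrix is block diagonal. A kernel
          -- vector set to zero on the cycle stays in the kernel of the other block and vanishes
          -- there by the independence of `T`; only the cycle block remains, which is the
          -- hypothesis.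
          indep-extend : ∀ {T} c k → Indep (without S) T →
            (∀ κ → Supp κ S → Supp κ (addAll T (f P ∘ (c ℕ.+_)) k) → (∀ j → ¬ OnP P j → κ j ≈ 0#) →
               (∀ m → mv κ (f P m) ≈ 0#) → ∀ m → κ (f P m) ≈ 0#) →
            Indep S (addAll T (f P ∘ (c ℕ.+_)) k)
          indep-extend {T} c k (T⊆ , ind) cycle = ⊆S , λ κ supp ker → vanish κ supp ker
            where
            A = addAll T (f P ∘ (c ℕ.+_)) k
            ⊆S : A ⊆ S
            ⊆S v∈ with ∈-addAll⁻ T (f P ∘ (c ℕ.+_)) k v∈
            ... | inj₁ v∈T = proj₁ (without⁻ S (T⊆ v∈T))
            ... | inj₂ (i , _ , ≡.refl) = f∈S P (c ℕ.+ i)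
            off-cycle : ∀ κ → Supp κ A → Ker S κ → ∀ v → ¬ OnP P v → κ v ≈ 0#
            off-cycle κ supp ker v v∉ = trans (sym (mask-no (OnP? P v) v∉)) (ind κ′ κ′supp κ′ker v)
              where
              κ′ : Fin n → Carrier
              κ′ v = mask (OnP? P v) (κ v)
              κ′supp : Supp κ′ T
              κ′supp v v∉T = mask-0 (OnP? P v) λ v∉ → supp v λ v∈ → case ∈-addAll⁻ T (f P ∘ (c ℕ.+_)) k v∈ of λ where
                (inj₁ v∈T) → v∉T v∈T
                (inj₂ (i , _ , eq)) → v∉ (c ℕ.+ i , ≡.sym eq)
              κ′ker : Ker (without S) κ′
              κ′ker i i∈ = let i∈S , i∉ = without⁻ S i∈ in
                trans (sum-cong-≋ λ v → mask-* (OnP? P v) λ v∈ → off (block v∈ i∈S i∉ ∘ Adj-sym)) (ker i i∈S)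
            vanish : ∀ κ → Supp κ A → Ker S κ → ∀ j → κ j ≈ 0#
            vanish κ supp ker j with OnP? P j
            ... | no j∉ = off-cycle κ supp ker j j∉
            ... | yes (m , ≡.refl) = cycle κ (λ j j∉S → supp j (j∉S ∘ ⊆S)) supp (off-cycle κ supp ker) (λ m → ker (f P m) (f∈S P m)) m

          monodromy : ∀ {k} q → p P ≡ 2 ℕ.+ q ℕ.* 4 → Supp k S → (∀ m → mv k (f P m) ≈ 0#) →
            k (f P 0) ≈ - (prodN w (p P) * k (f P 0))
          monodromy {k} q p≡ supp ker = trans (transport q w (k ∘ f P) (λ m → recurrence supp m (ker (suc m))))
            (-‿cong (*-cong (reflexive (≡.cong (prodN w) (≡.sym p≡)))
              (reflexive (≡.cong k (≡.trans (≡.cong (f P) (≡.trans (≡.sym p≡) (≡.sym (ℕ.+-identityʳ (p P))))) (periodic P 0))))))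

          rank-without-≤ : ∀ {T r} → HasRankOn (without S) r → Indep S T → ∣ T ∣ ≤ p P ℕ.+ r
          rank-without-≤ {T} rk ind = ≤-trans (p⊆q⇒∣p∣≤∣q∣ (size-bound T))
            (≤-trans (≤-reflexive (size-all T)) (ℕ.+-monoʳ-≤ (p P) (HasRankOn.maximal rk (without T) (indep-without ind))))

          fi∉ : ∀ {T} → T ⊆ without S → ∀ i → f P i ∉ T
          fi∉ T⊆ i fi∈ = proj₂ (without⁻ S (T⊆ fi∈)) (i , ≡.refl)

          -- With positions 0 and 1 left out, the row at `m + 1` determines the value at `m + 2`
          -- from the value at `m`, so zero propagates round the whole cycle.
          rank-typeA-lower : ∀ {T} q → p P ≡ 2 ℕ.+ q ℕ.* 4 → Indep (without S) T →
            Indep S (addAll T (f P ∘ (2 ℕ.+_)) (q ℕ.* 4))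
          rank-typeA-lower {T} q p≡ ind = indep-extend 2 (q ℕ.* 4) ind vanish
            where
            vanish : ∀ κ → Supp κ S → Supp κ (addAll T (f P ∘ (2 ℕ.+_)) (q ℕ.* 4)) → (∀ j → ¬ OnP P j → κ j ≈ 0#) →
               (∀ m → mv κ (f P m) ≈ 0#) → ∀ m → κ (f P m) ≈ 0#
            vanish κ suppS supp _ ker = go
              where
              initial : ∀ i → i < 2 → κ (f P i) ≈ 0#
              initial i i<2 = supp (f P i) λ fi∈ → case ∈-addAll⁻ T (f P ∘ (2 ℕ.+_)) (q ℕ.* 4) fi∈ of λ where
                (inj₁ fi∈T) → fi∉ (proj₁ ind) i fi∈T
                (inj₂ (j , j< , eq)) → f-inj P i (2 ℕ.+ j) (≤-trans i<2 (ℕ.m≤m+n 2 j))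
                  (≡.subst (2 ℕ.+ j <_) (≡.sym p≡) (s≤s (s≤s j<))) eq
              go : ∀ m → κ (f P m) ≈ 0#
              go 0 = initial 0 (s≤s z≤n)
              go 1 = initial 1 (s≤s (s≤s z≤n))
              go (suc (suc m)) = cancelʳ _ (w (suc m))
                (trans (sym (trans (+-congʳ (0*≈0 (go m))) (+-identityˡ _))) (trans (sym (row-sum suppS m)) (ker (suc m))))
                (nonzero (proj₂ (proj₂ (edge P (suc m)))))

          -- The sequence `Z` lives on the even positions and closes up to a nonzero kernel vector
          -- when the product of the weights is -1. A set `T` containing all even positions would
          -- carry it.
          missing-even : ∀ {T} q → p P ≡ 2 ℕ.+ q ℕ.* 4 → prodN w (p P) ≈ - 1# → Indep S T →
            ∃[ i ] i < p P × even i ≡ true × f P i ∉ T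
          missing-even {T} q p≡ prod≈-1 (T⊆S , ind)
            with Fin.all? (λ (i : Fin (p P)) → (even (toℕ i) ≟ᵇ true) →-dec (f P (toℕ i) ∈? T))
          ... | no ¬all with Fin.¬∀⟶∃¬ (p P) _ (λ i → (even (toℕ i) ≟ᵇ true) →-dec (f P (toℕ i) ∈? T)) ¬all
          ...   | i , ¬h = toℕ i , Fin.toℕ<n i
                         , decidable-stable (even (toℕ i) ≟ᵇ true) (λ ¬e → ¬h λ e → contradiction e ¬e)
                         , λ fi∈ → ¬h λ _ → fi∈
          missing-even {T} q p≡ prod≈-1 (T⊆S , ind) | yes all = contradiction (trans (sym (zf 0 (s≤s z≤n))) (ind z supp ker (f P 0))) 1≉0
            where
            Zp : Fin (p P) → Carrier
            Zp i = Z w̄ (toℕ i)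
            z : Fin n → Carrier
            z = push (f P ∘ toℕ) Zp
            zf : ∀ m → m < p P → z (f P m) ≈ Z w̄ m
            zf m m<p = ≡.subst (λ i → z (f P i) ≈ Z w̄ i) (Fin.toℕ-fromℕ< m<p)
              (push-∈ (f P ∘ toℕ) (Cycle.vertex-inj (roll P)) Zp (Fin.fromℕ< m<p))
            z-off : ∀ v → ¬ OnP P v → z v ≈ 0#
            z-off v v∉ = push-∉ (f P ∘ toℕ) Zp v λ j eq → v∉ (toℕ j , eq)
            supp : Supp z T
            supp v v∉T with OnP? P v
            ... | no v∉ = z-off v v∉
            ... | yes (m , ≡.refl) = trans (reflexive (≡.cong z (≡.sym (f-% P m)))) (trans (zf (m % p P) (m%n<n m (p P)))
                    (Z-odd w̄ (m % p P) (¬-not λ ev → v∉T (≡.subst (_∈ T) fi≡ (all i (≡.trans (≡.cong even i≡) ev))))))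
              where
              i = Fin.fromℕ< (m%n<n m (p P))
              i≡ : toℕ i ≡ m % p P
              i≡ = Fin.toℕ-fromℕ< (m%n<n m (p P))
              fi≡ : f P (toℕ i) ≡ f P m
              fi≡ = ≡.trans (≡.cong (f P) i≡) (f-% P m)
            suppS : Supp z S
            suppS v v∉S = supp v (v∉S ∘ T⊆S)
            -- `Z` solves the recurrence on the unrolled cycle in any case; it descends to the cycle
            -- because the sign of `transport` cancels against the product -1.
            Z0≈Zp : 1# ≈ Z w̄ (2 ℕ.+ q ℕ.* 4)
            Z0≈Zp = begin
              1#                                                              ≈⟨ transport q w (Z w̄) (λ m → two-term (ww̄ m) (Z-kernel w w̄ ww̄ m)) ⟩
              - (prodN w (2 ℕ.+ q ℕ.* 4) * Z w̄ (2 ℕ.+ q ℕ.* 4))               ≈⟨ -‿cong (*-congʳ (trans (reflexive (≡.cong (prodN w) (≡.sym p≡))) prod≈-1)) ⟩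
              - ((- 1#) * Z w̄ (2 ℕ.+ q ℕ.* 4))                                ≈⟨ -‿cong (-1*x≈-x _) ⟩
              - (- Z w̄ (2 ℕ.+ q ℕ.* 4))                                       ≈⟨ -‿involutive _ ⟩
              Z w̄ (2 ℕ.+ q ℕ.* 4)                                             ∎
            z-next : ∀ m → m < p P → z (f P (2 ℕ.+ m)) ≈ Z w̄ (2 ℕ.+ m)
            -- For `m < p` the index `2 + m` exceeds `p` by at most one. At `p` the value returns to
            -- that at 0; the index `p + 1` is odd, so `Z` vanishes there as it does at 1.
            z-next m m<p with ℕ.<-cmp (2 ℕ.+ m) (p P)
            ... | B.tri< 2+m<p _ _ = zf (2 ℕ.+ m) 2+m<p
            ... | B.tri≈ _ 2+m≡p _ = begin
                    z (f P (2 ℕ.+ m))        ≈⟨ reflexive (≡.cong z (≡.trans (≡.cong (f P) (≡.trans 2+m≡p (≡.sym (ℕ.+-identityʳ (p P))))) (periodic P 0))) ⟩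
                    z (f P 0)                ≈⟨ zf 0 (s≤s z≤n) ⟩
                    1#                       ≈⟨ Z0≈Zp ⟩
                    Z w̄ (2 ℕ.+ q ℕ.* 4)      ≈⟨ reflexive (≡.cong (Z w̄) (≡.trans (≡.sym p≡) (≡.sym 2+m≡p))) ⟩
                    Z w̄ (2 ℕ.+ m)            ∎
            ... | B.tri> _ _ p<2+m = begin
                    z (f P (2 ℕ.+ m))        ≈⟨ reflexive (≡.cong z (≡.trans (≡.cong (f P) 2+m≡p+1) (periodic P 1))) ⟩
                    z (f P 1)                ≈⟨ zf 1 (s≤s (s≤s z≤n)) ⟩
                    0#                       ≈⟨ Z-odd w̄ (2 ℕ.+ m) (≡.trans (≡.cong even (≡.trans 2+m≡p+1 (ℕ.+-comm (p P) 1)))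
                                                  (≡.cong not (≡.trans (≡.cong even p≡) (≡.trans (not-involutive _) (even-4* q))))) ⟨
                    Z w̄ (2 ℕ.+ m)            ∎
              where
              2+m≡p+1 : 2 ℕ.+ m ≡ p P ℕ.+ 1
              2+m≡p+1 = ≡.trans (≡.cong suc (≤-antisym m<p (≤-pred p<2+m))) (ℕ.+-comm 1 (p P))
            row : ∀ m → m < p P → mv z (f P (suc m)) ≈ 0#
            row m m<p = trans (row-sum suppS m) (trans (+-cong (*-congʳ (zf m m<p)) (*-congʳ (z-next m m<p))) (Z-kernel w w̄ ww̄ m))
            ker : Ker S z
            ker i i∈S with OnP? P i
            ... | no i∉ = sum-zero λ j → case OnP? P j of λ where
                    (no j∉) → 0*≈0 (z-off j j∉)
                    (yes j∈) → *0≈0 (off (block j∈ i∈S i∉ ∘ Adj-sym))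
            ... | yes (m , ≡.refl) with reach P 1 m
            ...   | j , j<p , eq = trans (reflexive (≡.cong (mv z) (≡.trans (≡.sym eq) (≡.cong (f P) (ℕ.+-comm j 1))))) (row j j<p)

        module _ {S} (P : PCycle S) (closed : Closed P) where
          open Component P closed

          shift-closed : Closed (shift P)
          shift-closed m d e = [ inj₁ , (λ eq → inj₂ (≡.trans eq (≡.cong (f P) (ℕ.+-suc (2 ℕ.+ p-3 P) m)))) ]′ (closed (suc m) d e)

          w-periodic : w (p P) ≈ w 0
          w-periodic = reflexive (≡.cong₂ M
            (≡.trans (≡.cong (f P) (≡.sym (ℕ.+-identityʳ (p P)))) (periodic P 0))
            (≡.trans (≡.cong (f P) (ℕ.+-comm 1 (p P))) (periodic P 1)))

          -- Even and odd positions decouple and each class carries a kernel vector. An independent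
          -- set thus misses one position of each parity, the odd one being found by applying
          -- `missing-even` to the cycle shifted by one, so it meets the cycle in at most `p - 2`
          -- positions.
          rank-typeA : ∀ {r} q → p P ≡ 2 ℕ.+ q ℕ.* 4 → prodN w (p P) ≈ - 1# →
            HasRankOn (without S) r → HasRankOn S (q ℕ.* 4 ℕ.+ r)
          rank-typeA {r} q p≡ prod≈-1 rk@(mkRank (T , ind , ≡.refl) _) = mkRank
            ( addAll T (f P ∘ (2 ℕ.+_)) (q ℕ.* 4) , rank-typeA-lower q p≡ ind
            , ∣addAll∣ T (f P ∘ (2 ℕ.+_)) (q ℕ.* 4) (λ i _ → fi∉ (proj₁ ind) (2 ℕ.+ i))
                (λ i j i<j j< → f-inj P (2 ℕ.+ i) (2 ℕ.+ j) (s≤s (s≤s i<j)) (≡.subst (2 ℕ.+ j <_) (≡.sym p≡) (s≤s (s≤s j<)))) )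
            upper
            where
            even-p : even (p P) ≡ true
            even-p = ≡.trans (≡.cong even p≡) (≡.trans (not-involutive _) (even-4* q))
            upper : ∀ T′ → Indep S T′ → ∣ T′ ∣ ≤ q ℕ.* 4 ℕ.+ ∣ T ∣
            upper T′ ind′
              with i , i<p , even-i , fi∉T ← missing-even q p≡ prod≈-1 ind′
                 | j , j<p , even-j , fj∉T ← Component.missing-even (shift P) shift-closed q p≡ (trans (prodN-shift w (p P) w-periodic) prod≈-1) ind′ =
              ℕ.+-cancelˡ-≤ 2 _ _ (≤-trans (≤-reflexive (≡.sym size))
                (≤-trans (p⊆q⇒∣p∣≤∣q∣ ⊆all) (≤-trans (≤-reflexive (size-all T′))
                  (≤-trans (ℕ.+-monoʳ-≤ (p P) (HasRankOn.maximal rk (without T′) (indep-without ind′)))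
                    (≤-reflexive (≡.cong (ℕ._+ ∣ T ∣) p≡))))))
              where
              odd-sj : even (suc j) ≡ false
              odd-sj = ≡.cong not even-j
              -- `j` is counted from position 1, so `suc j` could equal `p`; parity excludes this.
              sj<p : suc j < p P
              sj<p = ℕ.≤∧≢⇒< j<p λ sj≡p → case ≡.trans (≡.sym odd-sj) (≡.trans (≡.cong even sj≡p) even-p) of λ ()
              i≢sj : i ≢ suc j
              i≢sj eq = case ≡.trans (≡.sym odd-sj) (≡.trans (≡.cong even (≡.sym eq)) even-i) of λ ()
              e≢o : f P (suc j) ≢ f P i
              e≢o eq with ℕ.<-cmp i (suc j)
              ... | B.tri< i< _ _ = f-inj P i (suc j) i< sj<p (≡.sym eq)
              ... | B.tri≈ _ i≡ _ = i≢sj i≡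
              ... | B.tri> _ _ i> = f-inj P (suc j) i i> i<p eq
              size : ∣ T′ ▻ f P i ▻ f P (suc j) ∣ ≡ 2 ℕ.+ ∣ T′ ∣
              size = ≡.trans (∣∣-add (T′ ▻ f P i) (λ fj∈ → [ fj∉T , e≢o ]′ (∈-add⁻ T′ fj∈))) (≡.cong suc (∣∣-add T′ fi∉T))
              ⊆all : T′ ▻ f P i ▻ f P (suc j) ⊆ addAll (without T′) (f P) (p P)
              ⊆all v∈ with ∈-add⁻ (T′ ▻ f P i) v∈
              ... | inj₂ ≡.refl = on-all T′ sj<p
              ... | inj₁ v∈′ with ∈-add⁻ T′ v∈′
              ...   | inj₂ ≡.refl = on-all T′ i<p
              ...   | inj₁ v∈T = size-bound T′ v∈T

        -- With all weights 1, one turn round the cycle sends a kernel value `x` to `- x`, so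
        -- `2 x = 0`. Starting the turn at a shifted position treats the other vertices.
        monodromy-1 : ∀ {S k} (P : PCycle S) → Closed P → ∀ q → p P ≡ 2 ℕ.+ q ℕ.* 4 →
          (∀ m → M (f P m) (f P (suc m)) ≈ 1#) → ¬ 1# + 1# ≈ 0# → Supp k S → (∀ m → mv k (f P m) ≈ 0#) →
          ∀ m → k (f P m) ≈ 0#
        monodromy-1 {k = k} P closed q p≡ w≈1 2≉0 supp ker zero = cancel (1# + 1#) x (begin
            (1# + 1#) * x             ≈⟨ distribʳ x 1# 1# ⟩
            1# * x + 1# * x           ≈⟨ +-cong (*-identityˡ x) (*-congʳ (sym (prodN-1 (Component.w P closed) (p P) w≈1))) ⟩
            x + prodN w (p P) * x     ≈⟨ +-congʳ (monodromy q p≡ supp ker) ⟩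
            - (prodN w (p P) * x) + prodN w (p P) * x ≈⟨ -‿inverseˡ _ ⟩
            0#                        ∎) 2≉0
          where
          open Component P closed
          x = k (f P 0)
        monodromy-1 P closed q p≡ w≈1 2≉0 supp ker (suc m) =
          monodromy-1 (shift P) (shift-closed P closed) q p≡ (w≈1 ∘ suc) 2≉0 supp (ker ∘ suc) m

        rank-nonsingular : ∀ {S r} (P : PCycle S) (closed : Closed P) → ∀ q → p P ≡ 2 ℕ.+ q ℕ.* 4 →
          (∀ m → M (f P m) (f P (suc m)) ≈ 1#) → ¬ 1# + 1# ≈ 0# →
          HasRankOn (Component.without P closed S) r → HasRankOn S (p P ℕ.+ r)
        rank-nonsingular P closed q p≡ w≈1 2≉0 rk@(mkRank (T , ind , ≡.refl) _) = mkRank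
          ( addAll T (f P) (p P)
          , indep-extend 0 (p P) ind (λ κ supp _ _ ker → monodromy-1 P closed q p≡ w≈1 2≉0 supp ker)
          , ∣addAll∣ T (f P) (p P) (λ i _ → fi∉ (proj₁ ind) i) (f-inj P) )
          λ T′ → rank-without-≤ rk
          where open Component P closed

-- The inequality between the two ranks and its equality case

module RankComparison where

  import Algebra.Properties.Ring
  import Relation.Binary.Reasoning.Setoid
  open import Data.Fin.Subset using (_-_) renaming (⊤ to full)
  open import Data.Integer.Base using (+_)
  open import Data.Nat.DivMod
  open import Data.Nat.Induction using (<-wellFounded)
  open import Data.Nat.Tactic.RingSolver using () renaming (solve-∀ to ℕ-solve-∀)
  open import Induction.WellFounded using (Acc; acc)
  open Subsets
  open LinearAlgebra
  open InducedSubgraphs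
  open CyclesAndBridges
  open WeightedGraphs

  2+2* : ∀ x e → x ℕ.+ 2 ℕ.* suc e ≡ 2 ℕ.+ (x ℕ.+ 2 ℕ.* e)
  2+2* x e = ≡.trans (≡.cong (x ℕ.+_) (ℕ.*-suc 2 e)) (≡.trans (ℕ.+-suc x _) (≡.cong suc (ℕ.+-suc x _)))

  relax : ∀ {a b a′ b′ e e′ N} → b′ ℕ.+ N ≤ a′ ℕ.+ 2 ℕ.* e′ →
    suc e′ ≤ e → a′ ≤ a → b ≤ 2 ℕ.+ b′ → b ℕ.+ N ≤ a ℕ.+ 2 ℕ.* e
  relax {a} {b} {a′} {b′} {e} {e′} {N} lb e′<e a′≤a b≤ = begin
    b ℕ.+ N                  ≤⟨ ℕ.+-monoˡ-≤ N b≤ ⟩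
    2 ℕ.+ (b′ ℕ.+ N)         ≤⟨ ℕ.+-monoʳ-≤ 2 lb ⟩
    2 ℕ.+ (a′ ℕ.+ 2 ℕ.* e′)  ≡⟨ 2+2* a′ e′ ⟨
    a′ ℕ.+ 2 ℕ.* suc e′      ≤⟨ ℕ.+-mono-≤ a′≤a (ℕ.*-monoʳ-≤ 2 e′<e) ⟩
    a ℕ.+ 2 ℕ.* e            ∎
    where open ℕ.≤-Reasoning

  -- Here `a`, `b` and `e` are the rank of Φ, the rank of G and `ec`, with primes after deletion of
  -- a cycle vertex, and `N` is `2 * n`. The bound for `b + N` is a chain of four estimates;
  -- equality of its ends makes each of them sharp.
  squeeze : ∀ {a b a′ b′ e e′ N} → a ℕ.+ 2 ℕ.* e ≡ b ℕ.+ N → b′ ℕ.+ N ≤ a′ ℕ.+ 2 ℕ.* e′ →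
    suc e′ ≤ e → a′ ≤ a → b ≤ 2 ℕ.+ b′ →
    e ≡ suc e′ × a ≡ a′ × b ≡ 2 ℕ.+ b′ × a′ ℕ.+ 2 ℕ.* e′ ≡ b′ ℕ.+ N
  squeeze {a} {b} {a′} {b′} {e} {e′} {N} opt lb e′<e a′≤a b≤ = e≡ , a≡ , b≡ , opt′
    where
    chain : a ℕ.+ 2 ℕ.* e ≤ a′ ℕ.+ 2 ℕ.* suc e′
    chain = ≤-trans (≤-reflexive opt) (relax {e = suc e′} lb ≤-refl ≤-refl b≤)
    e≡ : e ≡ suc e′
    e≡ = ≤-antisym (ℕ.*-cancelˡ-≤ 2 (ℕ.+-cancelˡ-≤ a _ _ (≤-trans chain (ℕ.+-monoˡ-≤ _ a′≤a)))) e′<e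
    a≡ : a ≡ a′
    a≡ = ≤-antisym (ℕ.+-cancelʳ-≤ _ _ _ (≡.subst (λ x → a ℕ.+ 2 ℕ.* x ≤ a′ ℕ.+ 2 ℕ.* suc e′) e≡ chain)) a′≤a
    opt₁ : 2 ℕ.+ (a′ ℕ.+ 2 ℕ.* e′) ≡ b ℕ.+ N
    opt₁ = ≡.trans (≡.sym (2+2* a′ e′)) (≡.trans (≡.cong₂ (λ x y → x ℕ.+ 2 ℕ.* y) (≡.sym a≡) (≡.sym e≡)) opt)
    b≡ : b ≡ 2 ℕ.+ b′
    b≡ = ≤-antisym b≤ (ℕ.+-cancelʳ-≤ N _ _ (≤-trans (ℕ.+-monoʳ-≤ 2 lb) (≤-reflexive opt₁)))
    opt′ : a′ ℕ.+ 2 ℕ.* e′ ≡ b′ ℕ.+ N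
    opt′ = ℕ.+-cancelˡ-≡ 2 _ _ (≡.trans opt₁ (≡.cong (ℕ._+ N) b≡))

  delAll : ∀ {n} → Subset n → (ℕ → Fin n) → ℕ → Subset n
  delAll S g zero    = S
  delAll S g (suc k) = delAll (S - g 0) (g ∘ suc) k

  ∈-delAll⁻ : ∀ {n} (S : Subset n) g k {v} → v ∈ delAll S g k → v ∈ S × (∀ i → i < k → v ≢ g i)
  ∈-delAll⁻ S g zero    v∈ = v∈ , λ _ ()
  ∈-delAll⁻ S g (suc k) v∈ with ∈-delAll⁻ (S - g 0) (g ∘ suc) k v∈
  ... | v∈′ , v≢ with ∈-remove⁻ S v∈′
  ...   | v∈S , v≢g0 = v∈S , λ { zero _ → v≢g0 ; (suc i) (s≤s i<) → v≢ i i< }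

  ∈-delAll⁺ : ∀ {n} {S : Subset n} g k {v} → v ∈ S → (∀ i → i < k → v ≢ g i) → v ∈ delAll S g k
  ∈-delAll⁺ g zero    v∈ v≢ = v∈
  ∈-delAll⁺ g (suc k) v∈ v≢ = ∈-delAll⁺ (g ∘ suc) k (∈-remove⁺ v∈ (v≢ 0 (s≤s z≤n))) λ i i< → v≢ (suc i) (s≤s i<)

  module Extremal (K : StableDomain) where
    open StableDomain K
    open Algebra.Properties.Ring ring
    open Domain K
    open WeightedGraph K
    open Relation.Binary.Reasoning.Setoid setoid

    -- A vector supported off position 0 of a p-cycle whose image under the
    -- adjacency matrix is a nonzero multiple of the unit vector at 0 forces p ≡ 2 (mod 4).
    module _ (κ : ℕ → Carrier) (p-1 : ℕ) (κ0≈0 : κ 0 ≈ 0#) (κp≈0 : κ (suc p-1) ≈ 0#)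
             (rec : ∀ m → suc m < suc p-1 → κ m + κ (2 ℕ.+ m) ≈ 0#)
             (κ≉0 : ¬ κ p-1 + κ 1 ≈ 0#) where

      κ-period₄ : ∀ m → 4 ℕ.+ m ≤ suc p-1 → κ (4 ℕ.+ m) ≈ κ m
      κ-period₄ m le = sym (begin
        κ m                ≈⟨ x≈-y (rec m (≤-trans (s≤s (s≤s (ℕ.m≤n+m m 2))) le)) ⟩
        - κ (2 ℕ.+ m)      ≈⟨ -‿cong (x≈-y (rec (2 ℕ.+ m) le)) ⟩
        - (- κ (4 ℕ.+ m))  ≈⟨ -‿involutive _ ⟩
        κ (4 ℕ.+ m)        ∎)

      κ-period : ∀ m q → m ℕ.+ q ℕ.* 4 ≤ suc p-1 → κ (m ℕ.+ q ℕ.* 4) ≈ κ m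
      κ-period m zero    _  = reflexive (≡.cong κ (ℕ.+-identityʳ m))
      κ-period m (suc q) le = trans (reflexive (≡.cong κ eq))
        (trans (κ-period₄ (m ℕ.+ q ℕ.* 4) (≡.subst (_≤ suc p-1) eq le))
          (κ-period m q (≤-trans (ℕ.m≤n+m _ 4) (≡.subst (_≤ suc p-1) eq le))))
        where
        eq : m ℕ.+ (4 ℕ.+ q ℕ.* 4) ≡ 4 ℕ.+ (m ℕ.+ q ℕ.* 4)
        eq = ≡.trans (ℕ.+-comm m _) (≡.cong (4 ℕ.+_) (ℕ.+-comm _ m))

      -- The recurrence makes `κ` 4-periodic, so the values at `p - 1` and 1 depend on the residue
      -- only. For residue 0 their sum is `κ 3 + κ 1`, which vanishes; for 1 and 3 both values
      -- vanish because `κ 0` and `κ p` do.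
      residue : ∀ r q → r < 4 → suc p-1 ≡ r ℕ.+ q ℕ.* 4 → r ≡ 2
      residue 0 (suc q) _ ≡.refl = contradiction
        (trans (+-cong (κ-period 3 q (ℕ.n≤1+n _)) refl) (trans (+-comm _ _) (rec 1 (s≤s (s≤s (s≤s z≤n)))))) κ≉0
      residue 1 q _ ≡.refl = contradiction
        (trans (+-cong (trans (κ-period 0 q (ℕ.n≤1+n _)) κ0≈0) (trans (sym (κ-period 1 q ≤-refl)) κp≈0)) (+-identityʳ 0#)) κ≉0
      residue 2 q _ _ = ≡.refl
      residue 3 q _ ≡.refl = contradiction (trans (+-cong κ2 κ1) (+-identityʳ 0#)) κ≉0
        where
        κ2 : κ (2 ℕ.+ q ℕ.* 4) ≈ 0#
        κ2 = trans (κ-period 2 q (ℕ.n≤1+n _)) (trans (sym (trans (+-congʳ κ0≈0) (+-identityˡ _))) (rec 0 (s≤s (s≤s z≤n))))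
        κ1 : κ 1 ≈ 0#
        κ1 = trans (x≈-y (rec 1 (s≤s (s≤s (s≤s z≤n))))) (trans (-‿cong (trans (sym (κ-period 3 q ≤-refl)) κp≈0)) -0#≈0#)
      residue (suc (suc (suc (suc _)))) _ (s≤s (s≤s (s≤s (s≤s ())))) _

      order≡2 : suc p-1 % 4 ≡ 2
      order≡2 = residue (suc p-1 % 4) (suc p-1 / 4) (m%n<n (suc p-1) 4) (m≡m%n+[m/n]*n (suc p-1) 4)

    module Comparison {n : ℕ} (G : Graph n) (MΦ MG : Mat n n)
             (WΦ : Weighted G MΦ) (WG : Weighted G MG)
             (MG≈1 : ∀ {u v} → Graph.Adj G u v → MG u v ≈ 1#) where
      open Graph G
      open Induced G
      open Cycles G
      open GraphFacts G
      open PCycle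

      module Φ = Rank MΦ
      module 𝔾 = Rank MG
      module ΦG = OnGraph G WΦ
      module 𝔾G = OnGraph G WG

      -- This is `d ≥ 0` freed from subtraction. It ranges over all ranks, since no function
      -- computes them.
      Bounded : Subset n → Set
      Bounded S = ∀ {a b} → Φ.HasRankOn S a → 𝔾.HasRankOn S b → b ℕ.+ 2 ℕ.* n ≤ a ℕ.+ 2 ℕ.* ec S

      -- r(Φ[S]) = r(G[S]) - 2 θ(G[S]).
      Opt : Subset n → Set
      Opt S = ∀ {a b} → Φ.HasRankOn S a → 𝔾.HasRankOn S b → a ℕ.+ 2 ℕ.* ec S ≡ b ℕ.+ 2 ℕ.* n

      withRanks : ∀ {P : Set} S → Dec P → (∀ a b → Φ.HasRankOn S a → 𝔾.HasRankOn S b → P) → P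
      withRanks S P? h = Φ.with-rank S P? λ a ra → 𝔾.with-rank S P? λ b rb → h a b ra rb

      OnCyc-∈ : ∀ {S x} → OnCyc S x → x ∈ S
      OnCyc-∈ (_ , _ , _ , (x∈ , _) , _) = x∈

      removed-isolated : ∀ {S u v} → Pend S u v → ∀ {w} → ¬ E (S - v) u w
      removed-isolated {S} {u} {v} (_ , only) {w} e = proj₂ (∈-remove⁻ S (proj₁ (proj₂ e))) (only w (E-mono (remove⊆ S v) e))

      ec-pendant : ∀ {S u v} → Pend S u v → ¬ OnCyc S v → ec S ≡ ec (S - u - v)
      ec-pendant {S} {u} {v} pend ¬cyc = ≡.trans (ec-acyclic S v ¬cyc)
        (≡.trans (ec-acyclic (S - v) u λ (_ , _ , _ , e , _) → removed-isolated pend e) (≡.cong ec (p─x─y≡p─y─x S v u)))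

      remove₂-< : ∀ {S : Subset n} {u} v → u ∈ S → ∣ S - u - v ∣ < ∣ S ∣
      remove₂-< {S} {u} v u∈ = ≤-<-trans (p⊆q⇒∣p∣≤∣q∣ (remove⊆ (S - u) v)) (x∈p⇒∣p-x∣<∣p∣ u∈)

      bounded : ∀ S → Acc _<_ ∣ S ∣ → Bounded S
      bounded S (acc rec) {a} {b} ra rb with Fin.any? (OnCyc? S)
      ... | yes (x , cyc@(_ , _ , pair)) = withRanks (S - x) (_ ℕ.≤? _) λ a′ b′ ra′ rb′ →
        relax (bounded (S - x) (rec (x∈p⇒∣p-x∣<∣p∣ (OnCyc-∈ cyc))) ra′ rb′) (ec-cyclic-≤ S x pair)
          (Φ.rank-remove-≤ ra ra′) (𝔾.rank-remove-≥ rb rb′)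
      ... | no acyclic with Fin.any? (λ u → Fin.any? (E? S u))
      ...   | no edgeless
        rewrite 𝔾.rank-unique rb (𝔾G.rank-edgeless λ {u} {v} e → edgeless (u , v , e))
              | ec-forest ∣ S ∣ S ≤-refl (λ x c → acyclic (x , c)) = ℕ.m≤n+m (2 ℕ.* n) a
      -- In a forest every edge is a bridge and no leaf cycle exists, so the search can only end at
      -- a pendant vertex.
      ...   | yes (u₀ , v₀ , e₀) with Search.findLeaf (λ {x} pair _ → contradiction (x , _ , _ , pair) acyclic) (e₀ , λ ce → acyclic (_ , _ , ce))
      ...     | inj₂ (_ , _ , leaf , _) = contradiction (_ , _ , _ , cycPair (LeafCycle.cycle leaf) 0) acyclic
      ...     | inj₁ (u , v , pend) = withRanks (S - u - v) (_ ℕ.≤? _) λ a′ b′ ra′ rb′ →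
        ≡.subst₂ (λ x y → x ℕ.+ 2 ℕ.* n ≤ y ℕ.+ 2 ℕ.* ec S)
          (𝔾.rank-unique (𝔾.rank-pendant (𝔾G.isPendant pend) rb′) rb)
          (Φ.rank-unique (Φ.rank-pendant (ΦG.isPendant pend) ra′) ra)
          (ℕ.+-monoʳ-≤ 2 (≡.subst (λ e → b′ ℕ.+ 2 ℕ.* n ≤ a′ ℕ.+ 2 ℕ.* e) (≡.sym (ec-pendant pend (λ c → acyclic (v , c))))
            (bounded (S - u - v) (rec (remove₂-< v (proj₁ (proj₁ pend)))) ra′ rb′)))

      module _ {S} (opt : Opt S) {x a b} (pair : CycPair S x a b) where

        private
          x∈S : x ∈ S
          x∈S = proj₁ (proj₁ (proj₂ pair))

          tight : ∀ {r s r′ s′} → Φ.HasRankOn S r → 𝔾.HasRankOn S s → Φ.HasRankOn (S - x) r′ → 𝔾.HasRankOn (S - x) s′ →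
            ec S ≡ suc (ec (S - x)) × r ≡ r′ × s ≡ 2 ℕ.+ s′ × r′ ℕ.+ 2 ℕ.* ec (S - x) ≡ s′ ℕ.+ 2 ℕ.* n
          tight r s r′ s′ = squeeze (opt r s) (bounded (S - x) (<-wellFounded _) r′ s′) (ec-cyclic-≤ S x pair)
            (Φ.rank-remove-≤ r r′) (𝔾.rank-remove-≥ s s′)

        opt-remove : Opt (S - x)
        opt-remove r′ s′ = withRanks S (_ ℕ.≟ _) λ _ _ r s → proj₂ (proj₂ (proj₂ (tight r s r′ s′)))

        opt-ec : ec S ≡ suc (ec (S - x))
        opt-ec = withRanks S (_ ℕ.≟ _) λ _ _ r s → withRanks (S - x) (_ ℕ.≟ _) λ _ _ r′ s′ → proj₁ (tight r s r′ s′)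

        opt-rankΦ : ∀ {r r′} → Φ.HasRankOn S r → Φ.HasRankOn (S - x) r′ → r ≡ r′
        opt-rankΦ r r′ = 𝔾.with-rank S (_ ℕ.≟ _) λ _ s → 𝔾.with-rank (S - x) (_ ℕ.≟ _) λ _ s′ → proj₁ (proj₂ (tight r s r′ s′))

        opt-rankG : ∀ {s s′} → 𝔾.HasRankOn S s → 𝔾.HasRankOn (S - x) s′ → s ≡ 2 ℕ.+ s′
        opt-rankG s s′ = Φ.with-rank S (_ ℕ.≟ _) λ _ r → Φ.with-rank (S - x) (_ ℕ.≟ _) λ _ r′ → proj₁ (proj₂ (proj₂ (tight r s r′ s′)))

      opt-cactus : ∀ {S} → Opt S → Cactus S
      opt-cactus {S} opt {x} {a} {b} {c} pair ce with c Fin.≟ a | c Fin.≟ b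
      ... | yes c≡a | _ = inj₁ c≡a
      ... | no _ | yes c≡b = inj₂ c≡b
      ... | no c≢a | no c≢b = contradiction
        (≤-trans (ec-cyclic₂-≤ S x pair ce c≢a c≢b) (≤-reflexive (opt-ec opt pair))) ℕ.1+n≰n

      module _ {S} (opt : Opt S) {u v} (pend : Pend S u v) where

        -- Deleting `v` leaves `u` isolated and lowers the rank of Φ by 2, whereas equality forces
        -- the deletion of a cycle vertex to preserve that rank.
        opt-pendant-acyclic : ¬ OnCyc S v
        opt-pendant-acyclic (_ , _ , pair) = Φ.¬¬-rank (S - u - v) λ (r , rk) → ℕ.m≢1+n+m r {1}
          (≡.sym (opt-rankΦ opt pair (Φ.rank-pendant (ΦG.isPendant pend) rk)
            (Φ.rank-isolated (Φ.pendant-isolated (ΦG.isPendant pend)) (≡.subst (λ X → Φ.HasRankOn X r) (p─x─y≡p─y─x S u v) rk))))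

        opt-pendant : Opt (S - u - v)
        opt-pendant {a} {b} ra rb = ℕ.+-cancelˡ-≡ 2 _ _ (≡.trans
          (≡.cong (λ e → 2 ℕ.+ (a ℕ.+ 2 ℕ.* e)) (≡.sym (ec-pendant pend opt-pendant-acyclic)))
          (opt (Φ.rank-pendant (ΦG.isPendant pend) ra) (𝔾.rank-pendant (𝔾G.isPendant pend) rb)))

        pendant-off-cycle : ∀ (P : PCycle S) m → f P m ∈ S - u - v
        pendant-off-cycle P m = ∈-remove⁺ (∈-remove⁺ (f∈S P m) λ { ≡.refl → u-off (cycPair P m) })
          λ { ≡.refl → opt-pendant-acyclic (_ , _ , cycPair P m) }
          where
          u-off : ∀ {a b} → ¬ CycPair S u a b
          u-off (a≢b , ea , eb , _) = a≢b (≡.trans (proj₂ pend _ ea) (≡.sym (proj₂ pend _ eb)))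

      opt-isolated : ∀ {S u} → Opt S → u ∈ S → (∀ {w} → ¬ E S u w) → Opt (S - u)
      opt-isolated {S} {u} opt u∈ ¬e {a} {b} ra rb = ≡.trans
        (≡.cong (λ e → a ℕ.+ 2 ℕ.* e) (≡.sym (ec-acyclic S u λ (_ , _ , _ , e , _) → ¬e e)))
        (opt (Φ.rank-isolated (ΦG.isIsolated u∈ ¬e) ra) (𝔾.rank-isolated (𝔾G.isIsolated u∈ ¬e) rb))

      -- The path of `j * 2` vertices hangs free at `g 0`, so it is removed pair by pair as a
      -- pendant vertex and its neighbour. Only its last vertex may be attached to the rest, at
      -- `g (j * 2)`.
      strip : ∀ j {S} g → Opt S →
        (∀ i → suc i < j ℕ.* 2 → E S (g i) (g (suc i))) →
        (∀ i i′ → i < i′ → i′ < j ℕ.* 2 → g i ≢ g i′) →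
        (∀ i d → i < j ℕ.* 2 → E S (g i) d → d ≡ g (suc i) ⊎ (∃[ i′ ] i ≡ suc i′ × d ≡ g i′)) →
        Opt (delAll S g (j ℕ.* 2))
      strip zero    g opt _ _ _ = opt
      strip (suc j) {S} g opt edges inj nbr = strip j (λ i → g (2 ℕ.+ i)) (opt-pendant opt pend)
        (λ i i< → E-remove⁺ (E-remove⁺ (edges (2 ℕ.+ i) (s≤s (s≤s i<))) (≢g 0 (2 ℕ.+ i) (s≤s z≤n) (ℕ.<⇒≤ (s≤s (s≤s i<)))) (≢g 0 (3 ℕ.+ i) (s≤s z≤n) (s≤s (s≤s i<))))
                            (≢g 1 (2 ℕ.+ i) (s≤s (s≤s z≤n)) (ℕ.<⇒≤ (s≤s (s≤s i<)))) (≢g 1 (3 ℕ.+ i) (s≤s (s≤s z≤n)) (s≤s (s≤s i<))))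
        (λ i i′ i<i′ i′< → inj (2 ℕ.+ i) (2 ℕ.+ i′) (s≤s (s≤s i<i′)) (s≤s (s≤s i′<)))
        nbr′
        where
        ≢g : ∀ i i′ → i < i′ → i′ < suc j ℕ.* 2 → g i′ ≢ g i
        ≢g i i′ i<i′ i′< = inj i i′ i<i′ i′< ∘ ≡.sym
        pend : Pend S (g 0) (g 1)
        pend = edges 0 (s≤s (s≤s z≤n)) , λ w e → case nbr 0 w (s≤s z≤n) e of λ where
          (inj₁ eq) → eq
          (inj₂ (_ , () , _))
        nbr′ : ∀ i d → i < j ℕ.* 2 → E (S - g 0 - g 1) (g (2 ℕ.+ i)) d → d ≡ g (3 ℕ.+ i) ⊎ (∃[ i′ ] i ≡ suc i′ × d ≡ g (2 ℕ.+ i′))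
        nbr′ i d i< e@(_ , d∈ , _) with nbr (2 ℕ.+ i) d (s≤s (s≤s i<)) (E-mono (remove⊆ S (g 0) ∘ remove⊆ (S - g 0) (g 1)) e)
        nbr′ i d i< e | inj₁ eq = inj₁ eq
        nbr′ zero d i< (_ , d∈ , _) | inj₂ (.1 , ≡.refl , eq) = contradiction eq (proj₂ (∈-remove⁻ (S - g 0) d∈))
        nbr′ (suc i) d i< e | inj₂ (.(2 ℕ.+ i) , ≡.refl , eq) = inj₂ (i , ≡.refl , eq)

      CycleCond : Subset n → Set
      CycleCond S = ∀ (P : PCycle S) → p P % 4 ≡ 2 × prodN (λ m → MΦ (f P m) (f P (suc m))) (p P) ≈ - 1#

      NoPend Bridgeless : Subset n → Set
      NoPend S = ∀ u v → ¬ Pend S u v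
      Bridgeless S = ∀ u v → E S u v → CE S u v

      bridgeless-cycles : ∀ {S} → Opt S → Bridgeless S → CycleCond S
      bridgeless-cycles {S} opt bl P = p%4 , prod
        where
        x = f P 0
        pair = cycPair P 0
        closed : ∀ m d → E S (f P m) d → d ≡ f P (suc m) ⊎ d ≡ prev P m
        closed m d e = opt-cactus opt (cycPair P m) (bl _ _ e)
        module CΦ = ΦG.Component P closed
        module CG = 𝔾G.Component P closed
        fp≡f0 : f P (p P) ≡ x
        fp≡f0 = ≡.trans (≡.cong (f P) (≡.sym (ℕ.+-identityʳ (p P)))) (periodic P 0)
        p%4 : p P % 4 ≡ 2
        p%4 = decidable-stable (_ ℕ.≟ _) λ ¬p → 𝔾.¬¬-rank (S - x) λ (s′ , rk′) → 𝔾.¬¬-rank S λ (s , rk) →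
          𝔾.coker-at (≡.subst (𝔾.HasRankOn S) (opt-rankG opt pair rk rk′) rk) rk′ λ (k , supp′ , ker , kx≉0) →
            let
              supp : 𝔾.Supp k S
              supp = λ j j∉ → supp′ j (j∉ ∘ remove⊆ S x)
              k0 : k x ≈ 0#
              k0 = supp′ x λ x∈ → proj₂ (∈-remove⁻ S x∈) ≡.refl
              row : ∀ m → 𝔾.mv k (f P (suc m)) ≈ k (f P m) + k (f P (2 ℕ.+ m))
              row = λ m → trans (CG.row-sum supp m) (+-cong
                (trans (*-congˡ (MG≈1 (Adj-sym (proj₂ (proj₂ (edge P m)))))) (*-identityʳ _))
                (trans (*-congˡ (MG≈1 (proj₂ (proj₂ (edge P (suc m)))))) (*-identityʳ _)))
            -- Rows other than `x` yield the alternating recurrence. Row `x`, whose neighbours are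
            -- positions `p - 1` and 1, yields the sum that must not vanish.
            in ¬p (order≡2 (k ∘ f P) (2 ℕ.+ p-3 P) k0 (trans (reflexive (≡.cong k fp≡f0)) k0)
              (λ m sm<p → trans (sym (row m)) (ker (f P (suc m)) (∈-remove⁺ (f∈S P (suc m))
                (≡.subst (λ i → f P i ≢ x) (ℕ.+-identityʳ (suc m)) (distinct P (suc m) 0 (s≤s z≤n) sm<p)))))
              λ sum≈0 → kx≉0 (begin
                𝔾.mv k x                                    ≈⟨ reflexive (≡.cong (𝔾.mv k) fp≡f0) ⟨
                𝔾.mv k (f P (p P))                          ≈⟨ row (2 ℕ.+ p-3 P) ⟩
                k (f P (2 ℕ.+ p-3 P)) + k (f P (suc (p P))) ≈⟨ +-congˡ (reflexive (≡.cong k (≡.trans (≡.cong (f P) (ℕ.+-comm 1 (p P))) (periodic P 1)))) ⟩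
                k (f P (2 ℕ.+ p-3 P)) + k (f P 1)           ≈⟨ sum≈0 ⟩
                0#                                          ∎))
        prod : prodN CΦ.w (p P) ≈ - 1#
        prod = ≈-stable _ _ λ ¬p → Φ.¬¬-rank (S - x) λ (r′ , rk′) → Φ.¬¬-rank S λ (r , rk) →
          Φ.kernel-at (f∈S P 0) rk (≡.subst (Φ.HasRankOn (S - x)) (≡.sym (opt-rankΦ opt pair rk rk′)) rk′) λ (z , supp , ker , zx≉0) →
            -- One turn round the cycle multiplies `z x` by minus the product of the weights, so
            -- `(prod + 1) * z x` is zero and the nonzero `z x` cancels.
            ¬p (x≈-y (cancelʳ _ (z x) (begin
              (prodN CΦ.w (p P) + 1#) * z x          ≈⟨ distribʳ (z x) _ 1# ⟩
              prodN CΦ.w (p P) * z x + 1# * z x      ≈⟨ +-congˡ (*-identityˡ _) ⟩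
              prodN CΦ.w (p P) * z x + z x           ≈⟨ +-congˡ (CΦ.monodromy (p P / 4) (≡.trans (m≡m%n+[m/n]*n (p P) 4) (≡.cong (ℕ._+ p P / 4 ℕ.* 4) p%4)) supp (λ m → ker (f P m) (f∈S P m))) ⟩
              prodN CΦ.w (p P) * z x + - (prodN CΦ.w (p P) * z x) ≈⟨ -‿inverseʳ _ ⟩
              0#                                     ∎) zx≉0))

      Result : Subset n → Set
      Result S = CycleCond S × (NoPend S → Bridgeless S)

      -- The neighbour `w` is not pendant, so it has a neighbour besides `a`. If there is exactly
      -- one, `w` is the only pendant vertex of `S - a`, and equality holds for `S - a` and
      -- `S - a - w`: the situation repeats with one vertex fewer. If there are more, `S - a` has no
      -- pendant vertex and is bridgeless by `ih`, so `w` lies on a cycle, which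
      -- `opt-pendant-acyclic` forbids. `N` stays fixed while `S` shrinks, which keeps `ih`
      -- applicable.
      lone-pendant : ∀ N → (∀ S → ∣ S ∣ < N → Opt S → Result S) →
        ∀ S a w → Acc _<_ ∣ S ∣ → ∣ S ∣ ≤ N → Opt S → Opt (S - a) → Pend S a w → (∀ u v → u ≢ a → ¬ Pend S u v) → ⊥
      lone-pendant N ih S a w (acc rec) ∣S∣≤N opt opt-a pend@(e , only) others
        with Fin.any? (λ b → E? S w b ×-dec ¬? (b Fin.≟ a))
      ... | no none = others w a (E-≢ e ∘ ≡.sym) (E-sym e , λ b eb → decidable-stable (b Fin.≟ a) λ b≢a → none (b , eb , b≢a))
      ... | yes (b , eb , b≢a) with Fin.any? (λ c → E? S w c ×-dec ¬? (c Fin.≟ a) ×-dec ¬? (c Fin.≟ b))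
      ...   | no none = lone-pendant N ih (S - a) w b (rec smaller) (ℕ.<⇒≤ (ℕ.<-≤-trans smaller ∣S∣≤N)) opt-a (opt-pendant opt pend)
                (E-remove⁺ eb (E-≢ e ∘ ≡.sym) b≢a , λ c ec → decidable-stable (c Fin.≟ b) λ c≢b →
                  none (c , E-mono (remove⊆ S a) ec , proj₂ (∈-remove⁻ S (proj₁ (proj₂ ec))) , c≢b))
                (others′ )
        where
        smaller : ∣ S - a ∣ < ∣ S ∣
        smaller = x∈p⇒∣p-x∣<∣p∣ (proj₁ e)
        others′ : ∀ u v → u ≢ w → ¬ Pend (S - a) u v
        others′ u v u≢w (euv , only′) = others u v (proj₂ (∈-remove⁻ S (proj₁ euv)))
          (E-mono (remove⊆ S a) euv , λ d ed → only′ d (E-remove⁺ ed (proj₂ (∈-remove⁻ S (proj₁ euv))) λ { ≡.refl → u≢w (only u (E-sym ed)) }))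
      ...   | yes (c , ec , c≢a , c≢b) = opt-pendant-acyclic opt pend (b , CE-mono (remove⊆ S a) (proj₂ (ih (S - a) (ℕ.<-≤-trans smaller ∣S∣≤N) opt-a) noPend w b (E-remove⁺ eb (E-≢ e ∘ ≡.sym) b≢a)))
        where
        smaller : ∣ S - a ∣ < ∣ S ∣
        smaller = x∈p⇒∣p-x∣<∣p∣ (proj₁ e)
        noPend : NoPend (S - a)
        noPend u v (euv , only′) with u Fin.≟ w
        ... | yes ≡.refl = c≢b (≡.trans (only′ c (E-remove⁺ ec (E-≢ e ∘ ≡.sym) c≢a)) (≡.sym (only′ b (E-remove⁺ eb (E-≢ e ∘ ≡.sym) b≢a))))
        ... | no u≢w = others u v (proj₂ (∈-remove⁻ S (proj₁ euv)))
          (E-mono (remove⊆ S a) euv , λ d ed → only′ d (E-remove⁺ ed (proj₂ (∈-remove⁻ S (proj₁ euv))) λ { ≡.refl → u≢w (only u (E-sym ed)) }))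

      -- Deleting f 1, respectively f 0, from an even leaf cycle and then stripping the
      -- remaining path leaves the rest of the graph with, respectively without, y.
      no-leaf-cycle : ∀ {S y w} → (∀ S′ → ∣ S′ ∣ < ∣ S ∣ → Opt S′ → Result S′) → Opt S → NoPend S →
        (leaf : LeafCycle S y w) → p (LeafCycle.cycle leaf) % 4 ≡ 2 → ⊥
      no-leaf-cycle {S} {y} {w} ih opt noPend record { cycle = P ; f0 = ≡.refl ; bridge = (yw , ¬ce) ; only = only } p%4 =
        lone-pendant ∣ S ∣ ih S₁ y w (<-wellFounded _) (p⊆q⇒∣p∣≤∣q∣ S₁⊆S) opt₁ opt₂ pend₁ others
        where
        q = p P / 4
        p≡ : p P ≡ 2 ℕ.+ q ℕ.* 4
        p≡ = ≡.trans (m≡m%n+[m/n]*n (p P) 4) (≡.cong (ℕ._+ q ℕ.* 4) p%4)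
        -- The number of pendant pairs: both strippings remove `p - 2 = 4 q` vertices after the
        -- first deletion.
        j = q ℕ.* 2
        ℓ = j ℕ.* 2
        j2≡ : ℓ ≡ q ℕ.* 4
        j2≡ = ℕ.*-assoc q 2 2
        2+j2≡p : 2 ℕ.+ ℓ ≡ p P
        2+j2≡p = ≡.trans (≡.cong (2 ℕ.+_) j2≡) (≡.sym p≡)
        <p : ∀ {i} → i < ℓ → 2 ℕ.+ i < p P
        <p {i} i< = ≡.subst (2 ℕ.+ i <_) 2+j2≡p (s≤s (s≤s i<))
        fp≡y : f P (2 ℕ.+ ℓ) ≡ y
        fp≡y = ≡.trans (≡.cong (f P) (≡.trans 2+j2≡p (≡.sym (ℕ.+-identityʳ (p P))))) (periodic P 0)
        inner : ∀ m d → suc m < p P → E S (f P (suc m)) d → d ≡ f P (2 ℕ.+ m) ⊎ d ≡ f P m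
        inner m d sm<p e with only (suc m) d e
        ... | inj₁ ce = [ inj₁ , inj₂ ∘ (λ eq → ≡.trans eq (prev-suc P m)) ]′ (opt-cactus opt (cycPair P (suc m)) ce)
        ... | inj₂ (eq , _) = contradiction (≡.sym eq) (f-inj P 0 (suc m) (s≤s z≤n) sm<p)

        opt₁′ : Opt (delAll (S - f P 1) (f P ∘ (2 ℕ.+_)) (ℓ))
        opt₁′ = strip j (f P ∘ (2 ℕ.+_)) (opt-remove opt (cycPair P 1))
          (λ i si< → E-remove⁺ (edge P (2 ℕ.+ i)) (f-inj P 1 (2 ℕ.+ i) (s≤s (s≤s z≤n)) (<p (ℕ.<⇒≤ si<)) ∘ ≡.sym)
                                                  (f-inj P 1 (3 ℕ.+ i) (s≤s (s≤s z≤n)) (<p si<) ∘ ≡.sym))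
          (λ i i′ i<i′ i′< → f-inj P (2 ℕ.+ i) (2 ℕ.+ i′) (s≤s (s≤s i<i′)) (<p i′<))
          nbr
          where
          nbr : ∀ i d → i < ℓ → E (S - f P 1) (f P (2 ℕ.+ i)) d → d ≡ f P (3 ℕ.+ i) ⊎ (∃[ i′ ] i ≡ suc i′ × d ≡ f P (2 ℕ.+ i′))
          nbr i d i< e with inner (suc i) d (<p i<) (E-mono (remove⊆ S (f P 1)) e)
          nbr i d i< e | inj₁ eq = inj₁ eq
          nbr zero d i< (_ , d∈ , _) | inj₂ eq = contradiction eq (proj₂ (∈-remove⁻ S d∈))
          nbr (suc i) d i< e | inj₂ eq = inj₂ (i , ≡.refl , eq)

        opt₂′ : Opt (delAll (S - f P 0) (f P ∘ suc) (ℓ))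
        opt₂′ = strip j (f P ∘ suc) (opt-remove opt (cycPair P 0))
          (λ i si< → E-remove⁺ (edge P (suc i)) (f-inj P 0 (suc i) (s≤s z≤n) (ℕ.<⇒≤ (<p (ℕ.<⇒≤ si<))) ∘ ≡.sym)
                                                (f-inj P 0 (2 ℕ.+ i) (s≤s z≤n) (<p (ℕ.<⇒≤ si<)) ∘ ≡.sym))
          (λ i i′ i<i′ i′< → f-inj P (suc i) (suc i′) (s≤s i<i′) (ℕ.<⇒≤ (<p i′<)))
          nbr
          where
          nbr : ∀ i d → i < ℓ → E (S - f P 0) (f P (suc i)) d → d ≡ f P (2 ℕ.+ i) ⊎ (∃[ i′ ] i ≡ suc i′ × d ≡ f P (suc i′))
          nbr i d i< e with inner i d (ℕ.<⇒≤ (<p i<)) (E-mono (remove⊆ S (f P 0)) e)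
          nbr i d i< e | inj₁ eq = inj₁ eq
          nbr zero d i< (_ , d∈ , _) | inj₂ eq = contradiction eq (proj₂ (∈-remove⁻ S d∈))
          nbr (suc i) d i< e | inj₂ eq = inj₂ (i , ≡.refl , eq)

        S₁ S₂ : Subset n
        S₁ = delAll S (f P ∘ suc) (suc (ℓ))
        S₂ = delAll S (f P) (suc (ℓ))

        opt₁ : Opt S₁
        opt₁ = opt₁′

        last : Fin n
        last = f P (suc (ℓ))

        last∈ : last ∈ S₂
        last∈ = ∈-delAll⁺ (f P) (suc (ℓ)) (f∈S P _) λ i i< eq → f-inj P i (suc (ℓ)) i< (≡.subst (suc (ℓ) <_) 2+j2≡p ≤-refl) (≡.sym eq)

        last-isolated : ∀ {d} → ¬ E S₂ last d
        last-isolated {d} e@(_ , d∈ , _) with ∈-delAll⁻ S (f P) (suc (ℓ)) d∈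
        ... | d∈S , d≢ with inner (ℓ) d (≡.subst (suc (ℓ) <_) 2+j2≡p ≤-refl) (E-mono (proj₁ ∘ ∈-delAll⁻ S (f P) (suc (ℓ))) e)
        ...   | inj₁ eq = d≢ 0 (s≤s z≤n) (≡.trans eq fp≡y)
        ...   | inj₂ eq = d≢ (ℓ) ≤-refl eq

        S₁⁻ : ∀ {v} → v ∈ S₁ → v ∈ S × (∀ i → 0 < i → i < p P → v ≢ f P i)
        S₁⁻ v∈ with ∈-delAll⁻ S (f P ∘ suc) (suc (ℓ)) v∈
        ... | v∈S , v≢ = v∈S , λ { (suc i) _ si<p → v≢ i (≤-pred (≡.subst (suc i <_) (≡.sym 2+j2≡p) si<p)) }

        S₁⁺ : ∀ {v} → v ∈ S → (∀ i → 0 < i → i < p P → v ≢ f P i) → v ∈ S₁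
        S₁⁺ v∈ v≢ = ∈-delAll⁺ (f P ∘ suc) (suc (ℓ)) v∈ λ i i< → v≢ (suc i) (s≤s z≤n) (≡.subst (suc i <_) 2+j2≡p (s≤s i<))

        S₁⊆S : S₁ ⊆ S
        S₁⊆S = proj₁ ∘ S₁⁻

        -- Both sides are `S` without the whole cycle. The second stripping leaves `last` over as an
        -- isolated vertex, whose deletion preserves equality.
        same : S₁ - y ≡ S₂ - last
        same = ⊆-antisym to from
          where
          to : S₁ - y ⊆ S₂ - last
          to v∈ with ∈-remove⁻ S₁ v∈
          ... | v∈₁ , v≢y with S₁⁻ v∈₁
          ...   | v∈S , v≢ = ∈-remove⁺ (∈-delAll⁺ (f P) (suc (ℓ)) v∈S λ where
                      zero _ → v≢y
                      (suc i) si< → v≢ (suc i) (s≤s z≤n) (≡.subst (suc i <_) 2+j2≡p (ℕ.m≤n⇒m≤1+n si<)))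
                    (v≢ (suc (ℓ)) (s≤s z≤n) (≡.subst (suc (ℓ) <_) 2+j2≡p ≤-refl))
          from : S₂ - last ⊆ S₁ - y
          from v∈ with ∈-remove⁻ S₂ v∈
          ... | v∈₂ , v≢last with ∈-delAll⁻ S (f P) (suc (ℓ)) v∈₂
          ...   | v∈S , v≢ = ∈-remove⁺ (S₁⁺ v∈S λ i _ i<p → case ℕ.m≤n⇒m<n∨m≡n (≤-pred (≡.subst (i <_) (≡.sym 2+j2≡p) i<p)) of λ where
                      (inj₁ i<) → v≢ i i<
                      (inj₂ ≡.refl) → v≢last)
                    (v≢ 0 (s≤s z≤n))

        opt₂ : Opt (S₁ - y)
        opt₂ = ≡.subst Opt (≡.sym same) (opt-isolated opt₂′ last∈ last-isolated)

        y∈₁ : y ∈ S₁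
        y∈₁ = S₁⁺ (f∈S P 0) λ i 0<i i<p → f-inj P 0 i 0<i i<p

        w∈₁ : w ∈ S₁
        w∈₁ = S₁⁺ (proj₁ (proj₂ yw)) λ { i _ _ ≡.refl → ¬ce (chord P 0 (i , ≡.refl) yw) }

        pend₁ : Pend S₁ y w
        pend₁ = (y∈₁ , w∈₁ , proj₂ (proj₂ yw)) , λ d e@(_ , d∈ , _) → case only 0 d (E-mono S₁⊆S e) of λ where
          (inj₂ (_ , eq)) → eq
          (inj₁ ce) → case opt-cactus opt (cycPair P 0) ce of λ where
            (inj₁ eq) → contradiction eq (proj₂ (S₁⁻ d∈) 1 (s≤s z≤n) (s≤s (s≤s z≤n)))
            (inj₂ eq) → contradiction (≡.trans eq (≡.cong (f P) (ℕ.+-identityʳ (2 ℕ.+ p-3 P)))) (proj₂ (S₁⁻ d∈) (2 ℕ.+ p-3 P) (s≤s z≤n) ≤-refl)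

        -- Such a `u` lies off the cycle. The deleted cycle vertices have no neighbours off the
        -- cycle, so `u` keeps all its neighbours, and being pendant in `S₁` it would be pendant in
        -- `S`.
        others : ∀ u v → u ≢ y → ¬ Pend S₁ u v
        others u v u≢y (e , only′) = noPend u v (E-mono S₁⊆S e , λ d ed → only′ d (proj₁ e , S₁⁺ (proj₁ (proj₂ ed)) (away ed) , proj₂ (proj₂ ed)))
          where
          u∉P : ∀ k → u ≢ f P k
          u∉P k eq with reach P 0 k
          ... | zero , _ , eq′ = u≢y (≡.trans eq (≡.sym eq′))
          ... | suc i , si<p , eq′ = proj₂ (S₁⁻ (proj₁ e)) (suc i) (s≤s z≤n) si<p (≡.trans eq (≡.trans (≡.sym eq′) (≡.cong (f P) (ℕ.+-identityʳ (suc i)))))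
          away : ∀ {d} → E S u d → ∀ i → 0 < i → i < p P → d ≢ f P i
          away ed (suc i) _ si<p ≡.refl = [ u∉P (2 ℕ.+ i) , u∉P i ]′ (inner i u si<p (E-sym ed))

      main : ∀ S → Acc _<_ ∣ S ∣ → Opt S → Result S
      main S (acc rec) opt with Fin.any? (λ u → Fin.any? (Pend? S u))
      ... | yes (u , v , pend@(e , _)) =
        (λ P → proj₁ (main (S - u - v) (rec (remove₂-< v (proj₁ e))) (opt-pendant opt pend)) (restrict P (pendant-off-cycle opt pend P)))
        , λ noPend → contradiction pend (noPend u v)
      ... | no none with Fin.any? (λ u → Fin.any? λ v → E? S u v ×-dec ¬? (CE? S u v))
      ...   | no nobridge = bridgeless-cycles opt bl , λ _ → bl
        where
        bl : Bridgeless S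
        bl u v e = decidable-stable (CE? S u v) λ ¬ce → nobridge (u , v , e , ¬ce)
      ...   | yes (a , b , bridge) = ⊥-elim contra
        where
        noPend : NoPend S
        noPend u v pend = none (u , v , pend)
        U : Cactus S
        U = opt-cactus opt
        leafBeyond : ∀ {a b} → Bridge S a b → ∃[ y ] ∃[ w ] LeafCycle S y w × Con (S - a) b y
        leafBeyond br with Search.findLeaf U br
        ... | inj₁ (u , v , pend) = contradiction pend (noPend u v)
        ... | inj₂ found = found
        contra : ⊥
        -- Searching again across the bridge `yw`, away from the first leaf cycle, finds a second
        -- one through `y′`. If `y′` lay on the first cycle, `yw` would be cyclic; so the first
        -- cycle survives in `S - y′`, where induction gives its order.
        contra with leafBeyond bridge
        ... | y , w , leaf@(record { cycle = P ; f0 = ≡.refl ; bridge = br@(yw , ¬ce) }) , _ with leafBeyond br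
        ...   | y′ , _ , leaf′@(record { cycle = P′ ; f0 = ≡.refl }) , w~y′ = no-leaf-cycle (λ S′ lt → main S′ (rec lt)) opt noPend leaf
                (proj₁ (proj₁ (main (S - y′) (rec (x∈p⇒∣p-x∣<∣p∣ (f∈S P′ 0))) (opt-remove opt (cycPair P′ 0)))
                  (restrict P λ m → ∈-remove⁺ (f∈S P m) λ eq → y′∉P (m , eq))))
          where
          y′≢y : y′ ≢ y
          y′≢y eq = proj₂ (∈-remove⁻ S (Con-∈ (Con-sym w~y′) (∈-remove⁺ (proj₁ (proj₂ yw)) (E-≢ yw ∘ ≡.sym)))) eq
          y′∉P : ¬ OnP P y′
          y′∉P on = ¬ce (f P 1 , (λ { ≡.refl → ¬ce (_ , cycPair P 0) }) , yw , edge P 0 , w~y′ ◅◅ Con-sym (from-next P 0 on y′≢y))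

      reduce : ∀ S → Acc _<_ ∣ S ∣ → Opt S → Star (δ-Step G) full S → (∀ (P : PCycle full) m → f P m ∈ S) →
        ∃[ S₀ ] Star (δ-Step G) full S₀ × Opt S₀ × (∀ u v → ¬ Pend S₀ u v) × (∀ (P : PCycle full) m → f P m ∈ S₀)
      reduce S (acc rec) optS path cycles with Fin.any? (λ u → Fin.any? (Pend? S u))
      ... | no none = S , path , optS , (λ u v pend → none (u , v , pend)) , cycles
      ... | yes (u , v , pend@((u∈ , v∈ , e) , _)) = reduce (S - u - v)
        (rec (remove₂-< v u∈))
        (opt-pendant optS pend)
        (path ◅◅ (delete (Pend⇒Pendant pend) v∈ e ◅ nil))
        λ P m → pendant-off-cycle optS pend (restrict P (cycles P)) m

      record CycleSystem (S : Subset n) : Set where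
        field
          k        : ℕ
          C        : Fin k → PCycle S
          disjoint : ∀ i j → i ≢ j → ∀ v → ¬ (OnP (C i) v × OnP (C j) v)
          covers   : ∀ u v → CE S u v → ∃[ i ] EdgeOf (roll (C i)) u v
          count    : ec S ≡ n ℕ.+ k

      -- As distinct cycles are disjoint, deleting one vertex of `P` destroys `P` and no other
      -- cycle, and `ec` drops by exactly one. Hence the number of cycles collected is θ.
      addCycle : ∀ {S} → Opt S → (P : PCycle S) → CycleSystem (S - f P 0) → CycleSystem S
      addCycle {S} optS P record { k = k ; C = C ; disjoint = disjoint ; covers = covers ; count = count } = record
        { k = suc k
        ; C = C′
        ; disjoint = disjoint′
        ; covers = covers′
        ; count = ≡.trans (opt-ec optS (cycPair P 0)) (≡.trans (≡.cong suc count) (≡.sym (ℕ.+-suc n k)))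
        }
        where
        x : Fin n
        x = f P 0
        U : Cactus S
        U = opt-cactus optS
        widen : PCycle (S - x) → PCycle S
        widen Q = restrict Q (remove⊆ S x ∘ f∈S Q)
        C′ : Fin (suc k) → PCycle S
        C′ zero    = P
        C′ (suc i) = widen (C i)
        apart : ∀ i v → ¬ (OnP P v × OnP (C i) v)
        apart i v (onP , onC) = let m , eq = same-OnP U P (widen (C i)) onP onC 0 in proj₂ (∈-remove⁻ S (f∈S (C i) m)) eq
        disjoint′ : ∀ i j → i ≢ j → ∀ v → ¬ (OnP (C′ i) v × OnP (C′ j) v)
        disjoint′ zero    zero    i≢j = contradiction ≡.refl i≢j
        disjoint′ zero    (suc j) _ v on = apart j v on
        disjoint′ (suc i) zero    _ v (on , on′) = apart i v (on′ , on)
        disjoint′ (suc i) (suc j) i≢j = disjoint i j (i≢j ∘ ≡.cong suc)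
        covers-cycle : (D : PCycle S) → ∃[ i ] EdgeOf (roll (C′ i)) (f D 0) (f D 1)
        covers-cycle D = case OnP? D x of λ where
          (yes on) → zero , same-edge U D P on (0 , ≡.refl) 0
          (no off) → let i , e = covers _ _ (_ , cycPair (restrict D λ m → ∈-remove⁺ (f∈S D m) λ eq → off (m , eq)) 0) in suc i , e
        covers′ : ∀ u v → CE S u v → ∃[ i ] EdgeOf (roll (C′ i)) u v
        covers′ u v (_ , pair) = let D , f0 , f1 = cycleThrough pair in
          ≡.subst₂ (λ a b → ∃[ i ] EdgeOf (roll (C′ i)) a b) f0 f1 (covers-cycle D)

      cycleSystem : ∀ S → Acc _<_ ∣ S ∣ → Opt S → CycleSystem S
      cycleSystem S (acc rec) optS with Fin.any? (OnCyc? S)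
      ... | no acyclic = record { k = 0 ; C = λ () ; disjoint = λ () ; covers = λ u v ce → contradiction (u , v , ce) acyclic
                                ; count = ≡.trans (ec-forest ∣ S ∣ S ≤-refl λ x c → acyclic (x , c)) (≡.sym (ℕ.+-identityʳ n)) }
      ... | yes (_ , _ , _ , pair) = let P = proj₁ (cycleThrough pair) in
        addCycle optS P (cycleSystem (S - f P 0) (rec (x∈p⇒∣p-x∣<∣p∣ (f∈S P 0))) (opt-remove optS (cycPair P 0)))

      crucial-subgraph : Opt full → Σ[ G₀ ∈ Subset n ] Crucial G G₀ × (∃[ k ] + k ≡ θ G × CyclesAndIsolatedVertices G G₀ k)
      crucial-subgraph opt = assemble (reduce full (<-wellFounded _) opt nil (λ _ _ → ∈⊤))
        where
        open CycleSystem (cycleSystem full (<-wellFounded _) opt)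
        assemble : (∃[ S₀ ] Star (δ-Step G) full S₀ × Opt S₀ × NoPend S₀ × (∀ (P : PCycle full) m → f P m ∈ S₀)) →
          Σ[ G₀ ∈ Subset n ] Crucial G G₀ × (∃[ k ] + k ≡ θ G × CyclesAndIsolatedVertices G G₀ k)
        assemble (G₀ , path , opt₀ , noPend , cycles) = G₀
          , (path , λ v pend → let w , pend′ = Pendant⇒∃Pend pend in noPend v w pend′)
          , k , ≡.sym (θ≡ count) , roll ∘ C
          , (λ { i v (j , ≡.refl) → cycles (C i) (toℕ j) })
          , (λ i j i≢j v ((a , eq) , (b , eq′)) → disjoint i j i≢j v ((toℕ a , eq) , (toℕ b , eq′)))
          -- `G₀` has no pendant vertex and so no bridge. Each of its edges is therefore cyclic,
          -- already in the whole graph, and belongs to one of the collected cycles.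
          , λ u v u∈ v∈ e → covers u v (CE-mono ⊆⊤ (proj₂ (main G₀ (<-wellFounded _) opt₀) noPend u v (u∈ , v∈ , e)))

      weights : ∀ {S} → PCycle S → ℕ → Carrier
      weights P m = MΦ (f P m) (f P (suc m))

      -- The ranks computed from disjoint cycles and δ-transformations

      module Converse (2≉0 : ¬ 1# + 1# ≈ 0#)
        (types : ∀ {S} C (v∈ : ∀ i → Cycle.vertex C i ∈ S) →
           Cycle.order C % 4 ≡ 2 × prodN (weights (unroll C v∈)) (Cycle.order C) ≈ - 1#) where

        Ranks : ℕ → Subset n → Set
        Ranks k S = ∃[ r ] Φ.HasRankOn S r × 𝔾.HasRankOn S (2 ℕ.* k ℕ.+ r)

        -- Splitting off one cycle of order `p` as a block takes `p - 2` from the rank of Φ and `p`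
        -- from that of G, so each cycle accounts for a difference of 2.
        ranks-cycles : ∀ k {S} → CyclesAndIsolatedVertices G S k → Ranks k S
        ranks-cycles zero (_ , _ , _ , edges) = 0
          , ΦG.rank-edgeless (λ (u∈ , v∈ , e) → case edges _ _ u∈ v∈ e of λ ())
          , 𝔾G.rank-edgeless (λ (u∈ , v∈ , e) → case edges _ _ u∈ v∈ e of λ ())
        ranks-cycles (suc k) {S} (C , C∈ , disjoint , edges) = q ℕ.* 4 ℕ.+ r
          , ΦG.rank-typeA P closed q p≡ prod≈-1 rΦ
          , ≡.subst (𝔾.HasRankOn S) size (𝔾G.rank-nonsingular P closed q p≡ (λ m → MG≈1 (proj₂ (proj₂ (edge P m)))) 2≉0 rG)
          where
          C₀ = C zero
          v∈ : ∀ i → Cycle.vertex C₀ i ∈ S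
          v∈ i = C∈ zero _ (i , ≡.refl)
          P : PCycle S
          P = unroll C₀ v∈
          OnP⇒OnCycle : ∀ {v} → OnP P v → OnCycle C₀ v
          OnP⇒OnCycle (m , eq) = m mod p P , eq
          closed : ∀ m d → E S (f P m) d → d ≡ f P (suc m) ⊎ d ≡ prev P m
          closed m d (fm∈ , d∈ , e) with edges (f P m) d fm∈ d∈ e
          ... | suc i , j , eqs = contradiction
                  (OnP⇒OnCycle (m , ≡.refl) , [ (λ (eq , _) → j , eq) , (λ (_ , eq) → next j , eq) ]′ eqs)
                  (disjoint zero (suc i) (λ ()) (f P m))
          ... | zero , j , inj₁ (eq , ≡.refl) = inj₁ (f-step P (toℕ j) m (≡.trans (unroll-vertex C₀ v∈ j) eq))
          ... | zero , j , inj₂ (≡.refl , eq) = inj₂ (≡.trans (≡.sym (unroll-vertex C₀ v∈ j))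
                  (f-back P (toℕ j) (2 ℕ.+ p-3 P ℕ.+ m) (≡.trans eq (≡.sym (periodic P m)))))
          open ΦG.Component P closed using (without; without⁻; without⁺)
          rest : CyclesAndIsolatedVertices G (without S) k
          rest = C ∘ suc
            , (λ i v on → without⁺ S (C∈ (suc i) v on) λ onP → disjoint zero (suc i) (λ ()) v (OnP⇒OnCycle onP , on))
            , (λ i j i≢j → disjoint (suc i) (suc j) (i≢j ∘ Fin.suc-injective))
            , λ u v u∈ v∈′ e → let u∈S , u∉ = without⁻ S u∈ in case edges u v u∈S (proj₁ (without⁻ S v∈′)) e of λ where
                (suc i , on) → i , on
                (zero , j , inj₁ (eq , _)) → contradiction (OnCycle⇒OnP C₀ v∈ (j , eq)) u∉
                (zero , j , inj₂ (_ , eq)) → contradiction (OnCycle⇒OnP C₀ v∈ (next j , eq)) u∉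
          ih = ranks-cycles k rest
          r = proj₁ ih
          rΦ = proj₁ (proj₂ ih)
          rG = proj₂ (proj₂ ih)
          p%4 = proj₁ (types C₀ v∈)
          q = p P / 4
          p≡ : p P ≡ 2 ℕ.+ q ℕ.* 4
          p≡ = order-form (p P) p%4
          prod≈-1 : prodN (weights P) (p P) ≈ - 1#
          prod≈-1 = proj₂ (types C₀ v∈)
          size : p P ℕ.+ (2 ℕ.* k ℕ.+ r) ≡ 2 ℕ.* suc k ℕ.+ (q ℕ.* 4 ℕ.+ r)
          size = ≡.trans (≡.cong (ℕ._+ (2 ℕ.* k ℕ.+ r)) p≡) (regroup (q ℕ.* 4) k r)
            where
            regroup : ∀ x k r → 2 ℕ.+ x ℕ.+ (2 ℕ.* k ℕ.+ r) ≡ 2 ℕ.* suc k ℕ.+ (x ℕ.+ r)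
            regroup = ℕ-solve-∀

        ranks-δ : ∀ {k S S₀} → Star (δ-Step G) S S₀ → Ranks k S₀ → Ranks k S
        ranks-δ nil rk = rk
        ranks-δ {k} (delete pend v∈ e ◅ steps) rk with ranks-δ {k} steps rk
        ... | r , rΦ , rG = 2 ℕ.+ r , Φ.rank-pendant (ΦG.isPendant pend′) rΦ
              , ≡.subst (𝔾.HasRankOn _) (shuffle k r) (𝔾.rank-pendant (𝔾G.isPendant pend′) rG)
          where
          pend′ = Pendant⇒Pend pend v∈ e
          shuffle : ∀ k r → 2 ℕ.+ (2 ℕ.* k ℕ.+ r) ≡ 2 ℕ.* k ℕ.+ (2 ℕ.+ r)
          shuffle = ℕ-solve-∀

-- Gain graphs and the theorem

module GainGraphs where

  import Algebra.Properties.Ring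
  import Data.Integer.Properties as ℤ
  open import Algebra.Bundles using (CommutativeRing)
  open import Data.Bool.Base using (true; false)
  open import Data.Bool.Properties using (T-irrelevant)
  open import Data.Fin.Subset using () renaming (⊤ to full)
  open import Data.Integer.Base as ℤ using (ℤ; +_)
  open import Data.Integer.Tactic.RingSolver using (solve-∀)
  open import Data.Nat.DivMod
  open import Data.Nat.Divisibility using (divides)
  open import Data.Nat.Induction using (<-wellFounded)
  open ComplexNumbers
  open Subsets
  open LinearAlgebra
  open InducedSubgraphs
  open CyclesAndBridges
  open WeightedGraphs
  open RankComparison

  module ℂR = CommutativeRing ℂ-commutativeRing
  open ℂR using () renaming (refl to ≈-refl; sym to ≈-sym; trans to ≈-trans; reflexive to ≈-reflexive; *-cong to *ℂ-cong; -‿cong to -ℂ-cong)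
  open Algebra.Properties.Ring ℂR.ring using (-1*x≈-x; -‿involutive)

  ℂ-domain : StableDomain
  ℂ-domain = record { commutativeRing = ℂ-commutativeRing ; ≈0-stable = ℂ-≈0-stable ; cancel = ℂ-cancel ; 1≉0 = 1≉0 }

  open Domain ℂ-domain
  open WeightedGraph ℂ-domain
  open Extremal ℂ-domain

  product≈prodN : ∀ k (t : Fin k → ℂ) (w : ℕ → ℂ) → (∀ i → t i ≈ℂ w (toℕ i)) → productℂ t ≈ℂ prodN w k
  product≈prodN zero    t w p = ≈-refl
  product≈prodN (suc k) t w p = *ℂ-cong (p zero) (product≈prodN k (t ∘ suc) (w ∘ suc) (p ∘ suc))

  -1^even : ∀ q → (-ℂ 1ℂ) ^ℂ (q ℕ.* 2) ≈ℂ 1ℂ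
  -1^even zero    = ≈-refl
  -1^even (suc q) = ≈-trans (*ℂ-cong (≈-refl {x = -ℂ 1ℂ}) (*ℂ-cong (≈-refl {x = -ℂ 1ℂ}) (-1^even q)))
    (≈-trans (-1*x≈-x _) (≈-trans (-ℂ-cong (-1*x≈-x _)) (-‿involutive 1ℂ)))

  -1^odd : ∀ q → (-ℂ 1ℂ) ^ℂ (suc (q ℕ.* 2)) ≈ℂ -ℂ 1ℂ
  -1^odd q = ≈-trans (*ℂ-cong (≈-refl {x = -ℂ 1ℂ}) (-1^even q)) (ℂR.*-identityʳ _)

  order-double : ∀ p → p % 4 ≡ 2 → p ≡ suc (p / 4 ℕ.* 2) ℕ.* 2
  order-double p eq = ≡.trans (order-form p eq) (≡.cong (2 ℕ.+_) (≡.sym (ℕ.*-assoc (p / 4) 2 2)))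

  -- For `p ≡ 2 (mod 4)` the number `p / 2` is odd, so being of Type A means having cycle gain -1.
  -1^order/2 : ∀ p → p % 4 ≡ 2 → (-ℂ 1ℂ) ^ℂ (p / 2) ≈ℂ -ℂ 1ℂ
  -1^order/2 p eq = ≈-trans (≈-reflexive (≡.cong ((-ℂ 1ℂ) ^ℂ_)
    (≡.trans (≡.cong (_/ 2) (order-double p eq)) (m*n/n≡m (suc (p / 4 ℕ.* 2)) 2)))) (-1^odd (p / 4))

  difference : ∀ k r {t} → + k ≡ t → + r ≡ + (2 ℕ.* k ℕ.+ r) ℤ.- + 2 ℤ.* t
  difference k r ≡.refl = ≡.trans (collapse (+ k) (+ r)) (≡.cong (λ x → x ℤ.+ + r ℤ.- + 2 ℤ.* + k) (≡.sym (ℤ.pos-* 2 k)))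
    where
    collapse : ∀ k r → r ≡ (+ 2 ℤ.* k ℤ.+ r) ℤ.- + 2 ℤ.* k
    collapse = solve-∀

  module Theorem {n : ℕ} (Φ : GainGraph n) where
    open GainGraph Φ renaming (graph to G)
    open Graph G
    open Induced G
    open Cycles G
    open GraphFacts G
    open PCycle

    gainMatrix-edge : ∀ {u v} (e : Adj u v) → gainMatrix Φ u v ≡ gain u v e
    gainMatrix-edge {u} {v} e with adj? u v
    ... | yes e′ = ≡.cong (gain u v) (T-irrelevant e′ e)
    ... | no ¬e  = contradiction e ¬e

    gainMatrix-off : ∀ {u v} → ¬ Adj u v → gainMatrix Φ u v ≈ℂ 0ℂ
    gainMatrix-off {u} {v} ¬e with adj? u v
    ... | yes e = contradiction e ¬e
    ... | no _  = ≈-refl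

    gain-weighted : Weighted G (gainMatrix Φ)
    gain-weighted = record
      { off = gainMatrix-off
      ; unit = λ {u} {v} e → ≈-trans
          (*ℂ-cong (≈-reflexive (gainMatrix-edge e)) (≈-trans (≈-reflexive (gainMatrix-edge (Adj-sym e))) (gain-conj u v e (Adj-sym e))))
          (unit*conj≈1 (gain u v e) (gain-unit u v e))
      }

    adjacency-edge : ∀ {u v} → Adj u v → adjacencyMatrix G u v ≈ℂ 1ℂ
    adjacency-edge {u} {v} e with true ← adj u v = ≈-refl

    adjacency-weighted : Weighted G (adjacencyMatrix G)
    adjacency-weighted = record
      { off = off
      ; unit = λ e → ≈-trans (*ℂ-cong (adjacency-edge e) (adjacency-edge (Adj-sym e))) (ℂR.*-identityˡ 1ℂ)
      }
      where
      off : ∀ {u v} → ¬ Adj u v → adjacencyMatrix G u v ≈ℂ 0ℂ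
      off {u} {v} ¬e with adj u v
      ... | true  = contradiction _ ¬e
      ... | false = ≈-refl

    private
      MΦ MG : Mat n n
      MΦ = gainMatrix Φ
      MG = adjacencyMatrix G

    open Comparison G MΦ MG gain-weighted adjacency-weighted adjacency-edge

    cycleGain≈ : ∀ {S} (C : Cycle G) (v∈ : ∀ i → Cycle.vertex C i ∈ S) →
      cycleGain Φ C ≈ℂ prodN (weights (unroll C v∈)) (Cycle.order C)
    cycleGain≈ C v∈ = product≈prodN (Cycle.order C) _ (weights (unroll C v∈)) λ i → ≈-reflexive
      (≡.trans (≡.sym (gainMatrix-edge (Cycle.edge C i))) (≡.cong (λ x → MΦ x (Cycle.vertex C (next i))) (≡.sym (unroll-vertex C v∈ i))))

    cycle-types : Opt full → ∀ C → TypeA Φ C × Cycle.order C % 4 ≡ 2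
    cycle-types opt C = (divides (suc (p₀ / 4 ℕ.* 2)) (order-double p₀ p%4)
        , ≈-trans (cycleGain≈ C (λ _ → ∈⊤)) (≈-trans (proj₂ cond) (≈-sym (-1^order/2 p₀ p%4)))) , p%4
      where
      p₀ = Cycle.order C
      cond = proj₁ (main full (<-wellFounded _) opt) (onFull C)
      p%4 = proj₁ cond

    cycle-weights : (∀ C → TypeA Φ C × Cycle.order C % 4 ≡ 2) → ∀ {S} C (v∈ : ∀ i → Cycle.vertex C i ∈ S) →
      Cycle.order C % 4 ≡ 2 × prodN (weights (unroll C v∈)) (Cycle.order C) ≈ℂ -ℂ 1ℂ
    cycle-weights types C v∈ = p%4 , ≈-trans (≈-sym (cycleGain≈ C v∈)) (≈-trans (proj₂ (proj₁ (types C))) (-1^order/2 (Cycle.order C) p%4))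
      where p%4 = proj₂ (types C)

    ranks⇒conditions : (∃[ rΦ ] ∃[ rG ] HasRank MΦ rΦ × HasRank MG rG × + rΦ ≡ + rG ℤ.- + 2 ℤ.* θ G) →
      CyclesPairwiseDisjoint G × (∀ C → TypeA Φ C × Cycle.order C % 4 ≡ 2)
        × (Σ[ G₀ ∈ Subset n ] Crucial G G₀ × (∃[ k ] + k ≡ θ G × CyclesAndIsolatedVertices G G₀ k))
    ranks⇒conditions (rΦ , rG , hΦ , hG , eq) = cactus⇒disjoint (opt-cactus opt) , cycle-types opt , crucial-subgraph opt
      where
      opt : Opt full
      -- Ranks are unique, so the equation for the given pair of ranks transfers to every pair, as
      -- `Opt` requires.
      opt a b = ≡.subst₂ (λ x y → x ℕ.+ 2 ℕ.* ec full ≡ y ℕ.+ 2 ℕ.* n)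
        (Φ.rank-unique (Φ.familyRank⇒rank hΦ) a) (𝔾.rank-unique (𝔾.familyRank⇒rank hG) b) (rank-equation eq)

    conditions⇒ranks : (∀ C → TypeA Φ C × Cycle.order C % 4 ≡ 2) →
      (Σ[ G₀ ∈ Subset n ] Crucial G G₀ × (∃[ k ] + k ≡ θ G × CyclesAndIsolatedVertices G G₀ k)) →
      ∃[ rΦ ] ∃[ rG ] HasRank MΦ rΦ × HasRank MG rG × + rΦ ≡ + rG ℤ.- + 2 ℤ.* θ G
    conditions⇒ranks types (G₀ , (path , _) , k , k≡θ , cycles) =
      let r , rΦ , rG = ranks-δ {k} path (ranks-cycles k cycles) in
      r , 2 ℕ.* k ℕ.+ r , Φ.rank⇒familyRank rΦ , 𝔾.rank⇒familyRank rG , difference k r k≡θ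
      where open Converse 1+1≉0 (cycle-weights types)

open import Data.Integer.Base using (+_; _-_; _*_)

theorem4p8 : ∀ (n : ℕ) (Φ : GainGraph n) → let G = GainGraph.graph Φ in
    (∃[ rΦ ] ∃[ rG ] HasRank (gainMatrix Φ) rΦ × HasRank (adjacencyMatrix G) rG × + rΦ ≡ + rG - + 2 * θ G)
    ⇔
    ( CyclesPairwiseDisjoint G
    × (∀ (C : Cycle G) → TypeA Φ C × Cycle.order C % 4 ≡ 2)
    × (Σ[ G₀ ∈ Subset n ] Crucial G G₀ × (∃[ k ] + k ≡ θ G × CyclesAndIsolatedVertices G G₀ k)))
theorem4p8 n Φ = mk⇔ ranks⇒conditions λ (_ , types , crucial) → conditions⇒ranks types crucial
  where open GainGraphs.Theorem Φ using (ranks⇒conditions; conditions⇒ranks)
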